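{- Let $n\ge2$ and fix $\varepsilon\in\{\pm1\}^n$. Let $H=\{x\in\mathbb R^n:\sum_i x_i=0\}$. For each mixed cobinary tree $T$ with $\varepsilon(T)=\varepsilon$, the intersection $\overline R(T)\cap H$ is the cone of an $(n-2)$-simplex whose $n-1$ sides are given by the equalities $x_{p_i}=x_{q_i}$ ($1\le i\le n-1$), one for each internal edge $\ell_i$ of $T$. As $T$ runs over the isomorphism classes of mixed cobinary trees with $\varepsilon(T)=\varepsilon$, the sets $\overline R(T)$ cover $\mathbb R^n$ and their interiors $R(T)$ are pairwise disjoint. Thus, intersecting with the unit sphere $S^{n-2}$ in the hyperplane $H$, one obtains a partition of the sphere (closed pieces covering the sphere, with pairwise disjoint interiors) into $C_n=\frac1{n+1}\binom{2n}{n}$ (spherical) simplices of dimension $n-2$.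
   Context: A mixed cobinary tree (MCT) with $n$ internal nodes is a finite tree $T$ linearly embedded in the $xy$-plane (vertices are points, edges are straight segments meeting only in common endpoints) such that: (1) $T$ has no horizontal edges. (2) The internal nodes (the vertices which are not leaves, a leaf being a vertex of degree one) have distinct $x$-coordinates, which are $1,2,\dots,n$; denote by $t_i$ the internal node with $x$-coordinate $i$. A neighbour (internal or leaf) of an internal node lying higher is called a parent of it, one lying lower a child of it. (3) Each internal node is either of positive type (a $\Lambda$-node), with two children and one parent, or of negative type (a V-node), with one child and two parents. (4) If $(x,y)$ is a positive node, then the vertical wall $\{(x,z): z<y\}$ is disjoint from $T$ and separates the two children of the node (one is to its left, one to its right). (5) If $(x,y)$ is a negative node, then the vertical wall $\{(x,z): z>y\}$ is disjoint from $T$ and separates the two parents of the node. The sign vector is $\varepsilon(T)=(\varepsilon_1,\dots,\varepsilon_n)$ with $\varepsilon_i=1$ if $t_i$ is a $\Lambda$-node and $\varepsilon_i=-1$ if $t_i$ is a V-node. The bottom-to-top partial order on the internal nodes is the one generated by "each child is below its parent". Two MCTs with the same sign vector are isomorphic if their underlying trees are isomorphic by an isomorphism under which corresponding internal nodes have the same left-to-right total order (i.e. $t_i\mapsto t_i$) and the same bottom-to-top partial order. The $n-1$ internal edges of $T$ (edges joining two internal nodes) are numbered $\ell_1,\dots,\ell_{n-1}$; $\ell_i$ joins $t_{p_i}$ to $t_{q_i}$ with $p_i<q_i$, and $\mathrm{sgn}(\ell_i)=\pm1$ is the sign of its slope. Put $R(T)=\{x\in\mathbb R^n: \mathrm{sgn}(\ell_i)(x_{q_i}-x_{p_i})>0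 \text{ for } 1\le i\le n-1\}$ and let $\overline R(T)$ be its closure. A cone of an $(n-2)$-simplex in $H$ is a set of all nonnegative linear combinations of the elements of a basis of the $(n-1)$-dimensional space $H$; its sides are its $n-1$ facets. -}

module Defs where

open import Algebra.Bundles using (CommutativeRing)
open import Data.Bool.Base using (Bool; true; false)
open import Data.Fin.Base as Fin using (Fin; toℕ)
open import Data.List.Base using (List; []; _∷_; _∷ʳ_; length)
open import Data.List.Membership.Propositional using (_∈_)
open import Data.List.Relation.Unary.Linked using (Linked)
open import Data.List.Relation.Unary.Unique.Propositional using (Unique)
open import Data.Nat.Base as ℕ using (ℕ; suc; pred)
open import Data.Nat.Combinatorics using (_C_)
open import Data.Nat.DivMod using (_/_)
open import Data.Product using (Σ-syntax; ∃; ∃-syntax; ∃!; _×_; _,_; proj₁; proj₂)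
open import Data.Sign.Base using (Sign)
open import Data.Sum.Base using (_⊎_; [_,_]′)
open import Data.Vec.Functional using (Vector)
open import Function.Base using (const)
open import Function.Bundles using (_⇔_; _↔_; Inverse)
open import Level using (0ℓ)
open import Relation.Binary.Construct.Closure.ReflexiveTransitive using (Star)
open import Relation.Binary.Core using (Rel)
open import Relation.Binary.Definitions using (Tri; tri<; tri≈; tri>)
open import Relation.Binary.PropositionalEquality.Core using (_≡_; _≢_)
open import Relation.Binary.Structures using (IsStrictTotalOrder)
open import Relation.Nullary.Negation.Core using (¬_)
open import Relation.Unary using (Pred; _∩_; _⊆_; _≐_; _⊥_)

import Algebra.Definitions.RawMonoid as RawMonoidDefinitions
import Relation.Binary.Construct.StrictToNonStrict as StrictToNonStrict

-- The classical real numbers, characterised axiomatically: a Dedekind complete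
-- linearly ordered field. Equality is the setoid equality of the ring.

record CompleteOrderedField : Set₁ where
  infix  4 _<_
  infix  8 _⁻¹
  field
    commutativeRing : CommutativeRing 0ℓ 0ℓ

  open CommutativeRing commutativeRing public

  field
    _<_                : Rel Carrier 0ℓ
    isStrictTotalOrder : IsStrictTotalOrder _≈_ _<_
    0<1                : 0# < 1#
    +-monoˡ-<          : ∀ z {x y} → x < y → x + z < y + z
    *-pos              : ∀ {x y} → 0# < x → 0# < y → 0# < x * y
    -- total, with an unspecified value at 0
    _⁻¹                : Carrier → Carrier
    *-inverseʳ         : ∀ {x} → ¬ (x ≈ 0#) → x * x ⁻¹ ≈ 1#

  open StrictToNonStrict _≈_ _<_ public using (_≤_)

  UpperBound : Pred Carrier 0ℓ → Pred Carrier 0ℓ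
  UpperBound P b = ∀ {x} → P x → x ≤ b

  field
    supremum : (P : Pred Carrier 0ℓ) → ∃ P → ∃ (UpperBound P) →
               ∃[ s ] UpperBound P s × (∀ {b} → UpperBound P b → s ≤ b)

HasSize : {A : Set} → ℕ → Pred A 0ℓ → Set
HasSize {A} k P =
  Σ[ xs ∈ List A ] Unique xs × length xs ≡ k × (∀ v → P v ⇔ v ∈ xs)

catalan : ℕ → ℕ
catalan n = ((2 ℕ.* n) C n) / suc n

record FiniteGraph : Set where
  field
    order     : ℕ
    adjacent  : Fin order → Fin order → Bool
    symmetric : ∀ u v → adjacent u v ≡ adjacent v u
    loopless  : ∀ v → adjacent v v ≡ false

  Vertex : Set
  Vertex = Fin order

  Adj : Rel Vertex 0ℓ
  Adj u v = adjacent u v ≡ true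

  Connected : Set
  Connected = ∀ u v → Star Adj u v

  Acyclic : Set
  Acyclic = ∀ {u v w} ws → Unique (u ∷ v ∷ w ∷ ws) →
            ¬ Linked Adj ((u ∷ v ∷ w ∷ ws) ∷ʳ u)

  IsTree : Set
  IsTree = Connected × Acyclic

  Leaf : Pred Vertex 0ℓ
  Leaf v = HasSize 1 (Adj v)

  Internal : Pred Vertex 0ℓ
  Internal v = ¬ Leaf v

module RealGeometry (𝓡 : CompleteOrderedField) where

  open CompleteOrderedField 𝓡
  open IsStrictTotalOrder isStrictTotalOrder using (compare)
  open RawMonoidDefinitions +-rawMonoid using (sum) renaming (_×_ to _·_)

  ℝ : Set
  ℝ = Carrier

  fromℕ : ℕ → ℝ
  fromℕ k = k · 1#

  sgn : ℝ → ℝ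
  sgn x with compare 0# x
  ... | tri< _ _ _ = 1#
  ... | tri≈ _ _ _ = 0#
  ... | tri> _ _ _ = - 1#

  ------------------------------------------------------------------------
  -- Mixed cobinary trees

  Point : Set
  Point = ℝ × ℝ

  infix 4 _≈ₚ_
  _≈ₚ_ : Rel Point 0ℓ
  (a , b) ≈ₚ (c , d) = a ≈ c × b ≈ d

  Segment : Point → Point → Pred Point 0ℓ
  Segment (a , b) (c , d) p =
    ∃[ s ] 0# ≤ s × s ≤ 1# × p ≈ₚ (a + s * (c - a) , b + s * (d - b))

  -- A finite tree whose vertices are placed in the plane; the conditions for
  -- this placement to be a linear embedding are collected in IsEmbedding.
  record PlacedTree : Set where
    field
      graph  : FiniteGraph
      isTree : FiniteGraph.IsTree graph

    open FiniteGraph graph public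

    field
      position : Vertex → Point

    xc yc : Vertex → ℝ
    xc v = proj₁ (position v)
    yc v = proj₂ (position v)

    Edge : Vertex → Vertex → Pred Point 0ℓ
    Edge u v = Segment (position u) (position v)

    -- The subset T of the plane. Every vertex of a tree with at least two
    -- vertices lies on an edge.
    Support : Pred Point 0ℓ
    Support p = ∃[ u ] ∃[ v ] Adj u v × Edge u v p

    record IsEmbedding : Set where
      field
        injective  : ∀ {u v} → position u ≈ₚ position v → u ≡ v
        edges-meet : ∀ {u v u′ v′ p} → Adj u v → Adj u′ v′ →
                     Edge u v p → Edge u′ v′ p →
                     ((u ≡ u′ × v ≡ v′) ⊎ (u ≡ v′ × v ≡ u′)) ⊎
                     (∃[ w ] (w ≡ u ⊎ w ≡ v) × (w ≡ u′ ⊎ w ≡ v′) ×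
                             p ≈ₚ position w)

    Child Parent : Vertex → Pred Vertex 0ℓ
    Child  v w = Adj v w × yc w < yc v
    Parent v w = Adj v w × yc v < yc w

    record IsΛ (v : Vertex) : Set where
      field
        children  : HasSize 2 (Child v)
        parents   : HasSize 1 (Parent v)
        wall      : ∀ {p} → Support p → ¬ (proj₁ p ≈ xc v × proj₂ p < yc v)
        separated : ∃[ l ] ∃[ r ] Child v l × Child v r ×
                    xc l < xc v × xc v < xc r

    record IsV (v : Vertex) : Set where
      field
        children  : HasSize 1 (Child v)
        parents   : HasSize 2 (Parent v)
        wall      : ∀ {p} → Support p → ¬ (proj₁ p ≈ xc v × yc v < proj₂ p)
        separated : ∃[ l ] ∃[ r ] Parent v l × Parent v r ×
                    xc l < xc v × xc v < xc r

  record MCT (n : ℕ) : Set where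
    field
      placedTree : PlacedTree

    open PlacedTree placedTree public

    field
      isEmbedding  : IsEmbedding
      noHorizontal : ∀ {u v} → Adj u v → ¬ (yc u ≈ yc v)
      -- node i is t_{i+1}, the internal node with x-coordinate i + 1
      node         : Fin n → Vertex
      nodeInternal : ∀ i → Internal (node i)
      nodeComplete : ∀ {v} → Internal v → ∃[ i ] node i ≡ v
      node-x       : ∀ i → xc (node i) ≈ fromℕ (suc (toℕ i))
      nodeType     : ∀ i → IsΛ (node i) ⊎ IsV (node i)

    signVector : Fin n → Sign
    signVector i = [ const Sign.+ , const Sign.- ]′ (nodeType i)

    infix 4 _⊑_
    _⊑_ : Rel (Fin n) 0ℓ
    _⊑_ = Star (λ i j → Child (node j) (node i))

    InternalEdge : Rel (Fin n) 0ℓ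
    InternalEdge p q = p Fin.< q × Adj (node p) (node q)

    slope : Fin n → Fin n → ℝ
    slope p q = (yc (node q) - yc (node p)) * (xc (node q) - xc (node p)) ⁻¹

    record EdgeNumbering : Set where
      field
        edgeLeft     : Fin (pred n) → Fin n
        edgeRight    : Fin (pred n) → Fin n
        internalEdge : ∀ k → InternalEdge (edgeLeft k) (edgeRight k)
        exhaustive   : ∀ {i j} → InternalEdge i j →
                       ∃! _≡_ (λ k → edgeLeft k ≡ i × edgeRight k ≡ j)

  open MCT public using (signVector; EdgeNumbering; module EdgeNumbering)
  open MCT.EdgeNumbering public using (edgeLeft; edgeRight)

  infix 4 _≅_
  record _≅_ {n : ℕ} (T T′ : MCT n) : Set where
    private
      module T  = MCT T
      module T′ = MCT T′
    field
      bijection : T.Vertex ↔ T′.Vertex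

    open Inverse bijection using (to)

    field
      preservesAdj   : ∀ u v → T.adjacent u v ≡ T′.adjacent (to u) (to v)
      preservesNode  : ∀ i → to (T.node i) ≡ T′.node i
      preservesOrder : ∀ i j → (i T.⊑ j) ⇔ (i T′.⊑ j)

  ------------------------------------------------------------------------
  -- Subsets of ℝⁿ

  ℝ^ : ℕ → Set
  ℝ^ n = Vector ℝ n

  Near : ∀ {n} → ℝ → Rel (ℝ^ n) 0ℓ
  Near δ x y = ∀ i → - δ < y i - x i × y i - x i < δ

  Closure : ∀ {n} → Pred (ℝ^ n) 0ℓ → Pred (ℝ^ n) 0ℓ
  Closure P x = ∀ {δ} → 0# < δ → ∃[ y ] Near δ x y × P y

  Interior : ∀ {n} → Pred (ℝ^ n) 0ℓ → Pred (ℝ^ n) 0ℓ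
  Interior P x = ∃[ δ ] 0# < δ × (∀ {y} → Near δ x y → P y)

  RelativeInterior : ∀ {n} → Pred (ℝ^ n) 0ℓ → Pred (ℝ^ n) 0ℓ → Pred (ℝ^ n) 0ℓ
  RelativeInterior S P x =
    S x × (∃[ δ ] 0# < δ × (∀ {y} → S y → Near δ x y → P y))

  H : ∀ n → Pred (ℝ^ n) 0ℓ
  H n x = sum x ≈ 0#

  Sphere : ∀ n → Pred (ℝ^ n) 0ℓ
  Sphere n x = H n x × sum (λ i → x i * x i) ≈ 1#

  combination : ∀ {m n} → (Fin m → ℝ) → (Fin m → ℝ^ n) → ℝ^ n
  combination c b i = sum (λ j → c j * b j i)

  record IsBasisOf {m n} (V : Pred (ℝ^ n) 0ℓ) (b : Fin m → ℝ^ n) : Set where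
    field
      members     : ∀ j → V (b j)
      independent : ∀ c → (∀ i → combination c b i ≈ 0#) → ∀ j → c j ≈ 0#
      spanning    : ∀ {x} → V x → ∃[ c ] (∀ i → x i ≈ combination c b i)

  Cone : ∀ {m n} → (Fin m → ℝ^ n) → Pred (ℝ^ n) 0ℓ
  Cone b x = ∃[ c ] (∀ j → 0# ≤ c j) × (∀ i → x i ≈ combination c b i)

  -- The side of the simplicial cone Cone b opposite to the j-th generator.
  Side : ∀ {m n} → (Fin m → ℝ^ n) → Fin m → Pred (ℝ^ n) 0ℓ
  Side b j x =
    ∃[ c ] (∀ k → 0# ≤ c k) × c j ≈ 0# × (∀ i → x i ≈ combination c b i)

  IsSphericalSimplex : ∀ {n} → Pred (ℝ^ n) 0ℓ → Set
  IsSphericalSimplex {n} P =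
    Σ[ b ∈ (Fin (pred n) → ℝ^ n) ] IsBasisOf (H n) b × P ≐ (Cone b ∩ Sphere n)

  record IsPartition {m n} (S : Pred (ℝ^ n) 0ℓ)
                     (piece : Fin m → Pred (ℝ^ n) 0ℓ) : Set where
    field
      within   : ∀ i → piece i ⊆ S
      closed   : ∀ i → (Closure (piece i) ∩ S) ⊆ piece i
      covers   : ∀ {x} → S x → ∃[ i ] piece i x
      distinct : ∀ {i j} → i ≢ j → ¬ (piece i ≐ piece j)
      disjoint : ∀ {i j} → i ≢ j →
                 RelativeInterior S (piece i) ⊥ RelativeInterior S (piece j)

  Equaliser : ∀ {n} → Fin n → Fin n → Pred (ℝ^ n) 0ℓ
  Equaliser p q x = x p ≈ x q

  R : ∀ {n} → MCT n → Pred (ℝ^ n) 0ℓ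
  R T x = ∀ {p q} → MCT.InternalEdge T p q →
          0# < sgn (MCT.slope T p q) * (x q - x p)

  R̄ : ∀ {n} → MCT n → Pred (ℝ^ n) 0ℓ
  R̄ T = Closure (R T)

{-# OPTIONS --safe #-}
-- On a path without backtracking, a change of vertical direction happens at a
-- node whose wall the path never crosses again; hence the turning points of a
-- path move monotonically to the left or to the right. It follows that for an
-- edge from i up to j every Λ-node strictly between i and j is below i in the
-- tree order and every V-node above j, and from this that a tree is determined
-- by its signs and any linear extension of its order: R(T) and R(T′) are disjoint
-- unless T ≅ T′. Conversely, all heights occur: insert the nodes from left to
-- right, each time subdividing the rightmost polyline of the tree. The
-- differences of coordinates along the n - 1 edges are coordinates on H, which
-- makes the cones simplicial.
--
-- For the count, let m be the rightmost node of a tree. In the order "Λ-nodes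
-- from right to left, then V-nodes from left to right" the nodes on the lower
-- side of m come before those on the upper side, so only their number is free.
-- Recursively, isomorphism classes correspond to binary trees with n nodes,
-- whatever the signs.

module Submission where

open import Defs
open import Data.Empty using (⊥-elim)
open import Data.Fin.Base as Fin using (Fin; zero; suc; toℕ)
import Data.Fin.Properties as Finₚ
open import Data.List.Base using (List; []; _∷_; _++_; length; map; filter)
open import Data.List.Membership.Propositional using (_∈_)
import Data.List.Membership.Propositional.Properties as ∈ₚ
import Data.List.Properties as Listₚ
open import Data.List.Relation.Unary.All as All using (All; []; _∷_)
import Data.List.Relation.Unary.All.Properties as Allₚ
open import Data.List.Relation.Unary.AllPairs as AllPairs using (AllPairs; []; _∷_)
import Data.List.Relation.Unary.AllPairs.Properties as AllPairsₚ
open import Data.List.Relation.Unary.Any as Any using (Any; here; there)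
open import Data.List.Relation.Unary.Unique.Propositional using (Unique)
import Data.List.Relation.Unary.Unique.Propositional.Properties as Uniqueₚ
open import Data.Nat.Base as ℕ using (ℕ; zero; suc; z≤n; s≤s)
import Data.Nat.Properties as ℕₚ
open import Data.Product using (∃-syntax; ∃; ∃!; _×_; _,_; proj₁; proj₂; Σ-syntax)
open import Data.Sign.Base as Sign using (Sign)
open import Data.Sum.Base as Sum using (_⊎_; inj₁; inj₂)
open import Level using (0ℓ)
open import Relation.Binary.Core using (Rel)
open import Relation.Binary.Definitions using (tri<; tri≈; tri>)
open import Relation.Binary.PropositionalEquality.Core as ≡ using (_≡_; _≢_; _≗_)
open import Relation.Nullary using (¬_; Dec; yes; no)
open import Relation.Unary using (Pred; _∩_; _⊆_; _≐_; _⊥_)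

-- The internal nodes of a given `MCT` and the vertices of a tree under construction are both seen
-- only through `Cobinary`, which records what the walls and the two sides of a node say about
-- single edges. Unique paths follow from these local rules, so the rules also certify that a
-- constructed graph is a tree. `dual` and `mirror` supply the symmetric variants of each argument.
--
-- Slopes disappear early: `R T` consists of the vectors that increase along every edge directed
-- upwards. The heights of the nodes form such a vector, and perturbing along or against it computes
-- the closure, the interior and, on the sphere, the relative interior.
--
-- A constructed tree is embedded without any study of slopes: two edges are always separated by a
-- horizontal line or by the vertical line through a node.
--
-- In the count, a binary tree encodes one linear order by cuts, whereas a tree in the plane has its
-- own cuts, given by the directions in which paths leave a node. `Code` and `Fits` keep the two
-- apart, and `code-fits` identifies them as soon as the encoded order extends the tree order.

module Fields where

  open import Algebra.Bundles using (RawRing)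
  open import Data.Maybe.Base using (just; nothing)
  open import Function.Base using (_∘_)
  open import Relation.Binary.Structures using (IsStrictTotalOrder)
  open import Algebra.Solver.Ring.AlmostCommutativeRing
  import Algebra.Definitions.RawMonoid
  import Algebra.Properties.Ring
  import Algebra.Properties.Semiring.Mult
  import Algebra.Properties.Semiring.Sum
  import Algebra.Properties.Monoid.Mult
  import Algebra.Solver.Ring
  import Relation.Binary.Reasoning.Setoid

  -- Arithmetic, square roots and finite sums in a complete ordered field

  module OrderedField (𝓡 : CompleteOrderedField) where
    open CompleteOrderedField 𝓡 public hiding (zero)
    open RealGeometry 𝓡 using (ℝ; ℝ^; fromℕ; sgn)
    open IsStrictTotalOrder isStrictTotalOrder public
      using (compare; <-resp-≈; <-respˡ-≈; <-respʳ-≈)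
      renaming (trans to <-trans; irrefl to <-irrefl; asym to <-asym; _≟_ to _≈?_; _<?_ to _<?_)
    module RP = Algebra.Properties.Ring ring
    open Algebra.Properties.Semiring.Sum semiring public
      using (sum; sum-cong-≋; ∑-distrib-+; *-distribˡ-sum; *-distribʳ-sum; sum-replicate; ∑-comm)
    open Algebra.Properties.Semiring.Mult semiring public using (×1-homo-*; ×-homo-+) renaming (_×_ to _·_)
    private
      module SR = Relation.Binary.Reasoning.Setoid setoid

    -- Integer coefficients for the ring solver, as formal differences of naturals.
    private
      reduce : ℕ × ℕ → ℕ × ℕ
      -- Cancelling gives each coefficient a unique representative, so that equal polynomials have
      -- identical normal forms and `refl` can close `solve`.
      reduce (suc a , suc b) = reduce (a , b)
      reduce (a , b)         = a , b

      difference : RawRing _ _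
      difference = record
        { Carrier = ℕ × ℕ ; _≈_ = _≡_
        ; _+_ = λ { (a , b) (c , d) → reduce (a ℕ.+ c , b ℕ.+ d) }
        ; _*_ = λ { (a , b) (c , d) → reduce (a ℕ.* c ℕ.+ b ℕ.* d , a ℕ.* d ℕ.+ b ℕ.* c) }
        ; -_ = λ { (a , b) → b , a } ; 0# = 0 , 0 ; 1# = 1 , 0 }

      ⟦_⟧ : ℕ × ℕ → Carrier
      ⟦ a , b ⟧ = a · 1# - b · 1#

      swap-middle : ∀ a b c d → (a + b) + (c + d) ≈ (a + c) + (b + d)
      swap-middle a b c d = begin
        (a + b) + (c + d)  ≈⟨ +-assoc a b (c + d) ⟩
        a + (b + (c + d))  ≈⟨ +-congˡ (trans (sym (+-assoc b c d)) (trans (+-congʳ (+-comm b c)) (+-assoc c b d))) ⟩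
        a + (c + (b + d))  ≈⟨ +-assoc a c (b + d) ⟨
        (a + c) + (b + d)  ∎
        where open SR

      ⟦⟧-reduce : ∀ x → ⟦ reduce x ⟧ ≈ ⟦ x ⟧
      ⟦⟧-reduce (zero , b)      = refl
      ⟦⟧-reduce (suc a , zero)  = refl
      ⟦⟧-reduce (suc a , suc b) = trans (⟦⟧-reduce (a , b)) (begin
        A - B                    ≈⟨ +-identityˡ _ ⟨
        0# + (A - B)             ≈⟨ +-congʳ (-‿inverseʳ 1#) ⟨
        (1# - 1#) + (A - B)      ≈⟨ swap-middle _ _ _ _ ⟩
        (1# + A) + (- 1# - B)    ≈⟨ +-congˡ (RP.-‿+-comm 1# B) ⟩
        (1# + A) - (1# + B)      ∎)
        where
        open SR
        A = a · 1#
        B = b · 1#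

      ⟦⟧-+ : ∀ x y → ⟦ RawRing._+_ difference x y ⟧ ≈ ⟦ x ⟧ + ⟦ y ⟧
      ⟦⟧-+ (a , b) (c , d) = trans (⟦⟧-reduce (a ℕ.+ c , b ℕ.+ d)) (begin
        (a ℕ.+ c) · 1# - (b ℕ.+ d) · 1#                ≈⟨ +-cong (×-homo-+ 1# a c) (-‿cong (×-homo-+ 1# b d)) ⟩
        (a · 1# + c · 1#) - (b · 1# + d · 1#)          ≈⟨ +-congˡ (RP.-‿+-comm (b · 1#) (d · 1#)) ⟨
        (a · 1# + c · 1#) + (- (b · 1#) + - (d · 1#))  ≈⟨ swap-middle _ _ _ _ ⟩
        ⟦ a , b ⟧ + ⟦ c , d ⟧                          ∎)
        where open SR

      ⟦⟧-* : ∀ x y → ⟦ RawRing._*_ difference x y ⟧ ≈ ⟦ x ⟧ * ⟦ y ⟧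
      ⟦⟧-* (a , b) (c , d) = trans (⟦⟧-reduce (a ℕ.* c ℕ.+ b ℕ.* d , a ℕ.* d ℕ.+ b ℕ.* c)) (begin
        (a ℕ.* c ℕ.+ b ℕ.* d) · 1# - (a ℕ.* d ℕ.+ b ℕ.* c) · 1#
          ≈⟨ +-cong (hom a c b d) (-‿cong (hom a d b c)) ⟩
        (A * C + B * D) - (A * D + B * C)              ≈⟨ +-congˡ (RP.-‿+-comm (A * D) (B * C)) ⟨
        (A * C + B * D) + (- (A * D) + - (B * C))      ≈⟨ swap-middle _ _ _ _ ⟩
        (A * C - A * D) + (B * D - B * C)              ≈⟨ +-cong (expand A C D) second ⟩
        A * (C - D) + - B * (C - D)                    ≈⟨ distribʳ (C - D) A (- B) ⟨
        (A - B) * (C - D)                              ∎)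
        where
        open SR
        A = a · 1#
        B = b · 1#
        C = c · 1#
        D = d · 1#
        hom : ∀ p q r s → (p ℕ.* q ℕ.+ r ℕ.* s) · 1# ≈ (p · 1#) * (q · 1#) + (r · 1#) * (s · 1#)
        hom p q r s = trans (×-homo-+ 1# (p ℕ.* q) (r ℕ.* s)) (+-cong (×1-homo-* p q) (×1-homo-* r s))
        expand : ∀ x y z → x * y - x * z ≈ x * (y - z)
        expand x y z = trans (+-congˡ (RP.-‿distribʳ-* x z)) (sym (distribˡ x y (- z)))
        second : B * D - B * C ≈ - B * (C - D)
        second = begin
          B * D - B * C          ≈⟨ +-comm _ _ ⟩
          - (B * C) + B * D      ≈⟨ +-cong (RP.-‿distribˡ-* B C) (sym (RP.-‿involutive (B * D))) ⟩
          - B * C + - (- (B * D)) ≈⟨ +-congˡ (-‿cong (RP.-‿distribˡ-* B D)) ⟩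
          - B * C - - B * D      ≈⟨ expand (- B) C D ⟩
          - B * (C - D)          ∎

      -- Agrees with ⟦_⟧; the literals 0 and 1 must denote 0# and 1# on the nose.
      ⟦_⟧′ : ℕ × ℕ → Carrier
      ⟦ 0 , 0 ⟧′ = 0#
      ⟦ 1 , 0 ⟧′ = 1#
      ⟦ a , b ⟧′ = ⟦ a , b ⟧

      ⟦⟧′≈⟦⟧ : ∀ x → ⟦ x ⟧′ ≈ ⟦ x ⟧
      ⟦⟧′≈⟦⟧ (0 , 0)              = sym (-‿inverseʳ 0#)
      ⟦⟧′≈⟦⟧ (1 , 0)              = sym (trans (+-congˡ RP.-0#≈0#) (trans (+-identityʳ _) (+-identityʳ 1#)))
      ⟦⟧′≈⟦⟧ (suc (suc _) , 0)    = refl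
      ⟦⟧′≈⟦⟧ (0 , suc _)          = refl
      ⟦⟧′≈⟦⟧ (1 , suc _)          = refl
      ⟦⟧′≈⟦⟧ (suc (suc _) , suc _) = refl

      morphism : difference -Raw-AlmostCommutative⟶ fromCommutativeRing commutativeRing
      morphism = record
        { ⟦_⟧ = ⟦_⟧′
        ; +-homo = λ x y → trans (⟦⟧′≈⟦⟧ (RawRing._+_ difference x y))
                                 (trans (⟦⟧-+ x y) (sym (+-cong (⟦⟧′≈⟦⟧ x) (⟦⟧′≈⟦⟧ y))))
        ; *-homo = λ x y → trans (⟦⟧′≈⟦⟧ (RawRing._*_ difference x y))
                                 (trans (⟦⟧-* x y) (sym (*-cong (⟦⟧′≈⟦⟧ x) (⟦⟧′≈⟦⟧ y))))
        ; -‿homo = λ { (a , b) → trans (⟦⟧′≈⟦⟧ (b , a))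
                                 (trans (sym (RP.⁻¹-anti-homo‿- (a · 1#) (b · 1#))) (-‿cong (sym (⟦⟧′≈⟦⟧ (a , b))))) }
        ; 0-homo = refl
        ; 1-homo = refl }

      coefficient-equality : ∀ (x y : ℕ × ℕ) → _
      coefficient-equality (a , b) (c , d) with a ℕ.+ d ℕₚ.≟ c ℕ.+ b
      ... | no  _  = nothing
      ... | yes eq = just (trans (⟦⟧′≈⟦⟧ (a , b)) (trans eq′ (sym (⟦⟧′≈⟦⟧ (c , d)))))
        where
        open Relation.Binary.Reasoning.Setoid setoid
        A = a · 1#
        B = b · 1#
        C = c · 1#
        D = d · 1#
        A+D≈C+B : A + D ≈ C + B
        A+D≈C+B = trans (sym (×-homo-+ 1# a d)) (trans (reflexive (≡.cong (_· 1#) eq)) (×-homo-+ 1# c b))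
        eq′ : A - B ≈ C - D
        eq′ = begin
          A - B                  ≈⟨ +-identityʳ _ ⟨
          (A - B) + 0#           ≈⟨ +-congˡ (-‿inverseʳ D) ⟨
          (A - B) + (D - D)      ≈⟨ swap-middle _ _ _ _ ⟩
          (A + D) + (- B - D)    ≈⟨ +-congʳ A+D≈C+B ⟩
          (C + B) + (- B - D)    ≈⟨ swap-middle _ _ _ _ ⟩
          (C - B) + (B - D)      ≈⟨ swap-middle _ _ _ _ ⟩
          (C + B) + (- B - D)    ≈⟨ +-congˡ (+-comm _ _) ⟩
          (C + B) + (- D - B)    ≈⟨ swap-middle _ _ _ _ ⟩
          (C - D) + (B - B)      ≈⟨ +-congˡ (-‿inverseʳ B) ⟩
          (C - D) + 0#           ≈⟨ +-identityʳ _ ⟩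
          C - D                  ∎

    open Algebra.Solver.Ring difference (fromCommutativeRing commutativeRing) morphism coefficient-equality public
      using (solve; _:=_; _:+_; _:*_; :-_; _:-_; con)

    private
      variable
        x y z w a b c d : Carrier

    abstract
      <-diff : x < y → 0# < y - x
      <-diff {x} {y} x<y = <-respˡ-≈ (-‿inverseʳ x) (+-monoˡ-< (- x) x<y)

      <-by : 0# < a → a ≈ y - x → x < y
      <-by {a} {y} {x} 0<a eq = <-respʳ-≈ (trans (+-congʳ eq) (solve 2 (λ x y → y :- x :+ x := y) refl x y))
                                         (<-respˡ-≈ (+-identityˡ x) (+-monoˡ-< x 0<a))

      <⇒≤ : x < y → x ≤ y
      <⇒≤ = inj₁

      ≈⇒≤ : x ≈ y → x ≤ y
      ≈⇒≤ = inj₂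

      ≤-refl : x ≤ x
      ≤-refl = inj₂ refl

      <-≤-trans : x < y → y ≤ z → x < z
      <-≤-trans p (inj₁ q) = <-trans p q
      <-≤-trans p (inj₂ q) = <-respʳ-≈ q p

      ≤-<-trans : x ≤ y → y < z → x < z
      ≤-<-trans (inj₁ p) q = <-trans p q
      ≤-<-trans (inj₂ p) q = <-respˡ-≈ (sym p) q

      ≤-trans : x ≤ y → y ≤ z → x ≤ z
      ≤-trans (inj₁ p) q        = inj₁ (<-≤-trans p q)
      ≤-trans (inj₂ p) (inj₁ q) = inj₁ (<-respˡ-≈ (sym p) q)
      ≤-trans (inj₂ p) (inj₂ q) = inj₂ (trans p q)

      ≤-resp-≈ : x ≈ y → z ≈ w → x ≤ z → y ≤ w
      ≤-resp-≈ p q r = ≤-trans (inj₂ (sym p)) (≤-trans r (inj₂ q))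

      ≤⇒≯ : x ≤ y → ¬ (y < x)
      ≤⇒≯ x≤y y<x = <-irrefl refl (≤-<-trans x≤y y<x)

      ≮⇒≥ : ¬ (x < y) → y ≤ x
      ≮⇒≥ {x} {y} x≮y with compare x y
      ... | tri< x<y _ _ = ⊥-elim (x≮y x<y)
      ... | tri≈ _ x≈y _ = inj₂ (sym x≈y)
      ... | tri> _ _ y<x = inj₁ y<x

      ≤-antisym : x ≤ y → y ≤ x → x ≈ y
      ≤-antisym (inj₁ p) q = ⊥-elim (≤⇒≯ q p)
      ≤-antisym (inj₂ p) q = p

      <⊎≥ : ∀ x y → x < y ⊎ y ≤ x
      <⊎≥ x y with compare x y
      ... | tri< x<y _ _ = inj₁ x<y
      ... | tri≈ _ x≈y _ = inj₂ (inj₂ (sym x≈y))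
      ... | tri> _ _ y<x = inj₂ (inj₁ y<x)

      ≤-diff : x ≤ y → 0# ≤ y - x
      ≤-diff (inj₁ p)     = inj₁ (<-diff p)
      ≤-diff {x} (inj₂ p) = inj₂ (sym (trans (+-congʳ (sym p)) (-‿inverseʳ x)))

      ≤-by : 0# ≤ a → a ≈ y - x → x ≤ y
      ≤-by (inj₁ p) eq = inj₁ (<-by p eq)
      ≤-by {a} {y} {x} (inj₂ p) eq = inj₂ (trans (trans (solve 2 (λ x y → x := y :- (y :- x)) refl x y)
        (+-congˡ (-‿cong (trans (sym eq) (sym p))))) (trans (+-congˡ RP.-0#≈0#) (+-identityʳ y)))

      +-pos : 0# < x → 0# < y → 0# < x + y
      +-pos {x} {y} p q = <-trans q (<-by p (solve 2 (λ x y → x := x :+ y :- y) refl x y))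

      +-pos-nonneg : 0# < x → 0# ≤ y → 0# < x + y
      +-pos-nonneg p (inj₁ q) = +-pos p q
      +-pos-nonneg {x} {y} p (inj₂ q) = <-respʳ-≈ (trans (sym (+-identityʳ x)) (+-congˡ q)) p

      +-nonneg : 0# ≤ x → 0# ≤ y → 0# ≤ x + y
      +-nonneg (inj₁ p) q = inj₁ (+-pos-nonneg p q)
      +-nonneg {x} {y} (inj₂ p) q = ≤-resp-≈ refl (trans (sym (+-identityˡ y)) (+-congʳ p)) q

      *-nonneg : 0# ≤ x → 0# ≤ y → 0# ≤ x * y
      *-nonneg (inj₁ p) (inj₁ q) = inj₁ (*-pos p q)
      *-nonneg {x} {y} (inj₂ p) q = inj₂ (sym (trans (*-congʳ (sym p)) (zeroˡ y)))
      *-nonneg {x} {y} (inj₁ _) (inj₂ q) = inj₂ (sym (trans (*-congˡ (sym q)) (zeroʳ x)))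

      neg-pos : x < 0# → 0# < - x
      neg-pos {x} p = <-respʳ-≈ (+-identityˡ (- x)) (<-diff p)

      *-monoˡ-< : 0# < z → x < y → z * x < z * y
      *-monoˡ-< {z} {x} {y} p q =
        <-by (*-pos p (<-diff q)) (solve 3 (λ x y z → z :* (y :- x) := z :* y :- z :* x) refl x y z)

      *-monoˡ-≤ : 0# ≤ z → x ≤ y → z * x ≤ z * y
      *-monoˡ-≤ {z} {x} {y} p q =
        ≤-by (*-nonneg p (≤-diff q)) (solve 3 (λ x y z → z :* (y :- x) := z :* y :- z :* x) refl x y z)

      *-cancelˡ-< : 0# ≤ z → z * x < z * y → x < y
      *-cancelˡ-< {z} {x} {y} p q with <⊎≥ x y
      ... | inj₁ x<y = x<y
      ... | inj₂ y≤x = ⊥-elim (≤⇒≯ (*-monoˡ-≤ p y≤x) q)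

      sq-nonneg : ∀ x → 0# ≤ x * x
      sq-nonneg x with compare 0# x
      ... | tri< p _ _ = inj₁ (*-pos p p)
      ... | tri≈ _ p _ = inj₂ (sym (trans (*-congʳ (sym p)) (zeroˡ x)))
      ... | tri> _ _ p = inj₁ (<-respʳ-≈ (solve 1 (λ x → :- x :* :- x := x :* x) refl x) (*-pos (neg-pos p) (neg-pos p)))

      sq-pos : ¬ (x ≈ 0#) → 0# < x * x
      sq-pos {x} x≉0 with compare 0# x
      ... | tri< p _ _ = *-pos p p
      ... | tri≈ _ p _ = ⊥-elim (x≉0 (sym p))
      ... | tri> _ _ p = <-respʳ-≈ (solve 1 (λ x → :- x :* :- x := x :* x) refl x) (*-pos (neg-pos p) (neg-pos p))

      pos⇒≉0 : 0# < x → ¬ (x ≈ 0#)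
      pos⇒≉0 p q = <-irrefl (sym q) p

      -- If x⁻¹ ≤ 0 then 1 = x x⁻¹ ≤ 0.
      ⁻¹-pos : 0# < x → 0# < x ⁻¹
      ⁻¹-pos {x} p with <⊎≥ 0# (x ⁻¹)
      ... | inj₁ q = q
      ... | inj₂ q = ⊥-elim (≤⇒≯ (≤-resp-≈ (*-inverseʳ (pos⇒≉0 p)) (zeroʳ x) (*-monoˡ-≤ (<⇒≤ p) q)) 0<1)

      ⁻¹-* : 0# < x → (y * x ⁻¹) * x ≈ y
      ⁻¹-* {x} {y} p = trans (solve 3 (λ x y i → (y :* i) :* x := y :* (x :* i)) refl x y (x ⁻¹))
                             (trans (*-congˡ (*-inverseʳ (pos⇒≉0 p))) (*-identityʳ y))

      *-cancel-0 : ¬ (x ≈ 0#) → x * y ≈ 0# → y ≈ 0#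
      *-cancel-0 {x} {y} p q = begin
        y               ≈⟨ *-identityʳ y ⟨
        y * 1#          ≈⟨ *-congˡ (*-inverseʳ p) ⟨
        y * (x * x ⁻¹)  ≈⟨ solve 3 (λ x y i → y :* (x :* i) := (x :* y) :* i) refl x y (x ⁻¹) ⟩
        (x * y) * x ⁻¹  ≈⟨ *-congʳ q ⟩
        0# * x ⁻¹       ≈⟨ zeroˡ _ ⟩
        0#              ∎
        where open SR

      2# : Carrier
      2# = 1# + 1#

      0<2 : 0# < 2#
      0<2 = +-pos 0<1 0<1

      ½ : Carrier
      ½ = 2# ⁻¹

      0<½ : 0# < ½
      0<½ = ⁻¹-pos 0<2

      ½+½ : ½ + ½ ≈ 1#
      ½+½ = trans (solve 2 (λ h o → h :+ h := (con (1 , 0) :+ con (1 , 0)) :* h) refl ½ 1#) (*-inverseʳ (pos⇒≉0 0<2))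

      halves : ½ * x + ½ * x ≈ x
      halves {x} = trans (sym (distribʳ x ½ ½)) (trans (*-congʳ ½+½) (*-identityˡ x))

      fromℕ-suc : ∀ m → fromℕ m < fromℕ (suc m)
      fromℕ-suc m = <-by 0<1 (solve 2 (λ o m → o := o :+ m :- m) refl 1# (fromℕ m))

      fromℕ-mono-< : ∀ {m n} → m ℕ.< n → fromℕ m < fromℕ n
      fromℕ-mono-< {m} {suc n} (ℕ.s≤s m≤n) with ℕₚ.m≤n⇒m<n∨m≡n m≤n
      ... | inj₁ m<n    = <-trans (fromℕ-mono-< m<n) (fromℕ-suc n)
      ... | inj₂ ≡.refl = fromℕ-suc n

      fromℕ-mono-≤ : ∀ {m n} → m ℕ.≤ n → fromℕ m ≤ fromℕ n
      fromℕ-mono-≤ m≤n with ℕₚ.m≤n⇒m<n∨m≡n m≤n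
      ... | inj₁ m<n    = inj₁ (fromℕ-mono-< m<n)
      ... | inj₂ ≡.refl = ≤-refl

      fromℕ-cancel-< : ∀ {m n} → fromℕ m < fromℕ n → m ℕ.< n
      fromℕ-cancel-< {m} {n} p with m ℕₚ.<? n
      ... | yes q = q
      ... | no ¬q = ⊥-elim (≤⇒≯ (fromℕ-mono-≤ {n} {m} (ℕₚ.≮⇒≥ ¬q)) p)

      fromℕ-injective : ∀ {m n} → fromℕ m ≈ fromℕ n → m ≡ n
      fromℕ-injective {m} {n} p with ℕₚ.<-cmp m n
      ... | tri< q _ _ = ⊥-elim (<-irrefl p (fromℕ-mono-< {m} {n} q))
      ... | tri≈ _ q _ = q
      ... | tri> _ _ q = ⊥-elim (<-irrefl (sym p) (fromℕ-mono-< {n} {m} q))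

      0<fromℕ-suc : ∀ m → 0# < fromℕ (suc m)
      0<fromℕ-suc m = fromℕ-mono-< {0} {suc m} (ℕ.s≤s ℕ.z≤n)

      sgn-pos : 0# < x → sgn x ≡ 1#
      sgn-pos {x} p with compare 0# x
      ... | tri< _ _ _ = ≡.refl
      ... | tri≈ ¬p _ _ = ⊥-elim (¬p p)
      ... | tri> ¬p _ _ = ⊥-elim (¬p p)

      sgn-neg : x < 0# → sgn x ≡ - 1#
      sgn-neg {x} p with compare 0# x
      ... | tri< _ _ ¬p = ⊥-elim (¬p p)
      ... | tri≈ _ _ ¬p = ⊥-elim (¬p p)
      ... | tri> _ _ _ = ≡.refl

      min-family : ∀ {n} (f : Fin n → Carrier) → (∀ i → 0# < f i) → ∃[ δ ] 0# < δ × (∀ i → δ ≤ f i)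
      min-family {zero}  f pos = 1# , 0<1 , λ ()
      min-family {suc n} f pos with min-family (f ∘ suc) (pos ∘ suc)
      ... | δ , 0<δ , δ≤ with <⊎≥ δ (f zero)
      ...   | inj₁ p = δ , 0<δ , λ { zero → <⇒≤ p ; (suc i) → δ≤ i }
      ...   | inj₂ p = f zero , pos zero , λ { zero → ≤-refl ; (suc i) → ≤-trans p (δ≤ i) }

      min₂ : 0# < a → 0# < b → ∃[ δ ] 0# < δ × δ ≤ a × δ ≤ b
      min₂ {a} {b} p q with <⊎≥ a b
      ... | inj₁ r = a , p , ≤-refl , <⇒≤ r
      ... | inj₂ r = b , q , r , ≤-refl

      bound : ∀ x → ∃[ m ] 0# < m × - m < x × x < m
      bound x with <⊎≥ 0# x
      ... | inj₁ p = x + 1# , +-pos p 0<1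
          , <-by (+-pos (+-pos p p) 0<1) (solve 1 (λ x → x :+ x :+ con (1 , 0) := x :- :- (x :+ con (1 , 0))) refl x)
          , <-by 0<1 (solve 1 (λ x → con (1 , 0) := x :+ con (1 , 0) :- x) refl x)
      ... | inj₂ p = - x + 1# , 0<-x+1
          , <-by 0<1 (solve 1 (λ x → con (1 , 0) := x :- :- (:- x :+ con (1 , 0))) refl x)
          , ≤-<-trans p 0<-x+1
          where
          0<-x+1 : 0# < - x + 1#
          0<-x+1 = <-respʳ-≈ (+-comm 1# (- x)) (+-pos-nonneg 0<1 (≤-resp-≈ refl (+-identityˡ _) (≤-diff p)))

      -- With `m` a bound for the absolute value of `v i`, the threshold is the least of the
      -- quotients `δ / m`. It serves all smaller factors as well, which leaves room for further
      -- constraints on the factor.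
      small : ∀ {n} (v : Fin n → Carrier) {δ} → 0# < δ →
              ∃[ t ] 0# < t × (∀ s → 0# < s → s ≤ t → ∀ i → - δ < s * v i × s * v i < δ)
      small v {δ} 0<δ with min-family (λ i → δ * (proj₁ (bound (v i))) ⁻¹)
                                      (λ i → *-pos 0<δ (⁻¹-pos (proj₁ (proj₂ (bound (v i))))))
      ... | t , 0<t , t≤ = t , 0<t , λ s 0<s s≤t i →
        let (m , 0<m , -m<v , v<m) = bound (v i)
            sm≤δ : s * m ≤ δ
            sm≤δ = ≤-trans (≤-resp-≈ (*-comm m s) (*-comm m _) (*-monoˡ-≤ (<⇒≤ 0<m) (≤-trans s≤t (t≤ i))))
                           (≈⇒≤ (⁻¹-* 0<m))
        in ≤-<-trans (≤-by (≤-diff sm≤δ) (solve 3 (λ d s m → d :- s :* m := s :* (:- m) :- :- d) refl δ s m))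
                     (*-monoˡ-< 0<s -m<v)
         , <-≤-trans (*-monoˡ-< 0<s v<m) sm≤δ

    private
      -- Beyond `1 + a` squares exceed `(1 + a)² = 1 + 2a + a²`, which is greater than `a`.
      ub-square : 0# < a → UpperBound (λ z → z * z ≤ a) (1# + a)
      ub-square {a} 0<a {z} z²≤a with <⊎≥ (1# + a) z
      ... | inj₂ z≤ = z≤
      ... | inj₁ 1+a<z = ⊥-elim (≤⇒≯ z²≤a (<-trans a<[1+a]² (<-trans (*-monoˡ-< 0<1+a 1+a<z)
                (<-respˡ-≈ (*-comm z (1# + a)) (*-monoˡ-< (<-trans 0<1+a 1+a<z) 1+a<z)))))
        where
        0<1+a : 0# < 1# + a
        0<1+a = +-pos 0<1 0<a
        a<[1+a]² : a < (1# + a) * (1# + a)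
        a<[1+a]² = <-by (+-pos 0<1+a (*-pos 0<a 0<a))
          (solve 1 (λ a → con (1 , 0) :+ a :+ a :* a := (con (1 , 0) :+ a) :* (con (1 , 0) :+ a) :- a) refl a)

      sq-mono-< : 0# ≤ x → x < y → x * x < y * y
      sq-mono-< {x} {y} 0≤x x<y = ≤-<-trans (*-monoˡ-≤ 0≤x (<⇒≤ x<y))
        (<-respˡ-≈ (*-comm y x) (*-monoˡ-< (≤-<-trans 0≤x x<y) x<y))

    -- r is the supremum of { z | z² ≤ a }; if r² < a then r can be increased
    -- slightly, and if a < r² then the Newton iterate (r² + a) / 2r is a smaller
    -- upper bound.
    square-root : 0# < a → ∃[ r ] 0# < r × r * r ≈ a
    square-root {a} 0<a with supremum (λ z → z * z ≤ a) (0# , ≤-resp-≈ (sym (zeroˡ 0#)) refl (<⇒≤ 0<a))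
                               (1# + a , λ {z} → ub-square 0<a {z})
    ... | r , ub , least = r , 0<r , r²≈a
      where
      0<r : 0# < r
      0<r with <⊎≥ a 1#
      ... | inj₁ a<1 = <-≤-trans 0<a (ub (≤-resp-≈ refl (*-identityʳ a) (*-monoˡ-≤ (<⇒≤ 0<a) (<⇒≤ a<1))))
      ... | inj₂ 1≤a = <-≤-trans 0<1 (ub (≤-trans (≈⇒≤ (*-identityˡ 1#)) 1≤a))
      r²≈a : r * r ≈ a
      r²≈a with compare (r * r) a
      ... | tri≈ _ p _ = p
      ... | tri< p _ _ = ⊥-elim (≤⇒≯ (ub {r + e} sq≤) (<-by 0<e (solve 2 (λ r e → e := r :+ e :- r) refl r e)))
        where
        -- For `0 < e ≤ 1` one has `(r + e)² ≤ r² + k e`, so an `e` of at most `(a - r²) / k` keeps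
        -- the square below `a`.
        k = r + r + 1#
        0<k : 0# < k
        0<k = +-pos (+-pos 0<r 0<r) 0<1
        pick : ∃[ e ] 0# < e × e ≤ 1# × e ≤ (a - r * r) * k ⁻¹
        pick with <⊎≥ 1# ((a - r * r) * k ⁻¹)
        ... | inj₁ q = 1# , 0<1 , ≤-refl , <⇒≤ q
        ... | inj₂ q = _ , *-pos (<-diff p) (⁻¹-pos 0<k) , q , ≤-refl
        e = proj₁ pick
        0<e = proj₁ (proj₂ pick)
        e≤1 = proj₁ (proj₂ (proj₂ pick))
        ek≤ : k * e ≤ a - r * r
        ek≤ = ≤-trans (*-monoˡ-≤ (<⇒≤ 0<k) (proj₂ (proj₂ (proj₂ pick))))
                      (≈⇒≤ (trans (*-comm k _) (⁻¹-* 0<k)))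
        sq≤ : (r + e) * (r + e) ≤ a
        sq≤ = ≤-by (+-nonneg (≤-diff ek≤) (*-nonneg (<⇒≤ 0<e) (≤-diff e≤1)))
          (solve 3 (λ r e a → (a :- r :* r :- (r :+ r :+ con (1 , 0)) :* e) :+ e :* (con (1 , 0) :- e) := a :- (r :+ e) :* (r :+ e)) refl r e a)
      ... | tri> _ _ p = ⊥-elim (≤⇒≯ (least {u} upper) u<r)
        where
        i = (r + r) ⁻¹
        0<2r = +-pos 0<r 0<r
        t = (r * r - a) * i
        0<t : 0# < t
        0<t = *-pos (<-diff p) (⁻¹-pos 0<2r)
        u = r - t
        u<r : u < r
        u<r = <-by 0<t (solve 2 (λ r t → t := r :- (r :- t)) refl r t)
        t*2r : t * (r + r) ≈ r * r - a
        t*2r = ⁻¹-* 0<2r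
        0≤u : 0# ≤ u
        0≤u = <⇒≤ (*-cancelˡ-< (<⇒≤ 0<2r) (<-by (+-pos (*-pos 0<r 0<r) 0<a)
          (sym (trans (solve 2 (λ r t → (r :+ r) :* (r :- t) :- (r :+ r) :* con (0 , 0) := (r :* r :+ r :* r) :- t :* (r :+ r)) refl r t)
               (trans (+-congˡ (-‿cong t*2r)) (solve 2 (λ r a → (r :* r :+ r :* r) :- (r :* r :- a) := r :* r :+ a) refl r a))))))
        a≤u² : a ≤ u * u
        a≤u² = ≤-by (sq-nonneg t) (sym (trans
          (solve 3 (λ r t a → (r :- t) :* (r :- t) :- a := t :* t :+ (r :* r :- a :- t :* (r :+ r))) refl r t a)
          (trans (+-congˡ (trans (+-congˡ (-‿cong t*2r)) (-‿inverseʳ _))) (+-identityʳ _))))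
        upper : UpperBound (λ z → z * z ≤ a) u
        upper {z} z²≤a with <⊎≥ u z
        ... | inj₂ z≤u = z≤u
        ... | inj₁ u<z = ⊥-elim (≤⇒≯ (≤-trans z²≤a a≤u²) (sq-mono-< 0≤u u<z))

    abstract
      sqrt : 0# < a → ∃[ r ] 0# < r × r * r ≈ a
      sqrt = square-root

      sum-cong : ∀ {n} {f g : Fin n → Carrier} → (∀ i → f i ≈ g i) → sum f ≈ sum g
      sum-cong = sum-cong-≋

      sum-const : ∀ n x → sum {n} (λ _ → x) ≈ fromℕ n * x
      sum-const zero    x = sym (zeroˡ x)
      sum-const (suc n) x = trans (+-congˡ (sum-const n x))
        (solve 2 (λ m x → x :+ m :* x := (con (1 , 0) :+ m) :* x) refl (fromℕ n) x)

      sum-0 : ∀ {n} {f : Fin n → Carrier} → (∀ i → f i ≈ 0#) → sum f ≈ 0#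
      sum-0 {n} p = trans (sum-cong p) (trans (sum-const n 0#) (zeroʳ _))

      sum-nonneg : ∀ {n} (f : Fin n → Carrier) → (∀ i → 0# ≤ f i) → 0# ≤ sum f
      sum-nonneg {zero}  f p = ≤-refl
      sum-nonneg {suc n} f p = +-nonneg (p zero) (sum-nonneg (f ∘ suc) (p ∘ suc))

      sum-pos : ∀ {n} (f : Fin n → Carrier) → (∀ i → 0# ≤ f i) → ∀ k → 0# < f k → 0# < sum f
      sum-pos {suc n} f p zero    q = +-pos-nonneg q (sum-nonneg (f ∘ suc) (p ∘ suc))
      sum-pos {suc n} f p (suc k) q =
        <-respʳ-≈ (+-comm _ _) (+-pos-nonneg (sum-pos (f ∘ suc) (p ∘ suc) k q) (p zero))

      sum-single : ∀ {n} (f : Fin n → Carrier) k → (∀ i → ¬ i ≡ k → f i ≈ 0#) → sum f ≈ f k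
      sum-single {suc n} f zero    p = trans (+-congˡ (sum-0 (λ i → p (suc i) λ ()))) (+-identityʳ _)
      sum-single {suc n} f (suc k) p = trans (+-cong (p zero λ ()) (sum-single (f ∘ suc) k (λ i ne → p (suc i) λ { ≡.refl → ne ≡.refl })))
                                             (+-identityˡ _)

-- Paths in a mixed cobinary tree

module CobinaryCombinatorics where

  open import Data.Sum.Base using (swap)
  open import Function.Base using (flip)
  open import Relation.Binary.Definitions using (DecidableEquality)
  open import Relation.Binary.PropositionalEquality.Core using (refl; ≢-sym; subst)
  open import Relation.Binary.Construct.Closure.ReflexiveTransitive using (Star; ε; _◅_)

  -- Walk w u z: a walk from u to z without backtracking whose first step does
  -- not return to w.
  data Walk {V : Set} (A : Rel V 0ℓ) : V → V → V → Set where
    stop : ∀ {w u} → Walk A w u u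
    step : ∀ {w u v z} → A u v → v ≢ w → Walk A u v z → Walk A w u z

  data Path {V : Set} (A : Rel V 0ℓ) : V → V → Set where
    here : ∀ {i} → Path A i i
    go   : ∀ {i u z} → A i u → Walk A i u z → Path A i z

  -- The combinatorics of a mixed cobinary tree with adjacency A: ◁ compares
  -- x-coordinates, ≺ compares y-coordinates.
  record Cobinary {V : Set} (A _◁_ : Rel V 0ℓ) (IsΛ IsV : Pred V 0ℓ) : Set₁ where
    field
      _≟_      : DecidableEquality V
      A-sym    : ∀ {u v} → A u v → A v u
      ◁-trans  : ∀ {u v w} → u ◁ v → v ◁ w → u ◁ w
      ◁-asym   : ∀ {u v} → u ◁ v → ¬ (v ◁ u)
      _≺_      : Rel V 0ℓ
      ≺-trans  : ∀ {u v w} → u ≺ v → v ≺ w → u ≺ w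
      ≺-asym   : ∀ {u v} → u ≺ v → ¬ (v ≺ u)
      oriented : ∀ {u v} → A u v → u ≺ v ⊎ v ≺ u
      top-turn : ∀ {a b u} → A a u → A b u → a ≺ u → b ≺ u → a ≢ b →
                 IsΛ u × (a ◁ u × u ◁ b ⊎ b ◁ u × u ◁ a)
      bot-turn : ∀ {a b u} → A a u → A b u → u ≺ a → u ≺ b → a ≢ b →
                 IsV u × (a ◁ u × u ◁ b ⊎ b ◁ u × u ◁ a)
      -- The wall rules concern only edges with both ends on the walled side of `u`: an edge that
      -- passes the level of `u` may cross the vertical line beyond the wall.
      wallΛˡ   : ∀ {a b u} → IsΛ u → A a b → a ≺ u → b ≺ u → a ◁ u → b ◁ u
      wallΛʳ   : ∀ {a b u} → IsΛ u → A a b → a ≺ u → b ≺ u → u ◁ a → u ◁ b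
      wallVˡ   : ∀ {a b u} → IsV u → A a b → u ≺ a → u ≺ b → a ◁ u → b ◁ u
      wallVʳ   : ∀ {a b u} → IsV u → A a b → u ≺ a → u ≺ b → u ◁ a → u ◁ b

    ◁-irrefl : ∀ {u} → ¬ (u ◁ u)
    ◁-irrefl p = ◁-asym p p

    ≺-irrefl : ∀ {u} → ¬ (u ≺ u)
    ≺-irrefl p = ≺-asym p p

    infix 4 _⊑_
    data _⊑_ : V → V → Set where
      done : ∀ {u} → u ⊑ u
      up   : ∀ {u v w} → A u v → u ≺ v → v ⊑ w → u ⊑ w

    ⊑-snoc : ∀ {u v w} → u ⊑ v → A v w → v ≺ w → u ⊑ w
    ⊑-snoc done       b q = up b q done
    ⊑-snoc (up a p c) b q = up a p (⊑-snoc c b q)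

    ≺-⊑ : ∀ {u v w} → u ≺ v → v ⊑ w → u ≺ w
    ≺-⊑ p done       = p
    ≺-⊑ p (up _ q c) = ≺-⊑ (≺-trans p q) c

    ⊑-≺ : ∀ {u v w} → u ⊑ v → v ≺ w → u ≺ w
    ⊑-≺ done       q = q
    ⊑-≺ (up _ p c) q = ≺-trans p (⊑-≺ c q)

    ⊑-walk : ∀ {w c z} → w ≺ c → c ⊑ z → Walk A w c z
    ⊑-walk p done       = stop
    ⊑-walk p (up a q c) = step a (λ { refl → ≺-asym p q }) (⊑-walk q c)

    infixr 5 _◅ₚ_
    -- A path that starts by returning to `i` cancels against the new edge. Thus any chain of edges
    -- reduces to one without backtracking.
    _◅ₚ_ : ∀ {i j z} → A i j → Path A j z → Path A i z
    a ◅ₚ here = go a stop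
    _◅ₚ_ {i} a (go {u = u} b W) with u ≟ i
    ... | no u≢i   = go a (step b u≢i W)
    a ◅ₚ go b stop         | yes refl = here
    a ◅ₚ go b (step c _ W) | yes refl = go c W

    path : ∀ {i j} → Star A i j → Path A i j
    path ε       = here
    path (a ◅ s) = a ◅ₚ path s

  -- Reflection in a horizontal line exchanges the two signs, so what holds for ascents and Λ-nodes
  -- carries over to descents and V-nodes.
  dual : ∀ {V : Set} {A _◁_ : Rel V 0ℓ} {Λ N} → Cobinary A _◁_ Λ N → Cobinary A _◁_ N Λ
  dual C = record
    { _≟_ = _≟_ ; A-sym = A-sym ; ◁-trans = ◁-trans ; ◁-asym = ◁-asym
    ; _≺_ = flip _≺_ ; ≺-trans = λ p q → ≺-trans q p ; ≺-asym = ≺-asym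
    ; oriented = λ a → swap (oriented a)
    ; top-turn = bot-turn ; bot-turn = top-turn
    ; wallΛˡ = wallVˡ ; wallΛʳ = wallVʳ ; wallVˡ = wallΛˡ ; wallVʳ = wallΛʳ }
    where open Cobinary C

  mirror : ∀ {V : Set} {A _◁_ : Rel V 0ℓ} {Λ N} → Cobinary A _◁_ Λ N → Cobinary A (flip _◁_) Λ N
  mirror C = record
    { _≟_ = _≟_ ; A-sym = A-sym ; ◁-trans = λ p q → ◁-trans q p ; ◁-asym = ◁-asym
    ; _≺_ = _≺_ ; ≺-trans = ≺-trans ; ≺-asym = ≺-asym ; oriented = oriented
    ; top-turn = λ a b p q ne → let (l , s) = top-turn a b p q ne in l , flip-sides s
    ; bot-turn = λ a b p q ne → let (l , s) = bot-turn a b p q ne in l , flip-sides s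
    ; wallΛˡ = wallΛʳ ; wallΛʳ = wallΛˡ ; wallVˡ = wallVʳ ; wallVʳ = wallVˡ }
    where
    open Cobinary C
    flip-sides : ∀ {P Q R S : Set} → P × Q ⊎ R × S → S × R ⊎ Q × P
    flip-sides (inj₁ (p , q)) = inj₂ (q , p)
    flip-sides (inj₂ (p , q)) = inj₁ (q , p)

  -- A walk that descends from a Λ-node M on its left stays to the left of M. At
  -- its first turn, a V-node u, it was on the right of u (the wall above u keeps
  -- it on the same side as M), so it continues on the left of u < M, where the
  -- dual statement applies.
  descend-left : ∀ {V : Set} {A _◁_ : Rel V 0ℓ} {Λ N} (C : Cobinary A _◁_ Λ N) →
    let open Cobinary C in
    ∀ {M w u z} → Λ M → A u w → u ≺ w → w ⊑ M → u ◁ M → Walk A w u z → z ◁ M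
  descend-left C ΛM a p c u◁M stop = u◁M
  descend-left {_◁_ = _◁_} C {M} {w} {u} ΛM a p c u◁M (step {v = v} b v≢w W) with Cobinary.oriented C b
  ... | inj₂ v≺u = descend-left C ΛM (A-sym b) v≺u (up a p c) (wallΛˡ ΛM b u≺M (≺-trans v≺u u≺M) u◁M) W
    where
    open Cobinary C
    u≺M = ≺-⊑ p c
  ... | inj₁ u≺v with Cobinary.bot-turn C (Cobinary.A-sym C a) (Cobinary.A-sym C b) p u≺v (≢-sym v≢w)
  ...   | Nu , inj₁ (w◁u , _) = ⊥-elim (◁-asym u◁M (along p c w◁u))
    where
    open Cobinary C
    along : ∀ {w M} → u ≺ w → w ⊑ M → w ◁ u → M ◁ u
    along p done       q = q
    along p (up a r c) q = along (≺-trans p r) c (wallVˡ Nu a p (≺-trans p r) q)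
  ...   | Nu , inj₂ (v◁u , _) = ◁-trans (descend-left (dual C) Nu (A-sym b) u≺v Cobinary.done v◁u W) u◁M
    where open Cobinary C

  module Fates {V : Set} {A _◁_ : Rel V 0ℓ} {Λ N} (C : Cobinary A _◁_ Λ N) where
    open Cobinary C

    descend-right : ∀ {M w u z} → Λ M → A u w → u ≺ w → w ⊑ M → M ◁ u → Walk A w u z → M ◁ z
    descend-right ΛM a p c = descend-left (mirror C) ΛM a p (mirrored c)
      where
      mirrored : ∀ {u v} → u ⊑ v → Cobinary._⊑_ (mirror C) u v
      mirrored done       = Cobinary.done
      mirrored (up a p c) = Cobinary.up a p (mirrored c)

    -- m separates z from both i and its neighbour c (which may be m itself).
    Separates : V → V → V → V → Set
    Separates m i c z = (i ◁ m × (c ≡ m ⊎ c ◁ m) × m ◁ z) ⊎ (m ◁ i × (c ≡ m ⊎ m ◁ c) × z ◁ m)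

    data UpFate (i c z : V) : Set where
      up  : c ⊑ z → UpFate i c z
      top : ∀ m → c ⊑ m → Λ m → Separates m i c z → UpFate i c z

    private
      -- The whole chain lies below the Λ-node `u`, so none of its edges can pass the wall that
      -- hangs from `u`.
      below-left : ∀ {u c w} → Λ u → c ⊑ w → w ≺ u → w ◁ u → c ◁ u
      below-left Λu done       q r = r
      below-left Λu (up a p c) q r = wallΛˡ Λu (A-sym a) (⊑-≺ c q) (≺-trans p (⊑-≺ c q)) (below-left Λu c q r)

      below-right : ∀ {u c w} → Λ u → c ⊑ w → w ≺ u → u ◁ w → u ◁ c
      below-right Λu done       q r = r
      below-right Λu (up a p c) q r = wallΛʳ Λu (A-sym a) (⊑-≺ c q) (≺-trans p (⊑-≺ c q)) (below-right Λu c q r)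

      ascend : ∀ {i c w u z} → A i c → i ≺ c → c ⊑ w → A w u → w ≺ u → Walk A w u z → UpFate i c z
      ascend a p ch b q stop = up (⊑-snoc ch b q)
      ascend a p ch b q (step e v≢w W) with oriented e
      ... | inj₁ u≺v = ascend a p (⊑-snoc ch b q) e u≺v W
      ... | inj₂ v≺u with top-turn b (A-sym e) q v≺u (≢-sym v≢w)
      ...   | Λu , inj₁ (w◁u , u◁v) = top _ (⊑-snoc ch b q) Λu (inj₁
              ( below-left Λu (up a p ch) q w◁u , inj₂ (below-left Λu ch q w◁u)
              , descend-right Λu (A-sym e) v≺u done u◁v W))
      ...   | Λu , inj₂ (v◁u , u◁w) = top _ (⊑-snoc ch b q) Λu (inj₂
              ( below-right Λu (up a p ch) q u◁w , inj₂ (below-right Λu ch q u◁w)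
              , descend-left C Λu (A-sym e) v≺u done v◁u W))

    -- The first turn of a rising walk is a Λ-node. The wall below it holds the part climbed so far
    -- on one side, and `descend-left` or `descend-right` holds the rest of the walk on the other.
    up-fate : ∀ {i c z} → A i c → i ≺ c → Walk A i c z → UpFate i c z
    up-fate a p stop = up done
    up-fate a p (step e v≢i W) with oriented e
    ... | inj₁ u≺v = ascend a p done e u≺v W
    ... | inj₂ v≺u with top-turn a (A-sym e) p v≺u (≢-sym v≢i)
    ...   | Λu , inj₁ (i◁u , u◁v) = top _ done Λu (inj₁ (i◁u , inj₁ refl , descend-right Λu (A-sym e) v≺u done u◁v W))
    ...   | Λu , inj₂ (v◁u , u◁i) = top _ done Λu (inj₂ (u◁i , inj₁ refl , descend-left C Λu (A-sym e) v≺u done v◁u W))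

  module Structure {V : Set} {A _◁_ : Rel V 0ℓ} {Λ N} (C : Cobinary A _◁_ Λ N) where
    open Cobinary C
    open Fates C public using (Separates; UpFate; up; top; up-fate; descend-right)
    private module D = Fates (dual C)

    undual : ∀ {u v} → Cobinary._⊑_ (dual C) u v → v ⊑ u
    undual Cobinary.done       = done
    undual (Cobinary.up a p c) = ⊑-snoc (undual c) (A-sym a) p

    redual : ∀ {u v} → v ⊑ u → Cobinary._⊑_ (dual C) u v
    redual done       = Cobinary.done
    redual (up a p c) = Cobinary.⊑-snoc (dual C) (redual c) (A-sym a) p

    data DownFate (i c z : V) : Set where
      down : z ⊑ c → DownFate i c z
      bot  : ∀ m → m ⊑ c → N m → Separates m i c z → DownFate i c z

    down-fate : ∀ {i c z} → A i c → c ≺ i → Walk A i c z → DownFate i c z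
    down-fate a p W with D.up-fate a p W
    ... | D.up c          = down (undual c)
    ... | D.top m c Nm s  = bot m (undual c) Nm s

    ascend-right : ∀ {M w u z} → N M → A w u → w ≺ u → M ⊑ w → M ◁ u → Walk A w u z → M ◁ z
    ascend-right NM a p c = D.descend-right NM (A-sym a) p (redual c)

    -- A monotone chain cannot return to its start, and a turn that separates the start from the end
    -- cannot have the same node on both sides.
    not-closed : ∀ {i c} → A i c → ¬ Walk A i c i
    not-closed a W with oriented a
    ... | inj₁ p with up-fate a p W
    ...   | up c = ≺-irrefl (≺-⊑ p c)
    ...   | top m _ _ (inj₁ (q , _ , r)) = ◁-asym q r
    ...   | top m _ _ (inj₂ (q , _ , r)) = ◁-asym q r
    not-closed a W | inj₂ p with down-fate a p W
    ...   | down c = ≺-irrefl (⊑-≺ c p)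
    ...   | bot m _ _ (inj₁ (q , _ , r)) = ◁-asym q r
    ...   | bot m _ _ (inj₂ (q , _ , r)) = ◁-asym q r

    private
      reverse-append : ∀ {w u z y} → A u w → Walk A w u z → Walk A u w y → ∃[ c ] A z c × Walk A z c y
      reverse-append a stop            tail = _ , a , tail
      reverse-append a (step b v≢w W) tail = reverse-append (A-sym b) W (step a (≢-sym v≢w) tail)

    -- Reversing one walk and continuing along the other gives a closed walk at `z`; if the first
    -- steps differ, it does not backtrack at `i` either.
    first-unique : ∀ {i c c′ z} → A i c → Walk A i c z → A i c′ → Walk A i c′ z → c ≡ c′
    first-unique {c = c} {c′} a W a′ W′ with c ≟ c′
    ... | yes eq = eq
    ... | no ne with reverse-append (A-sym a) W (step a′ (≢-sym ne) W′)
    ...   | _ , b , X = ⊥-elim (not-closed b X)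

    Between : V → V → V → Set
    Between i k j = i ◁ k × k ◁ j ⊎ j ◁ k × k ◁ i

    private
      -- The separating node has `i` and `j` weakly on one side, so nothing between them can be on
      -- the other.
      no-separation : ∀ {i j k m} → Between i k j → ¬ Separates m i j k
      no-separation (inj₁ (p , q)) (inj₁ (r , inj₁ refl , t)) = ◁-asym q t
      no-separation (inj₁ (p , q)) (inj₁ (r , inj₂ s , t))    = ◁-asym q (◁-trans s t)
      no-separation (inj₁ (p , q)) (inj₂ (r , s , t))         = ◁-asym p (◁-trans t r)
      no-separation (inj₂ (p , q)) (inj₁ (r , s , t))         = ◁-asym q (◁-trans r t)
      no-separation (inj₂ (p , q)) (inj₂ (r , inj₁ refl , t)) = ◁-asym p t
      no-separation (inj₂ (p , q)) (inj₂ (r , inj₂ s , t))    = ◁-asym p (◁-trans t s)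

      -- The path to `k` leaves the edge at `j` or, if its first step is `i`, at `i`. In both cases
      -- it can be read as a walk beginning with this edge, and a turn is excluded by
      -- `no-separation`; what remains is a chain upwards from `j` or downwards from `i`.
      comparable : ∀ {i j k} → A i j → i ≺ j → Between i k j → Path A j k → k ⊑ i ⊎ j ⊑ k
      comparable a p (inj₁ (_ , q)) here = ⊥-elim (◁-irrefl q)
      comparable a p (inj₂ (q , _)) here = ⊥-elim (◁-irrefl q)
      comparable {i} a p btw (go {u = c} b W) with c ≟ i
      ... | no c≢i with up-fate a p (step b c≢i W)
      ...   | up ch       = inj₂ ch
      ...   | top m _ _ s = ⊥-elim (no-separation btw s)
      comparable {i} a p btw (go {u = c} b W) | yes refl with down-fate b p W
      ...   | down ch     = inj₁ ch
      ...   | bot m _ _ s = ⊥-elim (no-separation (swap btw) s)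

    -- In the other case of `comparable` the edge would lie below the Λ-node `k` with its ends on
    -- different sides, across the wall.
    betweenΛ : ∀ {i j k} → A i j → i ≺ j → Between i k j → Path A j k → Λ k → k ⊑ i
    betweenΛ a p btw P Λk with comparable a p btw P
    ... | inj₁ c = c
    ... | inj₂ c with j≺k btw c
      where
      j≺k : ∀ {i j k} → Between i k j → j ⊑ k → j ≺ k
      j≺k (inj₁ (_ , q)) done = ⊥-elim (◁-irrefl q)
      j≺k (inj₂ (q , _)) done = ⊥-elim (◁-irrefl q)
      j≺k _ (up _ q c)        = ≺-⊑ q c
    betweenΛ a p (inj₁ (q , r)) P Λk | inj₂ c | s = ⊥-elim (◁-asym r (wallΛˡ Λk a (≺-trans p s) s q))
    betweenΛ a p (inj₂ (q , r)) P Λk | inj₂ c | s = ⊥-elim (◁-asym q (wallΛʳ Λk a (≺-trans p s) s r))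

    betweenN : ∀ {i j k} → A i j → i ≺ j → Between i k j → Path A j k → N k → j ⊑ k
    betweenN a p btw P Nk with comparable a p btw P
    ... | inj₂ c = c
    ... | inj₁ c with k≺i btw c
      where
      k≺i : ∀ {i j k} → Between i k j → k ⊑ i → k ≺ i
      k≺i (inj₁ (q , _)) done = ⊥-elim (◁-irrefl q)
      k≺i (inj₂ (_ , q)) done = ⊥-elim (◁-irrefl q)
      k≺i _ (up _ q c)        = ≺-⊑ q c
    betweenN a p (inj₁ (q , r)) P Nk | inj₁ c | s = ⊥-elim (◁-asym r (wallVˡ Nk a s (≺-trans s p) q))
    betweenN a p (inj₂ (q , r)) P Nk | inj₁ c | s = ⊥-elim (◁-asym q (wallVʳ Nk a s (≺-trans s p) r))

    MonotoneFor : Rel V 0ℓ → Set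
    MonotoneFor _⊏_ = ∀ {i j} → A i j → i ≺ j → i ⊏ j

    chain-is-edge : ∀ {i j c} → A i j → i ≺ j → A i c → i ≺ c → c ⊑ j → c ≡ j
    chain-is-edge a p b q c = first-unique b (⊑-walk q c) a stop

  -- A mixed cobinary tree is determined by its signs and any linear extension.
  module Uniqueness {V : Set} {A A′ _◁_ : Rel V 0ℓ} {Λ N}
    (C : Cobinary A _◁_ Λ N) (C′ : Cobinary A′ _◁_ Λ N)
    (conn : ∀ i j → Path A i j) (conn′ : ∀ i j → Path A′ i j)
    (_⊏_ : Rel V 0ℓ) (⊏-trans : ∀ {u v w} → u ⊏ v → v ⊏ w → u ⊏ w) (⊏-irrefl : ∀ {u} → ¬ (u ⊏ u))
    (mono : Structure.MonotoneFor C _⊏_) (mono′ : Structure.MonotoneFor C′ _⊏_) where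

    private
      module C = Cobinary C
      module C′ = Cobinary C′
      module S = Structure C
      module S′ = Structure C′

      ⊏-⊑ : ∀ {u v w} → u ⊏ v → v C.⊑ w → u ⊏ w
      ⊏-⊑ p C.done       = p
      ⊏-⊑ p (C.up a q c) = ⊏-⊑ (⊏-trans p (mono a q)) c

      ⊑-⊏ : ∀ {u v w} → u C.⊑ v → v ⊏ w → u ⊏ w
      ⊑-⊏ C.done       p = p
      ⊑-⊏ (C.up a q c) p = ⊏-trans (mono a q) (⊑-⊏ c p)

      ⊏-⊑′ : ∀ {u v w} → u ⊏ v → v C′.⊑ w → u ⊏ w
      ⊏-⊑′ p C′.done       = p
      ⊏-⊑′ p (C′.up a q c) = ⊏-⊑′ (⊏-trans p (mono′ a q)) c

      ⊑-⊏′ : ∀ {u v w} → u C′.⊑ v → v ⊏ w → u ⊏ w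
      ⊑-⊏′ C′.done       p = p
      ⊑-⊏′ (C′.up a q c) p = ⊏-trans (mono′ a q) (⊑-⊏′ c p)

      between : ∀ {m i c z} → S′.Separates m i c z → S.Between i m z
      between (inj₁ (p , _ , q)) = inj₁ (p , q)
      between (inj₂ (p , _ , q)) = inj₂ (q , p)

    -- A turn m on the path of C′ from i to j would lie strictly between i and j,
    -- so by betweenΛ and betweenN its level contradicts the linear extension.
    edge-to-chain : ∀ {i j} → A i j → i C.≺ j → ∃[ c ] A′ i c × i C′.≺ c × c C′.⊑ j
    edge-to-chain {i} {j} a p with conn′ i j
    ... | here = ⊥-elim (C.≺-irrefl p)
    ... | go b W with C′.oriented b
    ...   | inj₁ q with S′.up-fate b q W
    ...     | S′.up c = _ , b , q , c
    ...     | S′.top m c Λm s = ⊥-elim (⊏-irrefl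
                (⊏-⊑ (⊏-⊑′ (mono′ b q) c) (S.betweenΛ a p (between s) (conn j m) Λm)))
    edge-to-chain {i} {j} a p | go b W | inj₂ q with S′.down-fate b q W
    ...     | S′.down c = ⊥-elim (⊏-irrefl (⊏-trans (mono a p) (⊑-⊏′ c (mono′ (C′.A-sym b) q))))
    ...     | S′.bot m c Nm s = ⊥-elim (⊏-irrefl (⊏-trans (mono a p)
                (⊑-⊏ (S.betweenN a p (between s) (conn j m) Nm) (⊑-⊏′ c (mono′ (C′.A-sym b) q)))))

  module SameEdges {V : Set} {A A′ _◁_ : Rel V 0ℓ} {Λ N}
    (C : Cobinary A _◁_ Λ N) (C′ : Cobinary A′ _◁_ Λ N)
    (conn : ∀ i j → Path A i j) (conn′ : ∀ i j → Path A′ i j)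
    (_⊏_ : Rel V 0ℓ) (⊏-trans : ∀ {u v w} → u ⊏ v → v ⊏ w → u ⊏ w) (⊏-irrefl : ∀ {u} → ¬ (u ⊏ u))
    (mono : Structure.MonotoneFor C _⊏_) (mono′ : Structure.MonotoneFor C′ _⊏_) where

    private
      module C = Cobinary C
      module C′ = Cobinary C′
      module To = Uniqueness C C′ conn conn′ _⊏_ ⊏-trans ⊏-irrefl mono mono′
      module From = Uniqueness C′ C conn′ conn _⊏_ ⊏-trans ⊏-irrefl mono′ mono

      ⊑-trans : ∀ {u v w} → u C.⊑ v → v C.⊑ w → u C.⊑ w
      ⊑-trans C.done       d = d
      ⊑-trans (C.up a p c) d = C.up a p (⊑-trans c d)

      transfer : ∀ {u v} → u C′.⊑ v → u C.⊑ v
      transfer C′.done       = C.done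
      transfer (C′.up a p c) = let (_ , b , q , d) = From.edge-to-chain a p in C.up b q (⊑-trans d (transfer c))

    -- The edge becomes a chain of `C′`, and that chain becomes a chain of `C` from `i` to `j`. As
    -- paths are unique, the round trip is the edge itself, which leaves no room for an intermediate
    -- node in the chain of `C′`.
    same-edge : ∀ {i j} → A i j → i C.≺ j → A′ i j × i C′.≺ j
    same-edge {i} {j} a p with To.edge-to-chain a p
    ... | c , a′ , p′ , ch with From.edge-to-chain a′ p′
    ...   | d , b , q , e with Structure.chain-is-edge C a p b q (⊑-trans e (transfer ch))
    ...     | refl = subst (λ v → A′ i v × i C′.≺ v) (antisym e (transfer ch)) (a′ , p′)
      where
      antisym : ∀ {u v} → u C.⊑ v → v C.⊑ u → v ≡ u
      antisym C.done       _ = refl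
      antisym (C.up _ r c) d = ⊥-elim (C.≺-irrefl (C.≺-⊑ (C.≺-⊑ r c) d))

-- Closure and interior of cones given by order relations, in space and on the sphere

module OrderCones where

  open Fields

  module ConeIdentities (𝓡 : CompleteOrderedField) where
    open OrderedField 𝓡
    abstract
      near-gap : ∀ a b c d h k → (a - b - - h) + (k - (c - d)) ≈ a - c + (h + k - (b - d))
      near-gap = solve 6 (λ a b c d h k → (a :- b :- :- h) :+ (k :- (c :- d)) := a :- c :+ (h :+ k :- (b :- d))) refl

      shifted-gap : ∀ t yi yj xi xj → t * (yj - yi) + (xj - xi) ≈ xj + t * yj - (xi + t * yi)
      shifted-gap = solve 5 (λ t yi yj xi xj → t :* (yj :- yi) :+ (xj :- xi) := xj :+ t :* yj :- (xi :+ t :* yi)) refl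

      open-gap : ∀ yj xj yi xi d → (yj - xj - - d) + (d - (yi - xi)) + (xj - xi - (d + d)) ≈ yj - yi
      open-gap = solve 5 (λ yj xj yi xi d → (yj :- xj :- :- d) :+ (d :- (yi :- xi)) :+ (xj :- xi :- (d :+ d)) := yj :- yi) refl

      interior-gap : ∀ t yi yj xi xj → t * (yj - yi) + (xj + t * - yj - (xi + t * - yi)) ≈ xj - xi
      interior-gap = solve 5 (λ t yi yj xi xj → t :* (yj :- yi) :+ (xj :+ t :* :- yj :- (xi :+ t :* :- yi)) := xj :- xi) refl

      orthogonal-gap : ∀ di dj a xi xj → (di - a * xi) - (dj - a * xj) ≈ (di - dj) + a * (xj - xi)
      orthogonal-gap = solve 5 (λ di dj a xi xj → (di :- a :* xi) :- (dj :- a :* xj) := (di :- dj) :+ a :* (xj :- xi)) refl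

      rotated-norm : ∀ s t n o → (o - s * t) * (o - s * t) * 1# + ((o - s * t) * s + (o - s * t) * s) * 0# + s * s * n ≈ o * o - s * (o * (t + t)) + s * (s * (n + t * t))
      rotated-norm = solve 4 (λ s t n o → (o :- s :* t) :* (o :- s :* t) :* con (1 , 0) :+ ((o :- s :* t) :* s :+ (o :- s :* t) :* s) :* con (0 , 0) :+ s :* s :* n := o :* o :- s :* (o :* (t :+ t)) :+ s :* (s :* (n :+ t :* t))) refl

      rotated-lower : ∀ s t p x h → (s * p - - h) + (h - s * t * x) ≈ ((1# - s * t) * x + s * p) - x - - (h + h)
      rotated-lower = solve 5 (λ s t p x h → (s :* p :- :- h) :+ (h :- s :* t :* x) := ((con (1 , 0) :- s :* t) :* x :+ s :* p) :- x :- :- (h :+ h)) refl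

      rotated-upper : ∀ s t p x h → (h - s * p) + (s * t * x - - h) ≈ h + h - (((1# - s * t) * x + s * p) - x)
      rotated-upper = solve 5 (λ s t p x h → (h :- s :* p) :+ (s :* t :* x :- :- h) := h :+ h :- (((con (1 , 0) :- s :* t) :* x :+ s :* p) :- x)) refl

      rotated-gap : ∀ u s xi xj pi pj → u * xi + s * pi - (u * xj + s * pj) ≈ u * (xi - xj) + s * (pi - pj)
      rotated-gap = solve 6 (λ u s xi xj pi pj → u :* xi :+ s :* pi :- (u :* xj :+ s :* pj) := u :* (xi :- xj) :+ s :* (pi :- pj)) refl

  -- Y witnesses that the open cone Mono< is not empty.
  module OrderCone (𝓡 : CompleteOrderedField) {n : ℕ} (U : Rel (Fin n) 0ℓ)
    (Y : RealGeometry.ℝ^ 𝓡 n)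
    (Y-mono : ∀ {i j} → U i j → CompleteOrderedField._<_ 𝓡 (Y i) (Y j)) where
    open OrderedField 𝓡
    open ConeIdentities 𝓡
    open RealGeometry 𝓡 hiding (R; R̄)

    Mono< Mono≤ : Pred (ℝ^ n) 0ℓ
    Mono< x = ∀ {i j} → U i j → x i < x j
    Mono≤ x = ∀ {i j} → U i j → x i ≤ x j

    Mono<⊆Mono≤ : Mono< ⊆ Mono≤
    Mono<⊆Mono≤ p u = <⇒≤ (p u)

    closure⇒Mono≤ : Closure Mono< ⊆ Mono≤
    closure⇒Mono≤ {x} cl {i} {j} u with <⊎≥ (x j) (x i)
    ... | inj₂ p = p
    -- Half the gap is the tolerance: two coordinates that each move by less than this keep their
    -- order.
    ... | inj₁ p with cl {½ * (x i - x j)} (*-pos 0<½ (<-diff p))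
    ...   | y , near , q = ⊥-elim (<-asym (q u) (<-by
            (+-pos (<-diff (proj₁ (near i))) (<-diff (proj₂ (near j))))
            (trans (near-gap (y i) (x i) (y j) (x j) (½ * (x i - x j)) (½ * (x i - x j)))
              (trans (+-congˡ (trans (+-congʳ halves) (-‿inverseʳ _))) (+-identityʳ _)))))

    private
      perturb : ∀ (x v : ℝ^ n) t i → t * v i ≈ (x i + t * v i) - x i
      perturb x v t i = solve 2 (λ a b → b := a :+ b :- a) refl (x i) (t * v i)

      near-perturb : ∀ {x v : ℝ^ n} {t δ} → (∀ i → - δ < t * v i × t * v i < δ) → Near δ x (λ i → x i + t * v i)
      near-perturb {x} {v} {t} b i =
        <-respʳ-≈ (perturb x v t i) (proj₁ (b i)) , <-respˡ-≈ (perturb x v t i) (proj₂ (b i))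

    -- A small positive multiple of `Y` added to `x` makes all the inequalities strict.
    Mono≤⇒closure : Mono≤ ⊆ Closure Mono<
    Mono≤⇒closure {x} p {δ} 0<δ with small Y 0<δ
    ... | t , 0<t , b = (λ i → x i + t * Y i) , near-perturb {x} {Y} (b t 0<t ≤-refl) , λ {i} {j} u →
      <-by (+-pos-nonneg (*-pos 0<t (<-diff (Y-mono u))) (≤-diff (p u)))
           (shifted-gap t (Y i) (Y j) (x i) (x j))

    Mono<-open : ∀ {x} → Mono< x → ∃[ δ ] 0# < δ × (∀ {y} → Near δ x y → Mono< y)
    Mono<-open {x} p = δ , 0<δ , λ {y} near {i} {j} u →
      <-by (+-pos-nonneg (+-pos (<-diff (proj₁ (near j))) (<-diff (proj₂ (near i))))
                         (≤-diff (δ+δ≤ (p u))))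
           (open-gap (y j) (x j) (y i) (x i) δ)
      where
      gap : ∀ i j → ∃[ g ] 0# < g × (x i < x j → g + g ≤ x j - x i)
      gap i j with <⊎≥ (x i) (x j)
      ... | inj₁ q = ½ * (x j - x i) , *-pos 0<½ (<-diff q) , λ _ → ≈⇒≤ halves
      -- A dummy value: with it the minimum can be taken over all pairs, although `U` is not
      -- decidable.
      ... | inj₂ q = 1# , 0<1 , λ r → ⊥-elim (≤⇒≯ q r)
      row : ∀ i → ∃[ δ ] 0# < δ × (∀ j → δ ≤ proj₁ (gap i j))
      row i = min-family (λ j → proj₁ (gap i j)) (λ j → proj₁ (proj₂ (gap i j)))
      all-rows = min-family (λ i → proj₁ (row i)) (λ i → proj₁ (proj₂ (row i)))
      δ = proj₁ all-rows
      0<δ = proj₁ (proj₂ all-rows)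
      δ+δ≤ : ∀ {i j} → x i < x j → δ + δ ≤ x j - x i
      δ+δ≤ {i} {j} q = ≤-trans (≤-by (+-nonneg (≤-diff δ≤) (≤-diff δ≤))
          (solve 2 (λ g d → (g :- d) :+ (g :- d) := g :+ g :- (d :+ d)) refl (proj₁ (gap i j)) δ))
        (proj₂ (proj₂ (gap i j)) q)
        where
        δ≤ : δ ≤ proj₁ (gap i j)
        δ≤ = ≤-trans (proj₂ (proj₂ all-rows) i) (proj₂ (proj₂ (row i)) j)

    -- A small step against `Y` stays in the ball and lowers every difference along `U`; as the
    -- result is still nonnegative, the difference was positive before.
    interior⇒Mono< : Interior Mono≤ ⊆ Mono<
    interior⇒Mono< {x} (δ , 0<δ , ball) {i} {j} u with small (λ i → - Y i) 0<δ
    ... | t , 0<t , b =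
      <-by (+-pos-nonneg (*-pos 0<t (<-diff (Y-mono u)))
                         (≤-diff (ball (near-perturb {x} {λ i → - Y i} (b t 0<t ≤-refl)) u)))
           (interior-gap t (Y i) (Y j) (x i) (x j))

    Mono<⇒interior : Mono< ⊆ Interior Mono≤
    Mono<⇒interior {x} p = let (δ , 0<δ , ball) = Mono<-open {x} p in
      δ , 0<δ , λ near → Mono<⊆Mono≤ (ball near)

  module Centring (𝓡 : CompleteOrderedField) (m : ℕ) where
    open OrderedField 𝓡
    open ConeIdentities 𝓡
    open RealGeometry 𝓡 hiding (R; R̄)

    private n = suc m

    mean : ℝ^ n → ℝ
    mean v = sum v * (fromℕ n) ⁻¹

    centre : ℝ^ n → ℝ^ n
    centre v i = v i - mean v

    sum-difference : ∀ {k} (v w : Fin k → ℝ) → sum (λ i → v i - w i) ≈ sum v - sum w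
    sum-difference v w = begin
      sum (λ i → v i - w i)          ≈⟨ ∑-distrib-+ v (λ i → - w i) ⟩
      sum v + sum (λ i → - w i)      ≈⟨ +-congˡ (sum-cong (λ i → solve 1 (λ x → :- x := :- con (1 , 0) :* x) refl (w i))) ⟩
      sum v + sum (λ i → - 1# * w i) ≈⟨ +-congˡ (*-distribˡ-sum (- 1#) w) ⟨
      sum v + - 1# * sum w           ≈⟨ solve 2 (λ a b → a :+ :- con (1 , 0) :* b := a :- b) refl (sum v) (sum w) ⟩
      sum v - sum w                  ∎
      where open import Relation.Binary.Reasoning.Setoid setoid

    centre∈H : ∀ v → H n (centre v)
    centre∈H v = begin
      sum (λ i → v i - mean v)      ≈⟨ sum-difference v (λ _ → mean v) ⟩
      sum v - sum {n} (λ _ → mean v) ≈⟨ +-congˡ (-‿cong (trans (sum-const n (mean v)) (trans (*-comm _ _) (⁻¹-* (0<fromℕ-suc m))))) ⟩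
      sum v - sum v                 ≈⟨ -‿inverseʳ _ ⟩
      0#                            ∎
      where open import Relation.Binary.Reasoning.Setoid setoid

    centre-diff : ∀ v i j → centre v i - centre v j ≈ v i - v j
    centre-diff v i j = solve 3 (λ a b c → a :- c :- (b :- c) := a :- b) refl (v i) (v j) (mean v)

    norm² : ℝ^ n → ℝ
    norm² v = sum (λ i → v i * v i)

    inner : ℝ^ n → ℝ^ n → ℝ
    inner v w = sum (λ i → v i * w i)

    norm²-pos : ∀ v {i j} → v i < v j → 0# < norm² v
    norm²-pos v {i} {j} p with v i ≈? 0#
    ... | no  q = sum-pos _ (λ k → sq-nonneg (v k)) i (sq-pos q)
    ... | yes q = sum-pos _ (λ k → sq-nonneg (v k)) j (sq-pos (λ r → <-irrefl (trans q (sym r)) p))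

    norm²-combination : ∀ (x p : ℝ^ n) u s →
      norm² (λ i → u * x i + s * p i) ≈ u * u * norm² x + (u * s + u * s) * inner x p + s * s * norm² p
    norm²-combination x p u s = begin
      sum (λ i → (u * x i + s * p i) * (u * x i + s * p i))
        ≈⟨ sum-cong (λ i → solve 4 (λ u s x p → (u :* x :+ s :* p) :* (u :* x :+ s :* p)
             := u :* u :* (x :* x) :+ (u :* s :+ u :* s) :* (x :* p) :+ s :* s :* (p :* p)) refl u s (x i) (p i)) ⟩
      sum (λ i → u * u * (x i * x i) + (u * s + u * s) * (x i * p i) + s * s * (p i * p i))
        ≈⟨ trans (∑-distrib-+ (λ i → u * u * (x i * x i) + (u * s + u * s) * (x i * p i)) (λ i → s * s * (p i * p i)))
                 (+-congʳ (∑-distrib-+ (λ i → u * u * (x i * x i)) (λ i → (u * s + u * s) * (x i * p i)))) ⟩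
      sum (λ i → u * u * (x i * x i)) + sum (λ i → (u * s + u * s) * (x i * p i)) + sum (λ i → s * s * (p i * p i))
        ≈⟨ +-cong (+-cong (*-distribˡ-sum (u * u) (λ i → x i * x i)) (*-distribˡ-sum (u * s + u * s) (λ i → x i * p i)))
                  (*-distribˡ-sum (s * s) (λ i → p i * p i)) ⟨
      u * u * norm² x + (u * s + u * s) * inner x p + s * s * norm² p ∎
      where open import Relation.Binary.Reasoning.Setoid setoid

    sum-scale : ∀ s (v : ℝ^ n) → sum (λ i → s * v i) ≈ s * sum v
    sum-scale s v = sym (*-distribˡ-sum s v)

  module SphereCone (𝓡 : CompleteOrderedField) {m : ℕ} (U : Rel (Fin (suc m)) 0ℓ)
    (Y : RealGeometry.ℝ^ 𝓡 (suc m))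
    (Y-mono : ∀ {i j} → U i j → CompleteOrderedField._<_ 𝓡 (Y i) (Y j)) where
    open OrderedField 𝓡
    open ConeIdentities 𝓡
    open RealGeometry 𝓡 hiding (R; R̄)
    open OrderCone 𝓡 U Y Y-mono
    open Centring 𝓡 m

    private n = suc m

    -- Centring preserves the differences of `Y` and normalising multiplies them by a positive
    -- factor. The given pair ensures that the centred vector is not zero.
    unit-vector : ∀ {i j} → U i j → ∃[ x ] Sphere n x × Mono< x
    unit-vector u = normalised
      where
      v = centre Y
      v-mono : ∀ {i j} → U i j → v i < v j
      v-mono {i} {j} w = <-by (<-diff (Y-mono w)) (sym (centre-diff Y j i))
      0<N = norm²-pos v (v-mono u)
      root = sqrt (⁻¹-pos 0<N)
      r = proj₁ root
      0<r = proj₁ (proj₂ root)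
      normalised : ∃[ x ] Sphere n x × Mono< x
      normalised = (λ i → r * v i)
        , ( trans (sum-scale r v) (trans (*-congˡ (centre∈H Y)) (zeroʳ r))
          , trans (sum-cong (λ i → solve 2 (λ r v → (r :* v) :* (r :* v) := (r :* r) :* (v :* v)) refl r (v i)))
            (trans (sum-scale (r * r) (λ i → v i * v i))
              (trans (*-congʳ (proj₂ (proj₂ root))) (trans (*-comm _ _) (*-inverseʳ (pos⇒≉0 0<N)))))
          )
        , λ w → *-monoˡ-< 0<r (v-mono w)

    private
      step-size : ∀ N a b → 0# < N → 0# < a → 0# < b →
                  ∃[ t ] 0# < t × t ≤ 1# × t ≤ ½ * (N * a) × t ≤ ½ * (N * b)
      step-size N a b 0<N 0<a 0<b =
        let (e , 0<e , e≤p , e≤x) = min₂ (*-pos 0<½ (*-pos 0<N 0<a)) (*-pos 0<½ (*-pos 0<N 0<b))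
            (t , 0<t , t≤1 , t≤e) = min₂ 0<1 0<e
        in t , 0<t , t≤1 , ≤-trans t≤e e≤p , ≤-trans t≤e e≤x

    private
      -- With s = 2t / (|p|² + t²) the vector (1 - s t) x + s p is again a unit vector, and
      -- close to x for small t: no square root is needed.
      rotate : ∀ (x p : ℝ^ n) N δ → Sphere n x → H n p → inner x p ≈ 0# → norm² p ≈ N → 0# < N → 0# < δ →
               ∃[ u ] ∃[ s ] 0# < s × Sphere n (λ k → u * x k + s * p k) × Near δ x (λ k → u * x k + s * p k)
      rotate x p N δ (x∈H , |x|≈1) p∈H x⊥p |p| 0<N 0<δ = 1# - st , s , 0<s , y∈S , near
        where
        0<½δ = *-pos 0<½ 0<δ
        small-p = small p 0<½δ
        small-x = small x 0<½δ
        t₀ = step-size N (proj₁ small-p) (proj₁ small-x) 0<N (proj₁ (proj₂ small-p)) (proj₁ (proj₂ small-x))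
        t = proj₁ t₀
        0<t = proj₁ (proj₂ t₀)
        t≤1 = proj₁ (proj₂ (proj₂ t₀))
        0<M : 0# < N + t * t
        0<M = +-pos 0<N (*-pos 0<t 0<t)
        s = (t + t) * (N + t * t) ⁻¹
        0<s : 0# < s
        0<s = *-pos (+-pos 0<t 0<t) (⁻¹-pos 0<M)
        sM : s * (N + t * t) ≈ t + t
        sM = ⁻¹-* 0<M
        -- From `N s ≤ s (N + t²) = 2 t ≤ N e`; this is where the bounds in `step-size` come from.
        s≤ : ∀ {e} → t ≤ ½ * (N * e) → s ≤ e
        s≤ {e} q with <⊎≥ e s
        ... | inj₂ r = r
        ... | inj₁ r = ⊥-elim (≤⇒≯ {N * s} {t + t}
          (≤-by (*-nonneg (<⇒≤ 0<s) (sq-nonneg t))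
                (sym (trans (+-congʳ (sym sM)) (solve 3 (λ s n t → s :* (n :+ t :* t) :- n :* s := s :* (t :* t)) refl s N t))))
          (≤-<-trans (≤-resp-≈ refl halves (≤-by (+-nonneg (≤-diff q) (≤-diff q))
                       (solve 2 (λ h t → h :- t :+ (h :- t) := h :+ h :- (t :+ t)) refl (½ * (N * e)) t)))
                     (*-monoˡ-< 0<N r)))
        st = s * t
        y : ℝ^ n
        y k = (1# - st) * x k + s * p k
        y∈H : sum y ≈ 0#
        y∈H = trans (∑-distrib-+ (λ k → (1# - st) * x k) (λ k → s * p k))
          (trans (+-cong (trans (sum-scale (1# - st) x) (trans (*-congˡ x∈H) (zeroʳ _)))
                         (trans (sum-scale s p) (trans (*-congˡ p∈H) (zeroʳ _)))) (+-identityʳ 0#))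
        |y|≈1 : norm² y ≈ 1#
        |y|≈1 = trans (norm²-combination x p (1# - st) s)
          (trans (+-cong (+-cong (*-congˡ |x|≈1) (*-congˡ x⊥p)) (*-congˡ |p|))
          -- Since `x` is a unit vector orthogonal to `p`, the squared norm is `(1 - s t)² + s² N =
          -- 1 - 2 s t + s (s (N + t²))`, and the choice of `s` makes `s (N + t²)` equal to `2 t`.
          (trans (rotated-norm s t N 1#)
          (trans (+-congˡ (*-congˡ sM))
                 (solve 2 (λ s t → con (1 , 0) :* con (1 , 0) :- s :* (con (1 , 0) :* (t :+ t)) :+ s :* (t :+ t) := con (1 , 0)) refl s t))))
        y∈S : Sphere n y
        y∈S = y∈H , |y|≈1
        st≤ : st ≤ proj₁ small-x
        st≤ = ≤-trans (≤-by (*-nonneg (<⇒≤ 0<s) (≤-diff t≤1)) (solve 2 (λ s t → s :* (con (1 , 0) :- t) := s :- s :* t) refl s t))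
                      (s≤ (proj₂ (proj₂ (proj₂ (proj₂ t₀)))))
        near : Near δ x y
        near k = <-by (+-pos (<-diff (proj₁ bp)) (<-diff (proj₂ bx)))
                   (trans (rotated-lower s t (p k) (x k) (½ * δ))
                     (+-congˡ (-‿cong (-‿cong halves))))
               , <-by (+-pos (<-diff (proj₂ bp)) (<-diff (proj₁ bx)))
                   (trans (rotated-upper s t (p k) (x k) (½ * δ))
                     (+-congʳ halves))
          where
          bp = proj₂ (proj₂ small-p) s 0<s (s≤ (proj₁ (proj₂ (proj₂ (proj₂ t₀))))) k
          bx = proj₂ (proj₂ small-x) st (*-pos 0<s 0<t) st≤ k

    -- If x i = x j for an edge U i j, rotate x slightly inside the sphere
    -- towards p, the component of the centred vector - Y orthogonal to x.
    relative-interior⇒Mono< : RelativeInterior (Sphere n) (Mono≤ ∩ Sphere n) ⊆ Mono<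
    relative-interior⇒Mono< {x} ((x∈H , |x|≈1) , δ , 0<δ , ball) {i} {j} u
      with <⊎≥ (x i) (x j)
    ... | inj₁ p = p
    ... | inj₂ xj≤xi = ⊥-elim (≤⇒≯ (proj₁ (ball (proj₁ (proj₂ (proj₂ (proj₂ rotated)))) (proj₂ (proj₂ (proj₂ (proj₂ rotated))))) u) yj<yi)
      where
      mono≤ : Mono≤ x
      mono≤ = proj₁ (ball (x∈H , |x|≈1) (λ k → <-respʳ-≈ (sym (-‿inverseʳ (x k))) (-δ<0) , <-respˡ-≈ (sym (-‿inverseʳ (x k))) 0<δ))
        where
        -δ<0 : - δ < 0#
        -δ<0 = <-by 0<δ (solve 1 (λ d → d := con (0 , 0) :- :- d) refl δ)
      xi≈xj : x i ≈ x j
      xi≈xj = ≤-antisym (mono≤ u) xj≤xi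
      d = centre (λ k → - Y k)
      α = inner x d
      p : ℝ^ n
      p k = d k - α * x k
      p∈H : sum p ≈ 0#
      p∈H = trans (sum-difference d (λ k → α * x k))
        (trans (+-cong (centre∈H (λ k → - Y k)) (-‿cong (trans (sum-scale α x) (trans (*-congˡ x∈H) (zeroʳ α)))))
          (-‿inverseʳ 0#))
      x⊥p : inner x p ≈ 0#
      x⊥p = trans (sum-cong (λ k → solve 3 (λ x d a → x :* (d :- a :* x) := x :* d :- a :* (x :* x)) refl (x k) (d k) α))
        (trans (sum-difference (λ k → x k * d k) (λ k → α * (x k * x k)))
          (trans (+-congˡ (-‿cong (trans (sum-scale α (λ k → x k * x k)) (trans (*-congˡ |x|≈1) (*-identityʳ α)))))
            (-‿inverseʳ α)))
      -- Because `x i = x j`, removing the component along `x` does not affect the difference of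
      -- these two coordinates, so `p` inherits the strict decrease of `- Y` along the edge.
      pj<pi : p j < p i
      pj<pi = <-by (<-diff (Y-mono u)) (sym (trans
        (orthogonal-gap (d i) (d j) α (x i) (x j))
        (trans (+-cong (centre-diff (λ k → - Y k) i j)
                       (trans (*-congˡ (trans (+-congˡ (-‿cong xi≈xj)) (-‿inverseʳ _))) (zeroʳ α)))
          (solve 2 (λ a b → :- a :- :- b :+ con (0 , 0) := b :- a) refl (Y i) (Y j)))))
      rotated = rotate x p (norm² p) δ (x∈H , |x|≈1) p∈H x⊥p refl (norm²-pos p pj<pi) 0<δ
      r s : ℝ
      r = proj₁ rotated
      s = proj₁ (proj₂ rotated)
      0<s : 0# < s
      0<s = proj₁ (proj₂ (proj₂ rotated))
      yj<yi : r * x j + s * p j < r * x i + s * p i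
      yj<yi = <-by (*-pos 0<s (<-diff pj<pi)) (sym (trans
        (rotated-gap r s (x i) (x j) (p i) (p j))
        (trans (+-congʳ (trans (*-congˡ (trans (+-congʳ xi≈xj) (-‿inverseʳ _))) (zeroʳ _))) (+-identityˡ _))))

-- Potentials on a tree and the basis dual to its edges

module SimplicialCones where

  open Fields
  open CobinaryCombinatorics
  open OrderCones
  open import Relation.Nullary.Decidable using (_×-dec_)

  module Potential (𝓡 : CompleteOrderedField) {V : Set} {A _◁_ : Rel V 0ℓ} {Λ N}
    (C : Cobinary A _◁_ Λ N) (conn : ∀ i j → Path A i j) where
    open OrderedField 𝓡
    open RealGeometry 𝓡 using (ℝ)
    open Cobinary C using (_≟_; A-sym; _◅ₚ_)
    open Structure C

    module _ (d : V → V → ℝ) where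

      walk-sum : ∀ {w u z} → Walk A w u z → ℝ
      walk-sum stop                     = 0#
      walk-sum (step {u = u} {v} _ _ W) = d u v + walk-sum W

      path-sum : ∀ {i z} → Path A i z → ℝ
      path-sum here                   = 0#
      path-sum (go {i = i} {u} _ W) = d i u + walk-sum W

      walk-sum-unique : ∀ {w u z} (W W′ : Walk A w u z) → walk-sum W ≡ walk-sum W′
      walk-sum-unique stop         stop          = ≡.refl
      walk-sum-unique stop         (step a _ W′) = ⊥-elim (not-closed a W′)
      walk-sum-unique (step a _ W) stop          = ⊥-elim (not-closed a W)
      walk-sum-unique (step a _ W) (step a′ _ W′) with first-unique a W a′ W′
      ... | ≡.refl = ≡.cong (_ +_) (walk-sum-unique W W′)

      path-sum-unique : ∀ {i z} (P P′ : Path A i z) → path-sum P ≡ path-sum P′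
      path-sum-unique here     here       = ≡.refl
      path-sum-unique here     (go a W)   = ⊥-elim (not-closed a W)
      path-sum-unique (go a W) here       = ⊥-elim (not-closed a W)
      path-sum-unique (go a W) (go a′ W′) with first-unique a W a′ W′
      ... | ≡.refl = ≡.cong (_ +_) (walk-sum-unique W W′)

      module _ (d-antisym : ∀ i j → d i j ≈ - d j i) where

        -- Where `_◅ₚ_` cancels an edge traversed in both directions, the two contributions cancel
        -- by antisymmetry.
        path-sum-◅ : ∀ {i j z} (a : A i j) (P : Path A j z) → path-sum (a ◅ₚ P) ≈ d i j + path-sum P
        path-sum-◅ a here = refl
        path-sum-◅ {i} {j} a (go {u = u} b W) with u ≟ i
        ... | no _ = refl
        path-sum-◅ {i} {j} a (go b stop) | yes ≡.refl =
          sym (trans (+-cong (d-antisym i j) (+-identityʳ _)) (-‿inverseˡ _))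
        path-sum-◅ {i} {j} a (go b (step {v = v} c _ W)) | yes ≡.refl =
          trans (solve 3 (λ x y z → y :+ z := :- x :+ (x :+ (y :+ z))) refl (d j i) (d i v) (walk-sum W))
                (+-congʳ (sym (d-antisym i j)))

        -- Path sums do not depend on the chosen path, so the one from `i` may be taken to run
        -- through `j`. On a tree every antisymmetric `d` therefore has a potential.
        potential-difference : ∀ {i j} z → A i j → path-sum (conn i z) - path-sum (conn j z) ≈ d i j
        potential-difference {i} {j} z a = begin
          path-sum (conn i z) - path-sum (conn j z)
            ≈⟨ +-congʳ (trans (reflexive (path-sum-unique (conn i z) (a ◅ₚ conn j z))) (path-sum-◅ a (conn j z))) ⟩
          (d i j + path-sum (conn j z)) - path-sum (conn j z)
            ≈⟨ solve 2 (λ x y → x :+ y :- y := x) refl (d i j) (path-sum (conn j z)) ⟩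
          d i j ∎
          where open import Relation.Binary.Reasoning.Setoid setoid

  module TreeCone (𝓡 : CompleteOrderedField) {m k : ℕ} {A _◁_ : Rel (Fin (suc m)) 0ℓ} {Λ N}
    (C : Cobinary A _◁_ Λ N) (conn : ∀ i j → Path A i j)
    (lo hi : Fin k → Fin (suc m))
    (edge : ∀ e → A (lo e) (hi e) × Cobinary._≺_ C (lo e) (hi e))
    (edge-index : ∀ {i j} → A i j × Cobinary._≺_ C i j → ∃[ e ] lo e ≡ i × hi e ≡ j)
    (edge-unique : ∀ {e f} → lo e ≡ lo f → hi e ≡ hi f → e ≡ f) where
    open OrderedField 𝓡
    open RealGeometry 𝓡 hiding (R; R̄)
    open Cobinary C using (_≺_; oriented; ≺-asym; A-sym)
    open Centring 𝓡 m
    open Potential 𝓡 C conn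

    private
      n = suc m

      indicator : ∀ {P : Set} → Dec P → ℝ
      indicator (yes _) = 1#
      indicator (no  _) = 0#

      is-edge? : ∀ e u v → Dec (lo e ≡ u × hi e ≡ v)
      is-edge? e u v = (lo e Finₚ.≟ u) ×-dec (hi e Finₚ.≟ v)

      is-edge : Fin k → Fin n → Fin n → ℝ
      is-edge e u v = indicator (is-edge? e u v)

      jump : Fin k → Fin n → Fin n → ℝ
      jump e u v = is-edge e v u - is-edge e u v

      jump-antisym : ∀ e u v → jump e u v ≈ - jump e v u
      jump-antisym e u v = solve 2 (λ a b → a :- b := :- (b :- a)) refl (is-edge e v u) (is-edge e u v)

      indicator-yes : ∀ {P : Set} (P? : Dec P) → P → indicator P? ≡ 1#
      indicator-yes (yes _) p = ≡.refl
      indicator-yes (no ¬p) p = ⊥-elim (¬p p)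

      indicator-no : ∀ {P : Set} (P? : Dec P) → ¬ P → indicator P? ≡ 0#
      indicator-no (yes p) ¬p = ⊥-elim (¬p p)
      indicator-no (no _)  ¬p = ≡.refl

      not-reversed : ∀ e f → ¬ (lo e ≡ hi f × hi e ≡ lo f)
      not-reversed e f (p , q) = ≺-asym (proj₂ (edge f))
        (≡.subst₂ _≺_ p q (proj₂ (edge e)))

      jump-other : ∀ e f → e ≢ f → jump e (hi f) (lo f) ≈ 0#
      jump-other e f e≢f = trans (+-cong (reflexive (indicator-no (is-edge? e (lo f) (hi f)) (λ (p , q) → e≢f (edge-unique p q))))
        (-‿cong (reflexive (indicator-no (is-edge? e (hi f) (lo f)) (not-reversed e f))))) (-‿inverseʳ 0#)

      jump-same : ∀ e → jump e (hi e) (lo e) ≈ 1#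
      jump-same e = trans (+-cong (reflexive (indicator-yes (is-edge? e (lo e) (hi e)) (≡.refl , ≡.refl)))
        (-‿cong (reflexive (indicator-no (is-edge? e (hi e) (lo e)) (not-reversed e e)))))
        (solve 1 (λ o → o :- con (0 , 0) := o) refl 1#)

    private
      -- The potential of `jump e`. Up to a constant it is the indicator of that part of the tree
      -- without `e` which contains `hi e`: it rises by one along `e` and not at all along the other
      -- edges. After centring, these vectors form the basis of `H n` dual to the rises.
      raw-generator : Fin k → ℝ^ n
      raw-generator e i = path-sum (jump e) (conn i zero)

    generator : Fin k → ℝ^ n
    generator e = centre (raw-generator e)

    rise : ℝ^ n → Fin k → ℝ
    rise x e = x (hi e) - x (lo e)

    private
      generator-rise : ∀ e f → rise (generator e) f ≈ jump e (hi f) (lo f)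
      generator-rise e f = trans (centre-diff (raw-generator e) (hi f) (lo f))
        (potential-difference (jump e) (jump-antisym e) zero (A-sym (proj₁ (edge f))))

      combination-rise : ∀ (c : Fin k → ℝ) e → rise (combination c generator) e ≈ c e
      combination-rise c e = begin
        sum (λ j → c j * generator j (hi e)) - sum (λ j → c j * generator j (lo e))
          ≈⟨ sum-difference (λ j → c j * generator j (hi e)) (λ j → c j * generator j (lo e)) ⟨
        sum (λ j → c j * generator j (hi e) - c j * generator j (lo e))
          ≈⟨ sum-cong (λ j → trans (solve 3 (λ c g h → c :* g :- c :* h := c :* (g :- h)) refl
               (c j) (generator j (hi e)) (generator j (lo e))) (*-congˡ (generator-rise j e))) ⟩
        sum (λ j → c j * jump j (hi e) (lo e))
          ≈⟨ sum-single _ e (λ j j≢e → trans (*-congˡ (jump-other j e j≢e)) (zeroʳ _)) ⟩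
        c e * jump e (hi e) (lo e)
          ≈⟨ trans (*-congˡ (jump-same e)) (*-identityʳ _) ⟩
        c e ∎
        where open import Relation.Binary.Reasoning.Setoid setoid

      combination∈H : ∀ (c : Fin k → ℝ) → H n (combination c generator)
      combination∈H c = trans (∑-comm (λ i j → c j * generator j i))
        (sum-0 (λ j → trans (sum-scale (c j) (generator j)) (trans (*-congˡ (centre∈H (raw-generator j))) (zeroʳ _))))

      -- The difference is the same at both ends of each edge, hence constant by connectedness, and
      -- a constant vector with coordinate sum zero vanishes.
      determined : ∀ {x y : ℝ^ n} → H n x → H n y → (∀ e → rise x e ≈ rise y e) → ∀ i → x i ≈ y i
      determined {x} {y} x∈H y∈H same i = trans (solve 2 (λ x y → x := (x :- y) :+ y) refl (x i) (y i))
        (trans (+-congʳ (trans (constant (conn i zero)) z₀≈0)) (+-identityˡ (y i)))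
        where
        z : ℝ^ n
        z i = x i - y i
        along : ∀ {u v} → A u v → z u ≈ z v
        along {u} {v} a with oriented a
        ... | inj₁ p with edge-index (a , p)
        ...   | e , ≡.refl , ≡.refl = trans
            (solve 4 (λ a b c d → c :- d := (a :- b) :- ((a :- c) :- (b :- d))) refl (x (hi e)) (y (hi e)) (x (lo e)) (y (lo e)))
            (trans (+-congˡ (-‿cong (trans (+-congʳ (same e)) (-‿inverseʳ _))))
                   (solve 1 (λ x → x :- con (0 , 0) := x) refl _))
        along {u} {v} a | inj₂ p with edge-index (A-sym a , p)
        ...   | e , ≡.refl , ≡.refl = sym (trans
            (solve 4 (λ a b c d → c :- d := (a :- b) :- ((a :- c) :- (b :- d))) refl (x (hi e)) (y (hi e)) (x (lo e)) (y (lo e)))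
            (trans (+-congˡ (-‿cong (trans (+-congʳ (same e)) (-‿inverseʳ _))))
                   (solve 1 (λ x → x :- con (0 , 0) := x) refl _)))
        constant-walk : ∀ {w u v} → Walk A w u v → z u ≈ z v
        constant-walk stop         = refl
        constant-walk (step a _ W) = trans (along a) (constant-walk W)
        constant : ∀ {u v} → Path A u v → z u ≈ z v
        constant here     = refl
        constant (go a W) = trans (along a) (constant-walk W)
        z₀≈0 : z zero ≈ 0#
        z₀≈0 = *-cancel-0 (pos⇒≉0 (0<fromℕ-suc m)) (begin
          fromℕ n * z zero         ≈⟨ sum-const n (z zero) ⟨
          sum {n} (λ _ → z zero)   ≈⟨ sum-cong (λ i → constant (conn i zero)) ⟨
          sum z                    ≈⟨ sum-difference x y ⟩
          sum x - sum y            ≈⟨ +-cong x∈H (-‿cong y∈H) ⟩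
          0# - 0#                  ≈⟨ -‿inverseʳ 0# ⟩
          0#                       ∎)
          where open import Relation.Binary.Reasoning.Setoid setoid

      expand : ∀ {x} → H n x → ∀ i → x i ≈ combination (rise x) generator i
      expand {x} x∈H = determined x∈H (combination∈H (rise x)) (λ e → sym (combination-rise (rise x) e))

    isBasis : IsBasisOf (H n) generator
    isBasis = record
      { members     = λ e → centre∈H (raw-generator e)
      ; independent = λ c p e → trans (sym (combination-rise c e)) (trans (+-cong (p (hi e)) (-‿cong (p (lo e)))) (-‿inverseʳ 0#))
      ; spanning    = λ {x} x∈H → rise x , expand x∈H
      }

    Monotone : Pred (ℝ^ n) 0ℓ
    Monotone x = ∀ {i j} → A i j × i ≺ j → x i ≤ x j

    private
      coefficient : ∀ {x : ℝ^ n} c → (∀ i → x i ≈ combination c generator i) → ∀ e → rise x e ≈ c e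
      coefficient c p e = trans (+-cong (p (hi e)) (-‿cong (p (lo e)))) (combination-rise c e)

      in-cone : ∀ {x} c → (∀ e → 0# ≤ c e) → (∀ i → x i ≈ combination c generator i) → Monotone x × H n x
      in-cone {x} c 0≤c p =
        (λ u → let (e , lo≡ , hi≡) = edge-index u in
           ≡.subst₂ (λ i j → x i ≤ x j) lo≡ hi≡
             (≤-by (0≤c e) (sym (coefficient c p e))))
        , trans (sum-cong p) (combination∈H c)

    cone : (Monotone ∩ H n) ≐ Cone generator
    cone = (λ {x} (mono , x∈H) → rise x , (λ e → ≤-diff (mono (edge e))) , expand x∈H)
         , (λ (c , 0≤c , p) → in-cone c 0≤c p)

    side : ∀ e → Side generator e ≐ ((Monotone ∩ H n) ∩ Equaliser (lo e) (hi e))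
    side e = (λ {x} (c , 0≤c , c≈0 , p) → in-cone c 0≤c p
               , sym (trans (trans (solve 2 (λ a b → a := a :- b :+ b) refl (x (hi e)) (x (lo e)))
                        (+-congʳ (trans (coefficient c p e) c≈0))) (+-identityˡ _)))
           , (λ {x} ((mono , x∈H) , eq) → rise x , (λ e → ≤-diff (mono (edge e)))
               , trans (+-congˡ (-‿cong eq)) (-‿inverseʳ _) , expand x∈H)

-- The cobinary structure and the order cone of a given tree

module TreeAnalysis where

  open Fields
  open CobinaryCombinatorics
  open import Data.Sum.Base using ([_,_]′)
  open import Function.Base using (const)
  open import Function.Bundles using (_⇔_; Equivalence)
  open import Relation.Binary.Construct.Closure.ReflexiveTransitive using (Star; ε; _◅_)
  open import Relation.Nullary.Decidable using (decidable-stable)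

  HasSize-inhabited : ∀ {A : Set} {P : Pred A 0ℓ} {k} → HasSize (suc k) P → ∃ P
  HasSize-inhabited (x ∷ _ , _ , _ , f) = x , Equivalence.from (f x) (here ≡.refl)

  HasSize-1-unique : ∀ {A : Set} {P : Pred A 0ℓ} → HasSize 1 P → ∀ {a b} → P a → P b → a ≡ b
  HasSize-1-unique (x ∷ [] , _ , ≡.refl , ⇔) {a} {b} p q
    with Equivalence.to (⇔ a) p | Equivalence.to (⇔ b) q
  ... | here ≡.refl | here ≡.refl = ≡.refl

  HasSize-2-exhaust : ∀ {A : Set} {P : Pred A 0ℓ} → HasSize 2 P →
    ∀ {l r c} → P l → P r → l ≢ r → P c → c ≡ l ⊎ c ≡ r
  HasSize-2-exhaust (x ∷ y ∷ [] , _ , ≡.refl , ⇔) {l} {r} {c} pl pr l≢r pc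
    with Equivalence.to (⇔ l) pl | Equivalence.to (⇔ r) pr | Equivalence.to (⇔ c) pc
  ... | here ≡.refl         | here ≡.refl         | _                   = ⊥-elim (l≢r ≡.refl)
  ... | there (here ≡.refl) | there (here ≡.refl) | _                   = ⊥-elim (l≢r ≡.refl)
  ... | here ≡.refl         | there (here ≡.refl) | here ≡.refl         = inj₁ ≡.refl
  ... | here ≡.refl         | there (here ≡.refl) | there (here ≡.refl) = inj₂ ≡.refl
  ... | there (here ≡.refl) | here ≡.refl         | here ≡.refl         = inj₂ ≡.refl
  ... | there (here ≡.refl) | here ≡.refl         | there (here ≡.refl) = inj₁ ≡.refl

  module Crossing (𝓡 : CompleteOrderedField) where
    open OrderedField 𝓡

    abstract
      convex-pos : ∀ {s p q} → 0# ≤ s → s ≤ 1# → 0# < p → 0# < q → 0# < (1# - s) * p + s * q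
      convex-pos (inj₁ 0<s) s≤1 0<p 0<q =
        <-respʳ-≈ (+-comm _ _) (+-pos-nonneg (*-pos 0<s 0<q) (*-nonneg (≤-diff s≤1) (<⇒≤ 0<p)))
      convex-pos {s} {p} {q} (inj₂ 0≈s) s≤1 0<p 0<q = <-respʳ-≈ (sym (trans (+-cong (*-congʳ (trans (+-congˡ (-‿cong (sym 0≈s)))
        (solve 1 (λ o → o :- con (0 , 0) := o) refl 1#))) (*-congʳ (sym 0≈s)))
        (trans (+-cong (*-identityˡ p) (zeroˡ q)) (+-identityʳ p)))) 0<p

      below-identity : ∀ s a b c → (1# - s) * (c - a) + s * (c - b) ≈ c - (a + s * (b - a))
      below-identity = solve 4 (λ s a b c → (con (1 , 0) :- s) :* (c :- a) :+ s :* (c :- b) := c :- (a :+ s :* (b :- a))) refl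

      above-identity : ∀ s a b c → (1# - s) * (a - c) + s * (b - c) ≈ (a + s * (b - a)) - c
      above-identity = solve 4 (λ s a b c → (con (1 , 0) :- s) :* (a :- c) :+ s :* (b :- c) := (a :+ s :* (b :- a)) :- c) refl

      crossing : ∀ {a b c} → a < b → a ≤ c → c ≤ b → ∃[ s ] 0# ≤ s × s ≤ 1# × a + s * (b - a) ≈ c
      crossing {a} {b} {c} a<b a≤c c≤b = s , *-nonneg (≤-diff a≤c) (<⇒≤ (⁻¹-pos 0<D)) , s≤1
        , trans (+-congˡ sD) (solve 2 (λ a c → a :+ (c :- a) := c) refl a c)
        where
        D : Carrier
        D = b - a
        0<D : 0# < D
        0<D = <-diff a<b
        s : Carrier
        s = (c - a) * D ⁻¹
        sD : s * D ≈ c - a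
        sD = ⁻¹-* 0<D
        c-a≤D : c - a ≤ D
        c-a≤D = ≤-by (≤-diff c≤b) (solve 3 (λ a b c → b :- c := (b :- a) :- (c :- a)) refl a b c)
        s≤1 : s ≤ 1#
        s≤1 with <⊎≥ 1# s
        ... | inj₂ p = p
        ... | inj₁ p = ⊥-elim (≤⇒≯ c-a≤D (<-respˡ-≈ (*-identityʳ D) (<-respʳ-≈ (trans (*-comm D s) sD) (*-monoˡ-< 0<D p))))

  module Analysis (𝓡 : CompleteOrderedField) {n : ℕ} (T : RealGeometry.MCT 𝓡 n) where
    open OrderedField 𝓡
    open RealGeometry 𝓡 hiding (R̄)
    open Crossing 𝓡
    open MCT T hiding (signVector; EdgeNumbering; module EdgeNumbering)

    A : Rel (Fin n) 0ℓ
    A i j = Adj (node i) (node j)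

    infix 4 _≺_
    _≺_ : Rel (Fin n) 0ℓ
    i ≺ j = yc (node i) < yc (node j)

    Adj-sym : ∀ {u v} → Adj u v → Adj v u
    Adj-sym {u} {v} p = ≡.trans (symmetric v u) p

    vertical : ∀ {u v} → Adj u v → yc u < yc v ⊎ yc v < yc u
    vertical {u} {v} a with compare (yc u) (yc v)
    ... | tri< p _ _ = inj₁ p
    ... | tri≈ _ p _ = ⊥-elim (noHorizontal a p)
    ... | tri> _ _ p = inj₂ p

    x-mono : ∀ {i j} → i Fin.< j → xc (node i) < xc (node j)
    x-mono {i} {j} p = <-respˡ-≈ (sym (node-x i)) (<-respʳ-≈ (sym (node-x j)) (fromℕ-mono-< {suc (toℕ i)} {suc (toℕ j)} (ℕ.s≤s p)))

    x-cancel : ∀ {i j} → xc (node i) < xc (node j) → i Fin.< j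
    x-cancel {i} {j} p = ℕ.s≤s⁻¹ (fromℕ-cancel-< {suc (toℕ i)} {suc (toℕ j)} (<-respˡ-≈ (node-x i) (<-respʳ-≈ (node-x j) p)))

    node-injective : ∀ {i j} → node i ≡ node j → i ≡ j
    node-injective {i} {j} p with Finₚ.<-cmp i j
    ... | tri< q _ _ = ⊥-elim (<-irrefl (reflexive (≡.cong xc p)) (x-mono q))
    ... | tri≈ _ q _ = q
    ... | tri> _ _ q = ⊥-elim (<-irrefl (reflexive (≡.cong xc (≡.sym p))) (x-mono q))

    type-Λ : ∀ {i} → signVector T i ≡ Sign.+ → IsΛ (node i)
    type-Λ {i} = pick (nodeType i)
      where
      pick : ∀ {P Q : Set} (t : P ⊎ Q) → [ const Sign.+ , const Sign.- ]′ t ≡ Sign.+ → P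
      pick (inj₁ p) _ = p

    type-V : ∀ {i} → signVector T i ≡ Sign.- → IsV (node i)
    type-V {i} = pick (nodeType i)
      where
      pick : ∀ {P Q : Set} (t : P ⊎ Q) → [ const Sign.+ , const Sign.- ]′ t ≡ Sign.- → Q
      pick (inj₂ p) _ = p

    Split : Vertex → Vertex → Vertex → Set
    Split a v b = xc a < xc v × xc v < xc b ⊎ xc b < xc v × xc v < xc a

    private
      split : ∀ {P : Pred Vertex 0ℓ} {v} → HasSize 2 P →
              (∃[ l ] ∃[ r ] P l × P r × xc l < xc v × xc v < xc r) →
              ∀ {a b} → P a → P b → a ≢ b → Split a v b
      split {P} {v} size (l , r , pl , pr , l<v , v<r) pa pb a≢b
        with HasSize-2-exhaust size pl pr l≢r pa | HasSize-2-exhaust size pl pr l≢r pb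
        where
        l≢r : l ≢ r
        l≢r ≡.refl = <-asym l<v v<r
      ... | inj₁ ≡.refl | inj₁ ≡.refl = ⊥-elim (a≢b ≡.refl)
      ... | inj₁ ≡.refl | inj₂ ≡.refl = inj₁ (l<v , v<r)
      ... | inj₂ ≡.refl | inj₁ ≡.refl = inj₂ (l<v , v<r)
      ... | inj₂ ≡.refl | inj₂ ≡.refl = ⊥-elim (a≢b ≡.refl)

    children-split : ∀ {v a b} → IsΛ v → Child v a → Child v b → a ≢ b → Split a v b
    children-split t = split (IsΛ.children t) (IsΛ.separated t)

    parents-split : ∀ {v a b} → IsV v → Parent v a → Parent v b → a ≢ b → Split a v b
    parents-split t = split (IsV.parents t) (IsV.separated t)

    private
      -- Such an edge meets the vertical line through `v` at a height that is a convex combination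
      -- of the heights of its ends, hence on the wall.
      wall-below : ∀ {v a b} → IsΛ v → Adj a b → yc a < yc v → yc b < yc v →
                   ¬ (xc a < xc b × xc a ≤ xc v × xc v ≤ xc b)
      wall-below {v} {a} {b} t e ya yb (p , q , r) =
        let (s , 0≤s , s≤1 , eq) = crossing p q r
        in IsΛ.wall t {xc a + s * (xc b - xc a) , yc a + s * (yc b - yc a)} (a , b , e , s , 0≤s , s≤1 , refl , refl)
             (eq , <-by (convex-pos 0≤s s≤1 (<-diff ya) (<-diff yb)) (below-identity s (yc a) (yc b) (yc v)))

      wall-above : ∀ {v a b} → IsV v → Adj a b → yc v < yc a → yc v < yc b →
                   ¬ (xc a < xc b × xc a ≤ xc v × xc v ≤ xc b)
      wall-above {v} {a} {b} t e ya yb (p , q , r) =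
        let (s , 0≤s , s≤1 , eq) = crossing p q r
        in IsV.wall t {xc a + s * (xc b - xc a) , yc a + s * (yc b - yc a)} (a , b , e , s , 0≤s , s≤1 , refl , refl)
             (eq , <-by (convex-pos 0≤s s≤1 (<-diff ya) (<-diff yb)) (above-identity s (yc a) (yc b) (yc v)))

      stays-left : ∀ {a b c} → ¬ (a < b × a ≤ c × c ≤ b) → a < c → b < c
      stays-left {a} {b} {c} h p with <⊎≥ b c
      ... | inj₁ q = q
      ... | inj₂ q = ⊥-elim (h (<-≤-trans p q , <⇒≤ p , q))

      stays-right : ∀ {a b c} → ¬ (b < a × b ≤ c × c ≤ a) → c < a → c < b
      stays-right {a} {b} {c} h p with <⊎≥ c b
      ... | inj₁ q = q
      ... | inj₂ q = ⊥-elim (h (≤-<-trans q p , q , <⇒≤ p))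

    -- `nodeComplete` yields only the double negation of being a leaf; this is enough because
    -- equality of vertices is decidable.
    not-node-leaf : ∀ {v} → ¬ (∃[ i ] node i ≡ v) → ∀ {a b} → Adj v a → Adj v b → a ≡ b
    not-node-leaf {v} ¬node {a} {b} p q = decidable-stable (a Finₚ.≟ b) λ a≢b →
      ¬node (nodeComplete (λ leaf → a≢b (HasSize-1-unique leaf p q)))

    node? : ∀ v → Dec (∃[ i ] node i ≡ v)
    node? v = Finₚ.any? (λ i → node i Finₚ.≟ v)

    private
      mutual
        from-node : ∀ {i j} → Star Adj (node i) (node j) → Star A i j
        from-node {i} {j} s = at-node s ≡.refl

        at-node : ∀ {v i j} → Star Adj v (node j) → v ≡ node i → Star A i j
        at-node ε eq with node-injective eq
        ... | ≡.refl = ε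
        at-node (_◅_ {j = w} a s) ≡.refl with node? w
        ... | yes (k , ≡.refl) = a ◅ at-node s ≡.refl
        ... | no ¬node         = at-leaf ¬node (Adj-sym a) s

        -- From a leaf the walk can only return to the node it came from, so the excursion is cut
        -- out.
        at-leaf : ∀ {v i j} → ¬ (∃[ k ] node k ≡ v) → Adj v (node i) → Star Adj v (node j) → Star A i j
        at-leaf ¬node a ε       = ⊥-elim (¬node (_ , ≡.refl))
        at-leaf ¬node a (b ◅ s) = at-node s (not-node-leaf ¬node b a)

    module Signed (ε : Fin n → Sign) (sign : signVector T ≗ ε) where

      Λ V : Pred (Fin n) 0ℓ
      Λ i = ε i ≡ Sign.+
      V i = ε i ≡ Sign.-

      isΛ : ∀ {i} → Λ i → IsΛ (node i)
      isΛ {i} p = type-Λ (≡.trans (sign i) p)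

      isV : ∀ {i} → V i → IsV (node i)
      isV {i} p = type-V (≡.trans (sign i) p)

      kind : ∀ i → Λ i ⊎ V i
      kind i with ε i
      ... | Sign.+ = inj₁ ≡.refl
      ... | Sign.- = inj₂ ≡.refl

      private
        sides : ∀ {a u b} → Split (node a) (node u) (node b) → a Fin.< u × u Fin.< b ⊎ b Fin.< u × u Fin.< a
        sides (inj₁ (p , q)) = inj₁ (x-cancel p , x-cancel q)
        sides (inj₂ (p , q)) = inj₂ (x-cancel p , x-cancel q)

        top-turn : ∀ {a b u} → A a u → A b u → a ≺ u → b ≺ u → a ≢ b →
                   Λ u × (a Fin.< u × u Fin.< b ⊎ b Fin.< u × u Fin.< a)
        top-turn {a} {b} {u} p q r s a≢b with kind u
        ... | inj₁ Λu = Λu , sides (children-split (isΛ Λu) (Adj-sym p , r) (Adj-sym q , s) (λ eq → a≢b (node-injective eq)))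
        ... | inj₂ Vu = ⊥-elim (a≢b (node-injective (HasSize-1-unique (IsV.children (isV Vu)) (Adj-sym p , r) (Adj-sym q , s))))

        bot-turn : ∀ {a b u} → A a u → A b u → u ≺ a → u ≺ b → a ≢ b →
                   V u × (a Fin.< u × u Fin.< b ⊎ b Fin.< u × u Fin.< a)
        bot-turn {a} {b} {u} p q r s a≢b with kind u
        ... | inj₂ Vu = Vu , sides (parents-split (isV Vu) (Adj-sym p , r) (Adj-sym q , s) (λ eq → a≢b (node-injective eq)))
        ... | inj₁ Λu = ⊥-elim (a≢b (node-injective (HasSize-1-unique (IsΛ.parents (isΛ Λu)) (Adj-sym p , r) (Adj-sym q , s))))

      cobinary : Cobinary A Fin._<_ Λ V
      cobinary = record
        { _≟_ = Finₚ._≟_ ; A-sym = Adj-sym ; ◁-trans = Finₚ.<-trans ; ◁-asym = ℕₚ.<-asym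
        ; _≺_ = _≺_ ; ≺-trans = <-trans ; ≺-asym = <-asym ; oriented = vertical
        ; top-turn = top-turn ; bot-turn = bot-turn
        ; wallΛˡ = λ t e p q r → x-cancel (stays-left (wall-below (isΛ t) e p q) (x-mono r))
        ; wallΛʳ = λ t e p q r → x-cancel (stays-right (wall-below (isΛ t) (Adj-sym e) q p) (x-mono r))
        ; wallVˡ = λ t e p q r → x-cancel (stays-left (wall-above (isV t) e p q) (x-mono r))
        ; wallVʳ = λ t e p q r → x-cancel (stays-right (wall-above (isV t) (Adj-sym e) q p) (x-mono r))
        }

      path : ∀ i j → Path A i j
      path i j = Cobinary.path cobinary (from-node (proj₁ isTree (node i) (node j)))

    U : Rel (Fin n) 0ℓ
    U i j = A i j × i ≺ j

    height : ℝ^ n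
    height i = yc (node i)

    Rising : Pred (ℝ^ n) 0ℓ
    Rising x = ∀ {i j} → U i j → x i < x j

    private
      slope-pos : ∀ {i j} → i Fin.< j → i ≺ j → sgn (slope i j) ≡ 1#
      slope-pos p q = sgn-pos (*-pos (<-diff q) (⁻¹-pos (<-diff (x-mono p))))

      abstract
        neg-slope : ∀ {a b d} → b < a → 0# < d → (b - a) * d < 0#
        neg-slope {a} {b} {d} p q = <-by (*-pos (<-diff p) q)
          (solve 3 (λ a b d → (a :- b) :* d := con (0 , 0) :- (b :- a) :* d) refl a b d)

        neg-one : ∀ {a b} → a < b → 0# < - 1# * (a - b)
        neg-one {a} {b} p = <-respʳ-≈ (solve 2 (λ a b → b :- a := :- con (1 , 0) :* (a :- b)) refl a b) (<-diff p)

        neg-one⁻¹ : ∀ {a b} → 0# < - 1# * (a - b) → a < b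
        neg-one⁻¹ {a} {b} p = <-by p (solve 2 (λ a b → :- con (1 , 0) :* (a :- b) := b :- a) refl a b)

        one⁻¹ : ∀ {a b} → 0# < 1# * (b - a) → a < b
        one⁻¹ {a} {b} p = <-by p (*-identityˡ _)

        one : ∀ {a b} → a < b → 0# < 1# * (b - a)
        one p = <-respʳ-≈ (sym (*-identityˡ _)) (<-diff p)

      slope-neg : ∀ {i j} → i Fin.< j → j ≺ i → sgn (slope i j) ≡ - 1#
      slope-neg p q = sgn-neg (neg-slope q (⁻¹-pos (<-diff (x-mono p))))

    -- The slope of an edge read from left to right has the sign of its change of height, so
    -- orienting all edges upwards absorbs the signs in `R`.
    R⇒Rising : ∀ {x} → R T x → Rising x
    R⇒Rising {x} r {i} {j} (a , p) with Finₚ.<-cmp i j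
    ... | tri< q _ _      = one⁻¹ (≡.subst (λ s → 0# < s * (x j - x i)) (slope-pos q p) (r (q , a)))
    ... | tri≈ _ ≡.refl _ = ⊥-elim (<-irrefl refl p)
    ... | tri> _ _ q      = neg-one⁻¹ (≡.subst (λ s → 0# < s * (x i - x j)) (slope-neg q p) (r (q , Adj-sym a)))

    Rising⇒R : ∀ {x} → Rising x → R T x
    Rising⇒R {x} r {i} {j} (q , a) with vertical a
    ... | inj₁ p = ≡.subst (λ s → 0# < s * (x j - x i)) (≡.sym (slope-pos q p)) (one (r (a , p)))
    ... | inj₂ p = ≡.subst (λ s → 0# < s * (x j - x i)) (≡.sym (slope-neg q p)) (neg-one (r (Adj-sym a , p)))

-- The cone of a tree and the numbering of its edges

module EdgeCones where

  open Fields
  open CobinaryCombinatorics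
  open OrderCones
  open SimplicialCones
  open TreeAnalysis

  module Pieces (𝓡 : CompleteOrderedField) {n : ℕ} (T : RealGeometry.MCT 𝓡 n) where
    open RealGeometry 𝓡
    open Analysis 𝓡 T using (U; height; R⇒Rising; Rising⇒R)
    -- The heights of the nodes increase along `U` by its very definition, so they serve as the
    -- point of the open cone.
    open OrderCone 𝓡 U height proj₂ public

    closure-mono : ∀ {P Q : Pred (ℝ^ n) _} → P ⊆ Q → Closure P ⊆ Closure Q
    closure-mono P⊆Q cl 0<δ = let (y , near , p) = cl 0<δ in y , near , P⊆Q p

    R̄⇒Mono≤ : R̄ T ⊆ Mono≤
    R̄⇒Mono≤ r = closure⇒Mono≤ (closure-mono (R⇒Rising {_}) r)

    Mono≤⇒R̄ : Mono≤ ⊆ R̄ T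
    Mono≤⇒R̄ {x} p = closure-mono {Mono<} {R T} Rising⇒R (Mono≤⇒closure {x} p)

    interior-R̄ : Interior (R̄ T) ≐ R T
    interior-R̄ =
        (λ {x} (δ , 0<δ , ball) → Rising⇒R (interior⇒Mono< {x} (δ , 0<δ , λ {y} near → R̄⇒Mono≤ (ball near))))
      , (λ {x} r → let (δ , 0<δ , ball) = Mono<⇒interior {x} (R⇒Rising r) in
           δ , 0<δ , λ {y} near → Mono≤⇒R̄ {y} (ball near))

  module Numbering (𝓡 : CompleteOrderedField) {m : ℕ} (T : RealGeometry.MCT 𝓡 (suc m))
    (ε : Fin (suc m) → Sign) (sign : RealGeometry.signVector T ≗ ε) where
    open RealGeometry 𝓡
    open Analysis 𝓡 T
    open Signed ε sign
    open Cobinary cobinary using (oriented; A-sym; ≺-asym)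
    open Structure cobinary using (not-closed; first-unique)
    open Pieces 𝓡 T using (R̄⇒Mono≤; Mono≤⇒R̄)

    private
      n = suc m

      -- The edges are numbered by the nodes other than the root 0: k stands for the
      -- first edge on the path from k + 1 to the root.
      first : ∀ k → ∃[ c ] A (suc k) c × Walk A (suc k) c zero
      first k with path (suc k) zero
      ... | go a W = _ , a , W

      next : Fin m → Fin n
      next k = proj₁ (first k)

      Joins : Fin n → Fin n → Fin n → Fin n → Set
      Joins l r i j = (l ≡ i × r ≡ j) ⊎ (l ≡ j × r ≡ i)

      sorted : ∀ i j → A i j → ∃[ l ] ∃[ r ] (l Fin.< r × A l r) × Joins l r i j
      sorted i j a with Finₚ.<-cmp i j
      ... | tri< p _ _      = i , j , (p , a) , inj₁ (≡.refl , ≡.refl)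
      ... | tri≈ _ ≡.refl _ = ⊥-elim (not-closed a stop)
      ... | tri> _ _ p      = j , i , (p , A-sym a) , inj₂ (≡.refl , ≡.refl)

      edge-of : ∀ k → ∃[ l ] ∃[ r ] (l Fin.< r × A l r) × Joins l r (suc k) (next k)
      edge-of k = sorted (suc k) (next k) (proj₁ (proj₂ (first k)))

      next-is : ∀ {k j} → A (suc k) j → Walk A (suc k) j zero → next k ≡ j
      next-is {k} a W = first-unique (proj₁ (proj₂ (first k))) (proj₂ (proj₂ (first k))) a W

      -- If the path from `j` to the root does not begin with this edge, then putting the edge in
      -- front of it gives the path from `i`, which does.
      towards-root : ∀ i j → A i j → ∃[ k ] Joins (suc k) (next k) i j
      towards-root zero    zero    a = ⊥-elim (not-closed a stop)
      towards-root (suc k) zero    a = k , inj₁ (≡.refl , next-is a stop)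
      towards-root i       (suc l) a with next l Finₚ.≟ i
      ... | yes p = l , inj₂ (≡.refl , p)
      ... | no ¬p with i | step {w = i} (proj₁ (proj₂ (first l))) ¬p (proj₂ (proj₂ (first l)))
      ...   | zero  | W = ⊥-elim (not-closed a W)
      ...   | suc k | W = k , inj₁ (≡.refl , next-is a W)

      -- The path from `suc k` would go to `suc l` and immediately back.
      not-mutual : ∀ {k l} → next k ≡ suc l → next l ≢ suc k
      not-mutual {k} {l} p q with first k
      not-mutual {k} {l} ≡.refl q | _ , a , step b c≢k W = c≢k (≡.trans (≡.sym (next-is b W)) q)

      joins-unique : ∀ {l r l′ r′ i j} → l Fin.< r → l′ Fin.< r′ → Joins l r i j → Joins l′ r′ i j → l ≡ l′ × r ≡ r′
      joins-unique p q (inj₁ (≡.refl , ≡.refl)) (inj₁ (≡.refl , ≡.refl)) = ≡.refl , ≡.refl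
      joins-unique p q (inj₁ (≡.refl , ≡.refl)) (inj₂ (≡.refl , ≡.refl)) = ⊥-elim (Finₚ.<-asym p q)
      joins-unique p q (inj₂ (≡.refl , ≡.refl)) (inj₁ (≡.refl , ≡.refl)) = ⊥-elim (Finₚ.<-asym p q)
      joins-unique p q (inj₂ (≡.refl , ≡.refl)) (inj₂ (≡.refl , ≡.refl)) = ≡.refl , ≡.refl

      joins-trans : ∀ {a b c d e f} → Joins a b c d → Joins c d e f → Joins a b e f
      joins-trans (inj₁ (≡.refl , ≡.refl)) t = t
      joins-trans (inj₂ (≡.refl , ≡.refl)) (inj₁ (≡.refl , ≡.refl)) = inj₂ (≡.refl , ≡.refl)
      joins-trans (inj₂ (≡.refl , ≡.refl)) (inj₂ (≡.refl , ≡.refl)) = inj₁ (≡.refl , ≡.refl)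

      joins-sym : ∀ {a b c d} → Joins a b c d → Joins c d a b
      joins-sym (inj₁ (≡.refl , ≡.refl)) = inj₁ (≡.refl , ≡.refl)
      joins-sym (inj₂ (≡.refl , ≡.refl)) = inj₂ (≡.refl , ≡.refl)

      same-child : ∀ {k l} → Joins (suc k) (next k) (suc l) (next l) → k ≡ l
      same-child (inj₁ (≡.refl , _)) = ≡.refl
      same-child (inj₂ (p , q))      = ⊥-elim (not-mutual q (≡.sym p))

    numbering : EdgeNumbering T
    numbering = record
      { edgeLeft     = λ k → proj₁ (edge-of k)
      ; edgeRight    = λ k → proj₁ (proj₂ (edge-of k))
      ; internalEdge = λ k → proj₁ (proj₂ (proj₂ (edge-of k)))
      ; exhaustive   = λ {i} {j} (p , a) →
          let (k , joins) = towards-root i j a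
              (_ , _ , (q , _) , joins′) = edge-of k
          in k , joins-unique q p (joins-trans joins′ joins) (inj₁ (≡.refl , ≡.refl))
               , λ {l} (s , t) → same-child (joins-trans joins
                   (joins-trans (joins-sym (inj₁ (s , t))) (proj₂ (proj₂ (proj₂ (edge-of l))))))
      }

    module _ (ℓ : EdgeNumbering T) where
      private
        L R′ : Fin m → Fin n
        L  = edgeLeft ℓ
        R′ = edgeRight ℓ

        rising : ∀ i j → A i j → ∃[ l ] ∃[ h ] U l h × Joins l h i j
        rising i j a with oriented a
        ... | inj₁ p = i , j , (a , p) , inj₁ (≡.refl , ≡.refl)
        ... | inj₂ p = j , i , (A-sym a , p) , inj₂ (≡.refl , ≡.refl)

        -- An `EdgeNumbering` lists the ends of an edge from left to right, whereas `TreeCone` takes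
        -- them from bottom to top.
        orient : ∀ e → ∃[ l ] ∃[ h ] U l h × Joins l h (L e) (R′ e)
        orient e = rising (L e) (R′ e) (proj₂ (EdgeNumbering.internalEdge ℓ e))

        lo hi : Fin m → Fin n
        lo e = proj₁ (orient e)
        hi e = proj₁ (proj₂ (orient e))

        joins-≺ : ∀ {l h i j} → U l h → U i j → Joins l h i j → l ≡ i × h ≡ j
        joins-≺ u v (inj₁ p) = p
        joins-≺ (_ , p) (_ , q) (inj₂ (≡.refl , ≡.refl)) = ⊥-elim (≺-asym p q)

        numbered : ∀ {l r} → l Fin.< r → A l r → ∃[ e ] Joins (L e) (R′ e) l r
        numbered p a = let (e , joins , _) = EdgeNumbering.exhaustive ℓ (p , a) in e , inj₁ joins

        edge-index : ∀ {i j} → U i j → ∃[ e ] lo e ≡ i × hi e ≡ j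
        edge-index {i} {j} u =
          let (l , r , (p , a) , joins) = sorted i j (proj₁ u)
              (e , joins′) = numbered p a
              (_ , _ , u′ , joins″) = orient e
          in e , joins-≺ u′ u (joins-trans joins″ (joins-trans joins′ joins))

        edge-unique : ∀ {e f} → lo e ≡ lo f → hi e ≡ hi f → e ≡ f
        edge-unique {e} {f} p q =
          let pe = EdgeNumbering.internalEdge ℓ e
              pf = EdgeNumbering.internalEdge ℓ f
              (_ , _ , unique) = EdgeNumbering.exhaustive ℓ pf
              same = joins-unique (proj₁ pe) (proj₁ pf)
                       (joins-trans (joins-sym (proj₂ (proj₂ (proj₂ (orient e))))) (joins-trans (inj₁ (p , q)) (proj₂ (proj₂ (proj₂ (orient f))))))
                       (inj₁ (≡.refl , ≡.refl))
          in ≡.trans (≡.sym (unique same)) (unique (≡.refl , ≡.refl))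

      open TreeCone 𝓡 cobinary path lo hi (λ e → proj₁ (proj₂ (proj₂ (orient e)))) edge-index edge-unique
      open OrderedField 𝓡 using (sym)

      private
        equaliser : ∀ {x : ℝ^ n} {l h i j} → Joins l h i j →
                    (Equaliser l h x → Equaliser i j x) × (Equaliser i j x → Equaliser l h x)
        equaliser (inj₁ (≡.refl , ≡.refl)) = (λ p → p) , (λ p → p)
        equaliser (inj₂ (≡.refl , ≡.refl)) = sym , sym

      simplicial-cone : Σ[ b ∈ (Fin m → ℝ^ n) ] IsBasisOf (H n) b × (R̄ T ∩ H n) ≐ Cone b ×
        (∀ i → Side b i ≐ ((R̄ T ∩ H n) ∩ Equaliser (edgeLeft ℓ i) (edgeRight ℓ i)))
      simplicial-cone = generator , isBasis
        , ( (λ {x} (r , x∈H) → proj₁ cone {x} (R̄⇒Mono≤ r , x∈H))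
          , (λ {x} c → let (r , x∈H) = proj₂ cone {x} c in Mono≤⇒R̄ {x} r , x∈H))
        , λ e → let joins = proj₂ (proj₂ (proj₂ (orient e))) in
            (λ {x} s → let ((r , x∈H) , eq) = proj₁ (side e) {x} s in
               (Mono≤⇒R̄ {x} r , x∈H) , proj₁ (equaliser {x} joins) eq)
          , (λ {x} ((r , x∈H) , eq) → proj₂ (side e) {x} ((R̄⇒Mono≤ r , x∈H) , proj₂ (equaliser {x} joins) eq))

-- Isomorphism of trees and equality of cones

module Isomorphisms where

  open Fields
  open CobinaryCombinatorics
  open TreeAnalysis
  open import Data.Bool.Base using (Bool; true; false)
  open import Function.Bundles using (Equivalence; mk↔ₛ′; mk⇔)
  open import Relation.Binary.Construct.Closure.ReflexiveTransitive using (Star; _◅_) renaming (ε to stay)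

  -- The three edges at a node: left and right are the two separated by the wall.
  data Port : Set where
    left right alone : Port

  module Ports (𝓡 : CompleteOrderedField) {n : ℕ} (T : RealGeometry.MCT 𝓡 n)
    (ε : Fin n → Sign) (sign : RealGeometry.signVector T ≗ ε) where
    open OrderedField 𝓡
    open RealGeometry 𝓡
    open MCT T hiding (signVector; EdgeNumbering; module EdgeNumbering)
    open Analysis 𝓡 T
    open Signed ε sign

    AtPort : Sign → Fin n → Port → Vertex → Set
    AtPort Sign.+ i left  v = Child (node i) v × xc v < xc (node i)
    AtPort Sign.+ i right v = Child (node i) v × xc (node i) < xc v
    AtPort Sign.+ i alone v = Parent (node i) v
    AtPort Sign.- i left  v = Parent (node i) v × xc v < xc (node i)
    AtPort Sign.- i right v = Parent (node i) v × xc (node i) < xc v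
    AtPort Sign.- i alone v = Child (node i) v

    private
      same-side : ∀ {a v b} → xc a < xc v → xc b < xc v → ¬ Split a v b
      same-side p q (inj₁ (_ , r)) = <-asym q r
      same-side p q (inj₂ (_ , r)) = <-asym p r

      same-side′ : ∀ {a v b} → xc v < xc a → xc v < xc b → ¬ Split a v b
      same-side′ p q (inj₁ (r , _)) = <-asym p r
      same-side′ p q (inj₂ (r , _)) = <-asym q r

      ≡-by : ∀ {a b : Vertex} → ¬ (a ≢ b) → a ≡ b
      ≡-by {a} {b} ¬≢ with a Finₚ.≟ b
      ... | yes p = p
      ... | no  p = ⊥-elim (¬≢ p)

    port-exists : ∀ i κ → ∃[ v ] AtPort (ε i) i κ v
    port-exists i κ = by (ε i) κ isΛ isV
      where
      by : ∀ s κ → (ε i ≡ Sign.+ → IsΛ (node i)) → (ε i ≡ Sign.- → IsV (node i)) → {{_ : ε i ≡ s}} → ∃[ v ] AtPort s i κ v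
      by Sign.+ left  λ′ _ {{e}} = let (l , r , pl , pr , p , q) = IsΛ.separated (λ′ e) in l , pl , p
      by Sign.+ right λ′ _ {{e}} = let (l , r , pl , pr , p , q) = IsΛ.separated (λ′ e) in r , pr , q
      by Sign.+ alone λ′ _ {{e}} = HasSize-inhabited (IsΛ.parents (λ′ e))
      by Sign.- left  _ v′ {{e}} = let (l , r , pl , pr , p , q) = IsV.separated (v′ e) in l , pl , p
      by Sign.- right _ v′ {{e}} = let (l , r , pl , pr , p , q) = IsV.separated (v′ e) in r , pr , q
      by Sign.- alone _ v′ {{e}} = HasSize-inhabited (IsV.children (v′ e))

    at-port-unique : ∀ {s i} → ε i ≡ s → ∀ κ {v w} → AtPort s i κ v → AtPort s i κ w → v ≡ w
    at-port-unique {Sign.+} e left  (p , q) (p′ , q′) = ≡-by λ ne → same-side q q′ (children-split (isΛ e) p p′ ne)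
    at-port-unique {Sign.+} e right (p , q) (p′ , q′) = ≡-by λ ne → same-side′ q q′ (children-split (isΛ e) p p′ ne)
    at-port-unique {Sign.+} e alone p p′ = HasSize-1-unique (IsΛ.parents (isΛ e)) p p′
    at-port-unique {Sign.-} e left  (p , q) (p′ , q′) = ≡-by λ ne → same-side q q′ (parents-split (isV e) p p′ ne)
    at-port-unique {Sign.-} e right (p , q) (p′ , q′) = ≡-by λ ne → same-side′ q q′ (parents-split (isV e) p p′ ne)
    at-port-unique {Sign.-} e alone p p′ = HasSize-1-unique (IsV.children (isV e)) p p′

    port-unique : ∀ s {i} κ κ′ {v} → AtPort s i κ v → AtPort s i κ′ v → κ ≡ κ′
    port-unique s left  left  _ _ = ≡.refl
    port-unique s right right _ _ = ≡.refl
    port-unique s alone alone _ _ = ≡.refl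
    port-unique Sign.+ left  right (_ , p) (_ , q) = ⊥-elim (<-asym p q)
    port-unique Sign.+ left  alone ((_ , p) , _) (_ , q) = ⊥-elim (<-asym p q)
    port-unique Sign.+ right left  (_ , p) (_ , q) = ⊥-elim (<-asym p q)
    port-unique Sign.+ right alone ((_ , p) , _) (_ , q) = ⊥-elim (<-asym p q)
    port-unique Sign.+ alone left  (_ , q) ((_ , p) , _) = ⊥-elim (<-asym p q)
    port-unique Sign.+ alone right (_ , q) ((_ , p) , _) = ⊥-elim (<-asym p q)
    port-unique Sign.- left  right (_ , p) (_ , q) = ⊥-elim (<-asym p q)
    port-unique Sign.- left  alone ((_ , p) , _) (_ , q) = ⊥-elim (<-asym p q)
    port-unique Sign.- right left  (_ , p) (_ , q) = ⊥-elim (<-asym p q)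
    port-unique Sign.- right alone ((_ , p) , _) (_ , q) = ⊥-elim (<-asym p q)
    port-unique Sign.- alone left  (_ , q) ((_ , p) , _) = ⊥-elim (<-asym p q)
    port-unique Sign.- alone right (_ , q) ((_ , p) , _) = ⊥-elim (<-asym p q)

    port-adj : ∀ s {i} κ {v} → AtPort s i κ v → Adj (node i) v
    port-adj Sign.+ left  ((a , _) , _) = a
    port-adj Sign.+ right ((a , _) , _) = a
    port-adj Sign.+ alone (a , _)       = a
    port-adj Sign.- left  ((a , _) , _) = a
    port-adj Sign.- right ((a , _) , _) = a
    port-adj Sign.- alone (a , _)       = a

    private
      side-of : ∀ {P : Pred Vertex _} {v c} → HasSize 2 P →
                (∃[ l ] ∃[ r ] P l × P r × xc l < xc v × xc v < xc r) → P c →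
                xc c < xc v ⊎ xc v < xc c
      side-of size (l , r , pl , pr , p , q) pc
        with HasSize-2-exhaust size pl pr (λ { ≡.refl → <-asym p q }) pc
      ... | inj₁ ≡.refl = inj₁ p
      ... | inj₂ ≡.refl = inj₂ q

    adj-port : ∀ {s i} → ε i ≡ s → ∀ {v} → Adj (node i) v → ∃[ κ ] AtPort s i κ v
    adj-port {Sign.+} {i} e a with vertical a
    ... | inj₁ up = alone , a , up
    ... | inj₂ dn with side-of (IsΛ.children (isΛ e)) (IsΛ.separated (isΛ e)) (a , dn)
    ...   | inj₁ p = left , (a , dn) , p
    ...   | inj₂ p = right , (a , dn) , p
    adj-port {Sign.-} {i} e a with vertical a
    ... | inj₂ dn = alone , a , dn
    ... | inj₁ up with side-of (IsV.parents (isV e)) (IsV.separated (isV e)) (a , up)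
    ...   | inj₁ p = left , (a , up) , p
    ...   | inj₂ p = right , (a , up) , p

    IsNode : Vertex → Set
    IsNode v = ∃[ i ] node i ≡ v

    private
      -- Two adjacent non-nodes would form a connected component of T.
      no-leaf-edge : ∀ {u v r} → ¬ IsNode u → ¬ IsNode v → Adj u v → ¬ Star Adj u (node r)
      no-leaf-edge ¬u ¬v a stay = ¬u (_ , ≡.refl)
      no-leaf-edge ¬u ¬v a (b ◅ s) with not-node-leaf ¬u b a
      ... | ≡.refl = no-leaf-edge ¬v ¬u (Adj-sym a) s

    leaf-port : Fin n → ∀ v → ¬ IsNode v → ∃[ i ] ∃[ κ ] AtPort (ε i) i κ v
    leaf-port r v ¬v with proj₁ isTree v (node r)
    ... | stay = ⊥-elim (¬v (_ , ≡.refl))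
    ... | _◅_ {j = w} a s with node? w
    ...   | yes (i , ≡.refl) = i , adj-port ≡.refl (Adj-sym a)
    ...   | no ¬w            = ⊥-elim (no-leaf-edge ¬v ¬w a (a ◅ s))

  module Matching (𝓡 : CompleteOrderedField) {n : ℕ} (T T′ : RealGeometry.MCT 𝓡 n)
    (ε : Fin n → Sign) (sign : RealGeometry.signVector T ≗ ε) (sign′ : RealGeometry.signVector T′ ≗ ε)
    (same : ∀ {i j} → Analysis.U 𝓡 T i j → Analysis.U 𝓡 T′ i j)
    (same′ : ∀ {i j} → Analysis.U 𝓡 T′ i j → Analysis.U 𝓡 T i j) where
    open RealGeometry 𝓡
    private
      module T  = MCT T
      module T′ = MCT T′
      module A  = Analysis 𝓡 T
      module A′ = Analysis 𝓡 T′
      module P  = Ports 𝓡 T ε sign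
      module P′ = Ports 𝓡 T′ ε sign′

    transfer : ∀ s {i j} κ → P.AtPort s i κ (T.node j) → P′.AtPort s i κ (T′.node j)
    transfer s {i} {j} κ = by s κ
      where
      child : T.Child (T.node i) (T.node j) → T′.Child (T′.node i) (T′.node j)
      child (a , p) = let (a′ , p′) = same (A.Adj-sym a , p) in A′.Adj-sym a′ , p′
      by : ∀ s κ → P.AtPort s i κ (T.node j) → P′.AtPort s i κ (T′.node j)
      by Sign.+ left  (c , x) = child c , A′.x-mono (A.x-cancel x)
      by Sign.+ right (c , x) = child c , A′.x-mono (A.x-cancel x)
      by Sign.+ alone p       = same p
      by Sign.- left  (p , x) = same p , A′.x-mono (A.x-cancel x)
      by Sign.- right (p , x) = same p , A′.x-mono (A.x-cancel x)
      by Sign.- alone c       = child c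

    -- The isomorphism as a relation. Leaves carry no labels, so they are identified by the port at
    -- which they hang. The relation can be read in both directions, so that its being functional
    -- gives both inverse laws.
    data Match (v : T.Vertex) (v′ : T′.Vertex) : Set where
      nodes  : ∀ i → T.node i ≡ v → T′.node i ≡ v′ → Match v v′
      leaves : ¬ P.IsNode v → ¬ P′.IsNode v′ → ∀ i κ → P.AtPort (ε i) i κ v → P′.AtPort (ε i) i κ v′ → Match v v′

    match-functional : ∀ {v v′ w′} → Match v v′ → Match v w′ → v′ ≡ w′
    match-functional (nodes i ≡.refl ≡.refl) (nodes j e ≡.refl) = ≡.cong T′.node (A.node-injective (≡.sym e))
    match-functional (nodes i e _) (leaves ¬v _ _ _ _ _) = ⊥-elim (¬v (i , e))
    match-functional (leaves ¬v _ _ _ _ _) (nodes i e _) = ⊥-elim (¬v (i , e))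
    match-functional (leaves ¬v _ i κ p q) (leaves _ _ j μ p′ q′)
      with A.node-injective (A.not-node-leaf ¬v (A.Adj-sym (P.port-adj (ε i) κ p)) (A.Adj-sym (P.port-adj (ε j) μ p′)))
    ... | ≡.refl with P.port-unique (ε i) κ μ p p′
    ...   | ≡.refl = P′.at-port-unique ≡.refl κ q q′

    match-adj : ∀ {u v u′ v′} → Match u u′ → Match v v′ → T.Adj u v → T′.Adj u′ v′
    match-adj (nodes i ≡.refl ≡.refl) (nodes j ≡.refl ≡.refl) a with A.vertical a
    ... | inj₁ p = proj₁ (same (a , p))
    ... | inj₂ p = A′.Adj-sym (proj₁ (same (A.Adj-sym a , p)))
    match-adj (nodes i ≡.refl ≡.refl) (leaves ¬v _ j κ p p′) a
      with A.node-injective (A.not-node-leaf ¬v (A.Adj-sym a) (A.Adj-sym (P.port-adj (ε j) κ p)))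
    ... | ≡.refl = P′.port-adj (ε j) κ p′
    match-adj (leaves ¬v _ j κ p p′) (nodes i ≡.refl ≡.refl) a
      with A.node-injective (A.not-node-leaf ¬v a (A.Adj-sym (P.port-adj (ε j) κ p)))
    ... | ≡.refl = A′.Adj-sym (P′.port-adj (ε j) κ p′)
    match-adj (leaves ¬v _ j κ p p′) (leaves ¬w _ _ _ _ _) a =
      ⊥-elim (¬w (j , A.not-node-leaf ¬v (A.Adj-sym (P.port-adj (ε j) κ p)) a))

    match-total : Fin n → (∀ s {i j} κ → P′.AtPort s i κ (T′.node j) → P.AtPort s i κ (T.node j)) →
                  ∀ v → ∃[ v′ ] Match v v′
    match-total r back v with A.node? v
    ... | yes (i , e) = T′.node i , nodes i e ≡.refl
    ... | no ¬v with P.leaf-port r v ¬v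
    ...   | i , κ , p with P′.port-exists i κ
    -- If the vertex at this port of `T′` were a node, `back` would place a node at the same port of
    -- `T`, which is occupied by the leaf `v`.
    ...     | v′ , p′ = v′ , leaves ¬v (λ { (j , ≡.refl) → ¬v (j , P.at-port-unique ≡.refl κ (back (ε i) κ p′) p) }) i κ p p′

  module Isomorphism (𝓡 : CompleteOrderedField) {n : ℕ} where
    open RealGeometry 𝓡

    private
      chain-mono : ∀ {n} (T T′ : MCT n) → (∀ {i j} → Analysis.U 𝓡 T i j → Analysis.U 𝓡 T′ i j) →
                   ∀ {i j} → MCT._⊑_ T i j → MCT._⊑_ T′ i j
      chain-mono T T′ same stay = stay
      chain-mono T T′ same ((a , p) ◅ s) =
        let (a′ , p′) = same (Analysis.Adj-sym 𝓡 T a , p) in (Analysis.Adj-sym 𝓡 T′ a′ , p′) ◅ chain-mono T T′ same s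

      bool-ext : ∀ {a b : Bool} → (a ≡ true → b ≡ true) → (b ≡ true → a ≡ true) → a ≡ b
      bool-ext {false} {false} f g = ≡.refl
      bool-ext {false} {true}  f g = g ≡.refl
      bool-ext {true}  {b}     f g = ≡.sym (f ≡.refl)

    same-edges⇒≅ : (T T′ : MCT n) → Fin n → (ε : Fin n → Sign) → signVector T ≗ ε → signVector T′ ≗ ε →
      (∀ {i j} → Analysis.U 𝓡 T i j → Analysis.U 𝓡 T′ i j) →
      (∀ {i j} → Analysis.U 𝓡 T′ i j → Analysis.U 𝓡 T i j) → T ≅ T′
    same-edges⇒≅ T T′ r ε sign sign′ same same′ = record
      { bijection      = mk↔ₛ′ to from (λ v′ → F.match-functional (to-match (from v′)) (flip (from-match v′)))
                                       (λ v → B.match-functional (from-match (to v)) (flop (to-match v)))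
      ; preservesAdj   = λ u v → bool-ext (F.match-adj (to-match u) (to-match v))
                                          (B.match-adj (flop (to-match u)) (flop (to-match v)))
      ; preservesNode  = λ i → F.match-functional (to-match (T.node i)) (F.nodes i ≡.refl ≡.refl)
      ; preservesOrder = λ i j → mk⇔ (chain-mono T T′ same) (chain-mono T′ T same′)
      }
      where
      module T  = MCT T
      module T′ = MCT T′
      module F = Matching 𝓡 T T′ ε sign sign′ same same′
      module B = Matching 𝓡 T′ T ε sign′ sign same′ same
      flip : ∀ {v v′} → B.Match v′ v → F.Match v v′
      flip (B.nodes i p q)         = F.nodes i q p
      flip (B.leaves p q i κ r s) = F.leaves q p i κ s r
      flop : ∀ {v v′} → F.Match v v′ → B.Match v′ v
      flop (F.nodes i p q)         = B.nodes i q p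
      flop (F.leaves p q i κ r s) = B.leaves q p i κ s r
      to : T.Vertex → T′.Vertex
      to v = proj₁ (F.match-total r B.transfer v)
      to-match : ∀ v → F.Match v (to v)
      to-match v = proj₂ (F.match-total r B.transfer v)
      from : T′.Vertex → T.Vertex
      from v = proj₁ (B.match-total r F.transfer v)
      from-match : ∀ v → B.Match v (from v)
      from-match v = proj₂ (B.match-total r F.transfer v)

    module _ (T T′ : MCT n) (iso : T ≅ T′) where
      private
        module T  = MCT T
        module T′ = MCT T′
        module A  = Analysis 𝓡 T
        module A′ = Analysis 𝓡 T′
        open OrderedField 𝓡

        chain-height : ∀ (T : MCT n) {i j} → MCT._⊑_ T i j → i ≡ j ⊎ Analysis._≺_ 𝓡 T i j
        chain-height T stay = inj₁ ≡.refl
        chain-height T ((_ , p) ◅ s) with chain-height T s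
        ... | inj₁ ≡.refl = inj₂ p
        ... | inj₂ q      = inj₂ (<-trans p q)

        strict : ∀ (T : MCT n) {i j} → MCT._⊑_ T i j → i ≢ j → Analysis._≺_ 𝓡 T i j
        strict T s i≢j with chain-height T s
        ... | inj₁ p = ⊥-elim (i≢j p)
        ... | inj₂ p = p

        distinct : ∀ (T : MCT n) {i j} → Analysis._≺_ 𝓡 T i j → i ≢ j
        distinct T p ≡.refl = <-irrefl refl p

        adj-eq : ∀ i j → T.adjacent (T.node i) (T.node j) ≡ T′.adjacent (T′.node i) (T′.node j)
        adj-eq i j = ≡.trans (_≅_.preservesAdj iso (T.node i) (T.node j))
          (≡.cong₂ T′.adjacent (_≅_.preservesNode iso i) (_≅_.preservesNode iso j))

      -- Adjacency carries over directly. The direction is recovered from the partial order, because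
      -- a chain between distinct nodes strictly gains height.
      ≅⇒edges : ∀ {i j} → A.U i j → A′.U i j
      ≅⇒edges {i} {j} (a , p) = ≡.trans (≡.sym (adj-eq i j)) a
        , strict T′ (Equivalence.to (_≅_.preservesOrder iso i j) ((A.Adj-sym a , p) ◅ stay)) (distinct T p)

      ≅⇒edges⁻¹ : ∀ {i j} → A′.U i j → A.U i j
      ≅⇒edges⁻¹ {i} {j} (a , p) = ≡.trans (adj-eq i j) a
        , strict T (Equivalence.from (_≅_.preservesOrder iso i j) ((A′.Adj-sym a , p) ◅ stay)) (distinct T′ p)

      ≅⇒R≐ : R T ≐ R T′
      ≅⇒R≐ = (λ {x} r → A′.Rising⇒R (λ u → A.R⇒Rising r (≅⇒edges⁻¹ u)))
           , (λ {x} r → A.Rising⇒R (λ u → A′.R⇒Rising r (≅⇒edges u)))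

    module _ (T T′ : MCT n) (ε : Fin n → Sign) (sign : signVector T ≗ ε) (sign′ : signVector T′ ≗ ε) where
      private
        open OrderedField 𝓡
        module S  = Analysis.Signed 𝓡 T ε sign
        module S′ = Analysis.Signed 𝓡 T′ ε sign′

      -- The strict order of the coordinates of `x` extends the orders of both trees, which
      -- therefore have the same edges by `SameEdges`.
      common-point⇒≅ : Fin n → ∀ {x} → R T x → R T′ x → T ≅ T′
      common-point⇒≅ r {x} p p′ = same-edges⇒≅ T T′ r ε sign sign′
        (λ (a , q) → F.same-edge a q) (λ (a , q) → B.same-edge a q)
        where
        rise : Structure.MonotoneFor S.cobinary (λ i j → x i < x j)
        rise a q = Analysis.R⇒Rising 𝓡 T p (a , q)
        rise′ : Structure.MonotoneFor S′.cobinary (λ i j → x i < x j)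
        rise′ a q = Analysis.R⇒Rising 𝓡 T′ p′ (a , q)
        module F = SameEdges S.cobinary S′.cobinary S.path S′.path (λ i j → x i < x j) <-trans (<-irrefl refl) rise rise′
        module B = SameEdges S′.cobinary S.cobinary S′.path S.path (λ i j → x i < x j) <-trans (<-irrefl refl) rise′ rise

-- Building a tree with prescribed signs and levels, one node at a time

module Insertions where

  open CobinaryCombinatorics
  open import Data.List.Relation.Binary.Permutation.Propositional as Perm using (_↭_; ↭-sym; ↭-trans; prep; swap; ↭-refl)
  import Data.List.Relation.Binary.Permutation.Propositional.Properties as Permₚ
  open import Data.Nat.Base using (_≤_; _<_; _+_)
  open import Algebra.Properties.CommutativeSemigroup ℕₚ.+-commutativeSemigroup using (x∙yz≈y∙xz)
  open import Data.Unit.Base using (⊤; tt)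
  open import Relation.Binary.Construct.Closure.ReflexiveTransitive using (Star; _◅_; _◅◅_; reverse) renaming (ε to stay)
  open import Relation.Binary.Definitions using (DecidableEquality; Symmetric)
  open import Relation.Binary.PropositionalEquality.Core using (refl; sym; trans; cong; subst)
  open import Relation.Nullary.Decidable using (map′)

  module _ {A : Set} {R : Rel A 0ℓ} (R-sym : Symmetric R) where

    AllPairs-resp-↭ : ∀ {xs ys} → xs ↭ ys → AllPairs R xs → AllPairs R ys
    AllPairs-resp-↭ Perm.refl          ps                       = ps
    AllPairs-resp-↭ (prep x p)         (q ∷ ps)                 = Permₚ.All-resp-↭ p q ∷ AllPairs-resp-↭ p ps
    AllPairs-resp-↭ (swap x y p)       ((xy ∷ qx) ∷ (qy ∷ ps))  =
      (R-sym xy ∷ Permₚ.All-resp-↭ p qy) ∷ (Permₚ.All-resp-↭ p qx ∷ AllPairs-resp-↭ p ps)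
    AllPairs-resp-↭ (Perm.trans p q)   ps                       = AllPairs-resp-↭ q (AllPairs-resp-↭ p ps)

    AllPairs-lookup : ∀ {xs x y} → AllPairs R xs → x ∈ xs → y ∈ xs → x ≡ y ⊎ R x y
    AllPairs-lookup (q ∷ ps) (here refl) (here refl) = inj₁ refl
    AllPairs-lookup (q ∷ ps) (here refl) (there y)   = inj₂ (All.lookup q y)
    AllPairs-lookup (q ∷ ps) (there x)   (here refl) = inj₂ (R-sym (All.lookup q x))
    AllPairs-lookup (q ∷ ps) (there x)   (there y)   = AllPairs-lookup ps x y

  AllPairs-++⁻ : ∀ {A : Set} {R : Rel A 0ℓ} xs {ys} → AllPairs R (xs ++ ys) →
                 AllPairs R xs × AllPairs R ys × All (λ x → All (R x) ys) xs
  AllPairs-++⁻ []       ps       = [] , ps , []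
  AllPairs-++⁻ (x ∷ xs) (q ∷ ps) =
    let (p₁ , p₂ , p₃) = AllPairs-++⁻ xs ps ; (q₁ , q₂) = Allₚ.++⁻ xs q in q₁ ∷ p₁ , p₂ , q₂ ∷ p₃

  separate : ∀ {A : Set} {P Q : Pred A 0ℓ} {xs} → All (λ x → P x ⊎ Q x) xs →
             ∃[ ys ] ∃[ zs ] xs ↭ ys ++ zs × All P ys × All Q zs
  separate []               = [] , [] , ↭-refl , [] , []
  separate (_∷_ {x} (inj₁ p) ps) = let (ys , zs , σ , a , b) = separate ps in x ∷ ys , zs , prep x σ , p ∷ a , b
  separate (_∷_ {x} (inj₂ q) ps) = let (ys , zs , σ , a , b) = separate ps in
    ys , x ∷ zs , ↭-trans (prep x σ) (↭-sym (Permₚ.shift x ys zs)) , a , q ∷ b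

  -- A tree with `n` internal nodes has `n + 2` leaves: the two ends `bot` and `top` of the initial
  -- edge and one leaf for each inserted node.
  data Vtx (n : ℕ) : Set where
    bot top : Vtx n
    nd lf   : Fin n → Vtx n

  nd-injective : ∀ {n} {i j : Fin n} → nd i ≡ nd j → i ≡ j
  nd-injective refl = refl

  lf-injective : ∀ {n} {i j : Fin n} → lf i ≡ lf j → i ≡ j
  lf-injective refl = refl

  infix 4 _≟ᵥ_
  _≟ᵥ_ : ∀ {n} → DecidableEquality (Vtx n)
  bot  ≟ᵥ bot  = yes refl
  bot  ≟ᵥ top  = no λ ()
  bot  ≟ᵥ nd _ = no λ ()
  bot  ≟ᵥ lf _ = no λ ()
  top  ≟ᵥ bot  = no λ ()
  top  ≟ᵥ top  = yes refl
  top  ≟ᵥ nd _ = no λ ()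
  top  ≟ᵥ lf _ = no λ ()
  nd _ ≟ᵥ bot  = no λ ()
  nd _ ≟ᵥ top  = no λ ()
  nd i ≟ᵥ nd j = map′ (cong nd) nd-injective (i Finₚ.≟ j)
  nd _ ≟ᵥ lf _ = no λ ()
  lf _ ≟ᵥ bot  = no λ ()
  lf _ ≟ᵥ top  = no λ ()
  lf _ ≟ᵥ nd _ = no λ ()
  lf i ≟ᵥ lf j = map′ (cong lf) lf-injective (i Finₚ.≟ j)

  -- The tree for signs ε and levels h is built by inserting the nodes from left
  -- to right. P is the rightmost polyline of the tree built so far, a chain of
  -- edges reaching from level 0 to level N + 1, and D the set of the other edges.
  -- A new node i subdivides the edge e of P at its level. The wall of i hides the
  -- part of P below (Λ) or above (V) it, which moves to D; a new leaf to the right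
  -- of i completes the remaining part to the new rightmost polyline.
  module Build {n : ℕ} (ε : Fin n → Sign) (N : ℕ) (h : Fin n → ℕ)
    (h-injective : ∀ {i j} → h i ≡ h j → i ≡ j) (h<N : ∀ i → h i < N) where

    Edge : Set
    Edge = Vtx n × Vtx n

    lo hi : Edge → Vtx n
    lo = proj₁
    hi = proj₂

    -- `X` is twice the final x-coordinate: it puts the inserted nodes at 1, 2, ..., the leaf of a
    -- node halfway towards the next node, and `bot` and `top` at one half. The leaf of a Λ-node is
    -- placed at the lowest level and that of a V-node at the highest.
    X Y : Vtx n → ℕ
    X bot    = 1
    X top    = 1
    X (nd i) = 2 + (toℕ i + toℕ i)
    X (lf i) = 3 + (toℕ i + toℕ i)
    Y bot    = 0
    Y top    = suc N
    Y (nd i) = suc (h i)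
    Y (lf i) with ε i
    ... | Sign.+ = 0
    ... | Sign.- = suc N

    -- Any two edges are separated by a horizontal line (HSep) or by the vertical
    -- line through a node.
    HSep Sep RSep : Edge → Edge → Set
    LeftOf RightOf Clear RWall : Fin n → Edge → Set
    HSep e f    = Y (hi e) ≤ Y (lo f) ⊎ Y (hi f) ≤ Y (lo e)
    LeftOf k e  = X (lo e) ≤ X (nd k) × X (hi e) ≤ X (nd k)
    RightOf k e = X (nd k) ≤ X (lo e) × X (nd k) ≤ X (hi e)
    RSep e f    = HSep e f ⊎ ∃[ k ] LeftOf k f × RightOf k e
    Sep e f     = RSep e f ⊎ RSep f e
    Clear k e   = (ε k ≡ Sign.+ × Y (nd k) ≤ Y (lo e)) ⊎ (ε k ≡ Sign.- × Y (hi e) ≤ Y (nd k))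
    RWall k e   = Clear k e ⊎ RightOf k e

    -- What an edge hands down to the two pieces into which a new node cuts it. Only the relation
    -- `RightOf` is inherited: the new node lies to the right of all others, so a piece ending there
    -- need not stay `LeftOf` an older node.
    Sub : Edge → Edge → Set
    Sub e′ e = Y (lo e) ≤ Y (lo e′) × Y (hi e′) ≤ Y (hi e) × (∀ k → RightOf k e → RightOf k e′)

    HSep-sym : ∀ e f → HSep e f → HSep f e
    HSep-sym e f = Sum.swap

    HSep-sub : ∀ e e′ f → Sub e′ e → HSep e f → HSep e′ f
    HSep-sub e e′ f (p , q , _) (inj₁ r) = inj₁ (ℕₚ.≤-trans q r)
    HSep-sub e e′ f (p , q , _) (inj₂ r) = inj₂ (ℕₚ.≤-trans r p)

    RSep-sub : ∀ e e′ f → Sub e′ e → RSep e f → RSep e′ f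
    RSep-sub e e′ f s (inj₁ r)                   = inj₁ (HSep-sub e e′ f s r)
    RSep-sub e e′ f (_ , _ , s) (inj₂ (k , l , r)) = inj₂ (k , l , s k r)

    RWall-sub : ∀ k e e′ → Sub e′ e → RWall k e → RWall k e′
    RWall-sub k e e′ (p , q , _) (inj₁ (inj₁ (s , r))) = inj₁ (inj₁ (s , ℕₚ.≤-trans r p))
    RWall-sub k e e′ (p , q , _) (inj₁ (inj₂ (s , r))) = inj₁ (inj₂ (s , ℕₚ.≤-trans q r))
    RWall-sub k e e′ (_ , _ , s) (inj₂ r)              = inj₂ (s k r)

    Present : List (Fin n) → Vtx n → Set
    Present is bot    = ⊤
    Present is top    = ⊤
    Present is (nd i) = i ∈ is
    Present is (lf i) = i ∈ is

    hit : Vtx n → Vtx n → ℕ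
    hit w u with w ≟ᵥ u
    ... | yes _ = 1
    ... | no  _ = 0

    hit-yes : ∀ u → hit u u ≡ 1
    hit-yes u with u ≟ᵥ u
    ... | yes _ = refl
    ... | no ne = ⊥-elim (ne refl)

    hit-no : ∀ {w u} → w ≢ u → hit w u ≡ 0
    hit-no {w} {u} ne with w ≟ᵥ u
    ... | yes eq = ⊥-elim (ne eq)
    ... | no  _  = refl

    count : (Edge → Vtx n) → Vtx n → List Edge → ℕ
    count π u []       = 0
    count π u (e ∷ es) = hit (π e) u + count π u es

    count-↭ : ∀ π u {es fs} → es ↭ fs → count π u es ≡ count π u fs
    count-↭ π u Perm.refl         = refl
    count-↭ π u (prep e p)        = cong (hit (π e) u +_) (count-↭ π u p)
    count-↭ π u (swap {ys = ys} e f p) = trans (cong (λ c → hit (π e) u + (hit (π f) u + c)) (count-↭ π u p))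
      (x∙yz≈y∙xz (hit (π e) u) (hit (π f) u) (count π u ys))
    count-↭ π u (Perm.trans p q)  = trans (count-↭ π u p) (count-↭ π u q)

    count-zero : ∀ π u {es} → (∀ {e} → e ∈ es → π e ≢ u) → count π u es ≡ 0
    count-zero π u {[]}     p = refl
    count-zero π u {e ∷ es} p = trans (cong (_+ count π u es) (hit-no (p (here refl)))) (count-zero π u (λ q → p (there q)))

    children parents : Sign → Vtx n → ℕ
    childCount parentCount : Vtx n → ℕ
    childCount bot    = 0
    childCount top    = 1
    childCount (nd i) = children (ε i) (nd i)
    childCount (lf i) = children (ε i) (lf i)
    parentCount bot    = 1
    parentCount top    = 0
    parentCount (nd i) = parents (ε i) (nd i)
    parentCount (lf i) = parents (ε i) (lf i)
    children Sign.+ (nd _) = 2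
    children Sign.- (nd _) = 1
    children Sign.+ _      = 0
    children Sign.- _      = 1
    parents Sign.+ (nd _) = 1
    parents Sign.- (nd _) = 2
    parents Sign.+ _      = 1
    parents Sign.- _      = 0

    Joined : List Edge → Rel (Vtx n) 0ℓ
    Joined E u w = (u , w) ∈ E ⊎ (w , u) ∈ E

    Good : List (Fin n) → Edge → Set
    Good is e = Y (lo e) < Y (hi e) × Present is (lo e) × Present is (hi e)

    record State (is : List (Fin n)) : Set where
      field
        P D       : List Edge
        P-sep     : AllPairs HSep P
        D-sep     : AllPairs Sep D
        -- One-sided, as `P` is rightmost: a vertical line has the edge of `P` on its right. This
        -- form survives a subdivision of that edge, by `RSep-sub`.
        PD-sep    : ∀ e f → e ∈ P → f ∈ D → RSep e f
        P-wall    : ∀ k e → k ∈ is → e ∈ P → RWall k e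
        D-wall    : ∀ k e → k ∈ is → e ∈ D → RWall k e ⊎ LeftOf k e
        good      : ∀ e → e ∈ P ++ D → Good is e
        -- `P` is kept as an unordered list. This covering of the levels and `P-sep` take the place
        -- of the order along the polyline; the covering supplies the edge that the next node
        -- subdivides.
        covers    : ∀ y → 0 < y → y < suc N →
                    (∃[ e ] e ∈ P × Y (lo e) < y × y < Y (hi e)) ⊎ (∃[ j ] j ∈ is × Y (nd j) ≡ y)
        degrees   : ∀ u → Present is u → count hi u (P ++ D) ≡ childCount u × count lo u (P ++ D) ≡ parentCount u
        connected : ∀ u → Present is u → Star (Joined (P ++ D)) u bot

    initial : State []
    initial = record
      { P = (bot , top) ∷ [] ; D = [] ; P-sep = [] ∷ [] ; D-sep = []
      ; PD-sep = λ _ _ _ () ; P-wall = λ _ _ () ; D-wall = λ _ _ ()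
      ; good = λ { _ (here refl) → s≤s z≤n , tt , tt }
      ; covers = λ y p q → inj₁ (_ , here refl , p , q)
      ; degrees = λ { bot _ → refl , refl ; top _ → refl , refl }
      ; connected = λ { bot _ → stay ; top _ → inj₂ (here refl) ◅ stay }
      }

    private
      double : ∀ {a b} → a < b → 3 + (a + a) ≤ suc (b + b)
      double {a} {b} p = s≤s (subst (_≤ b + b) (cong suc (ℕₚ.+-suc a a)) (ℕₚ.+-mono-≤ p p))

    X-present : ∀ {is i} → All (Fin._< i) is → ∀ u → Present is u → X u < X (nd i)
    X-present is<i bot    _ = s≤s (s≤s z≤n)
    X-present is<i top    _ = s≤s (s≤s z≤n)
    X-present is<i (nd j) p = s≤s (ℕₚ.≤-trans (ℕₚ.n≤1+n _) (double (All.lookup is<i p)))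
    X-present is<i (lf j) p = s≤s (double (All.lookup is<i p))

    -- Only nodes have an even value of `X`, and distinct nodes have distinct values.
    X-node : ∀ u {i} → X u ≡ X (nd i) → u ≡ nd i
    X-node bot    ()
    X-node top    ()
    X-node (nd j) {i} p with Finₚ.<-cmp j i
    ... | tri< q _ _    = ⊥-elim (ℕₚ.<⇒≢ (ℕₚ.≤-trans (ℕₚ.n≤1+n _) (s≤s (double q))) p)
    ... | tri≈ _ refl _ = refl
    ... | tri> _ _ q    = ⊥-elim (ℕₚ.<⇒≢ (ℕₚ.≤-trans (ℕₚ.n≤1+n _) (s≤s (double q))) (sym p))
    X-node (lf j) {i} p with Finₚ.<-cmp j i
    ... | tri< q _ _    = ⊥-elim (ℕₚ.<⇒≢ (s≤s (double q)) p)
    ... | tri≈ _ refl _ = ⊥-elim (ℕₚ.1+n≢n p)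
    ... | tri> _ _ q    = ⊥-elim (ℕₚ.<⇒≢ (ℕₚ.≤-trans (s≤s (ℕₚ.≤-trans (ℕₚ.n≤1+n _) (double q))) (ℕₚ.n≤1+n _)) (sym p))

    Y-lf-Λ : ∀ {i} → ε i ≡ Sign.+ → Y (lf i) ≡ 0
    Y-lf-Λ {i} p with ε i
    Y-lf-Λ {i} refl | Sign.+ = refl

    Y-lf-V : ∀ {i} → ε i ≡ Sign.- → Y (lf i) ≡ suc N
    Y-lf-V {i} p with ε i
    Y-lf-V {i} refl | Sign.- = refl

    module Insert {is : List (Fin n)} (S : State is) (i : Fin n) (is<i : All (Fin._< i) is) where
      open State S

      private
        v l : Vtx n
        v = nd i
        l = lf i

        weaken : ∀ u → Present is u → Present (i ∷ is) u
        weaken bot    p = tt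
        weaken top    p = tt
        weaken (nd _) p = there p
        weaken (lf _) p = there p

        absent : ∀ {u} → Present is u → u ≢ v × u ≢ l
        absent {u} p = (λ { refl → ℕₚ.<-irrefl refl (X-present is<i v p) })
                     , (λ { refl → ℕₚ.<-irrefl refl (X-present is<i v p) })

        split-present : ∀ u → Present (i ∷ is) u → u ≡ v ⊎ u ≡ l ⊎ Present is u
        split-present bot    p           = inj₂ (inj₂ tt)
        split-present top    p           = inj₂ (inj₂ tt)
        split-present (nd _) (here refl) = inj₁ refl
        split-present (nd _) (there p)   = inj₂ (inj₂ p)
        split-present (lf _) (here refl) = inj₂ (inj₁ refl)
        split-present (lf _) (there p)   = inj₂ (inj₂ p)

        left-of : ∀ f → Good is f → LeftOf i f
        left-of f (_ , p , q) = ℕₚ.<⇒≤ (X-present is<i _ p) , ℕₚ.<⇒≤ (X-present is<i _ q)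

        right-trans : ∀ {k} e → k ∈ is → RightOf i e → RightOf k e
        right-trans e k∈ (p , q) = ℕₚ.≤-trans (ℕₚ.<⇒≤ (X-present is<i (nd _) k∈)) p
                               , ℕₚ.≤-trans (ℕₚ.<⇒≤ (X-present is<i (nd _) k∈)) q

      -- Replaces e by e₁ and e₂; e₁ and Dm move to D, the new leaf edge is e₃.
      module _ (e e₁ e₂ e₃ : Edge) (Dm K : List Edge) (perm : P ↭ e ∷ (Dm ++ K))
        (sub₁ : Sub e₁ e) (sub₂ : Sub e₂ e) (e₁e₂ : HSep e₁ e₂)
        (left₁ : LeftOf i e₁) (right₃ : RightOf i e₃)
        (above₃ : ∀ {f} → f ∈ e₂ ∷ K → HSep e₃ f)
        (wall₂ : ∀ {f} → f ∈ e₂ ∷ K → Clear i f)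
        (good₁ : Good (i ∷ is) e₁) (good₂ : Good (i ∷ is) e₂) (good₃ : Good (i ∷ is) e₃)
        (cover : ∀ {f y} → 0 < y → y < suc N → f ∈ P → Y (lo f) < y → y < Y (hi f) →
                 (∃[ g ] g ∈ e₃ ∷ e₂ ∷ K × Y (lo g) < y × y < Y (hi g)) ⊎ Y v ≡ y)
        (count-old : ∀ π u → π ≡ hi ⊎ π ≡ lo → u ≢ v → u ≢ l → ∀ c →
                     hit (π e₃) u + (hit (π e₁) u + (hit (π e₂) u + c)) ≡ hit (π e) u + c)
        (count-v : hit (hi e₃) v + (hit (hi e₁) v + (hit (hi e₂) v + 0)) ≡ childCount v
                 × hit (lo e₃) v + (hit (lo e₁) v + (hit (lo e₂) v + 0)) ≡ parentCount v)
        (count-l : hit (hi e₃) l + (hit (hi e₁) l + (hit (hi e₂) l + 0)) ≡ childCount l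
                 × hit (lo e₃) l + (hit (lo e₁) l + (hit (lo e₂) l + 0)) ≡ parentCount l)
        (link : ∀ {E} → e₁ ∈ E → e₂ ∈ E → Joined E v (lo e) × Joined E v (hi e))
        (link-leaf : ∀ {E} → e₃ ∈ E → Joined E l v)
        where

        private
          P′ D′ rest : List Edge
          P′ = e₃ ∷ e₂ ∷ K
          D′ = e₁ ∷ Dm ++ D
          rest = (Dm ++ K) ++ D

          sep′ : AllPairs HSep (e ∷ Dm ++ K)
          sep′ = AllPairs-resp-↭ {R = HSep} (λ {f} {g} → HSep-sym f g) perm P-sep

          e-sep : All (HSep e) (Dm ++ K)
          e-sep = AllPairs.head sep′

          parts : AllPairs HSep Dm × AllPairs HSep K × All (λ f → All (HSep f) K) Dm
          parts = AllPairs-++⁻ {R = HSep} Dm (AllPairs.tail sep′)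

          old : ∀ {f} → f ∈ e ∷ (Dm ++ K) → f ∈ P
          old = Permₚ.∈-resp-↭ (↭-sym perm)

          e∈P : e ∈ P
          e∈P = old (here refl)

          Dm∈P : ∀ {f} → f ∈ Dm → f ∈ P
          Dm∈P p = old (there (∈ₚ.∈-++⁺ˡ p))

          K∈P : ∀ {f} → f ∈ K → f ∈ P
          K∈P p = old (there (∈ₚ.∈-++⁺ʳ Dm p))

          good-P : ∀ f → f ∈ P → Good is f
          good-P f p = good f (∈ₚ.∈-++⁺ˡ p)

          good-D : ∀ f → f ∈ D → Good is f
          good-D f p = good f (∈ₚ.∈-++⁺ʳ P p)

          weaken-good : ∀ f → Good is f → Good (i ∷ is) f
          weaken-good f (a , p , q) = a , weaken _ p , weaken _ q

          e₁-sep : ∀ {f} → f ∈ Dm ++ K → HSep e₁ f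
          e₁-sep {f} p = HSep-sub e e₁ f sub₁ (All.lookup e-sep p)

          e₂-sep : ∀ {f} → f ∈ Dm ++ K → HSep e₂ f
          e₂-sep {f} p = HSep-sub e e₂ f sub₂ (All.lookup e-sep p)

          D′-cases : ∀ {f} → f ∈ D′ → f ≡ e₁ ⊎ f ∈ Dm ⊎ f ∈ D
          D′-cases (here refl) = inj₁ refl
          D′-cases (there p) with ∈ₚ.∈-++⁻ Dm p
          ... | inj₁ q = inj₂ (inj₁ q)
          ... | inj₂ q = inj₂ (inj₂ q)

          D-sep′ : AllPairs Sep D′
          D-sep′ = Allₚ.++⁺ (All.tabulate (λ p → inj₁ (inj₁ (e₁-sep (∈ₚ.∈-++⁺ˡ p)))))
                            (All.tabulate (λ {f} p → inj₁ (RSep-sub e e₁ f sub₁ (PD-sep e f e∈P p))))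
                 ∷ AllPairsₚ.++⁺ (AllPairs.map {R = HSep} {S = Sep} (λ s → inj₁ (inj₁ s)) (proj₁ parts)) D-sep
                     (All.tabulate (λ p → All.tabulate (λ q → inj₁ (PD-sep _ _ (Dm∈P p) q))))

          PD-sep′ : ∀ f g → f ∈ P′ → g ∈ D′ → RSep f g
          PD-sep′ f g (here refl) q with D′-cases q
          ... | inj₁ refl        = inj₂ (i , left₁ , right₃)
          ... | inj₂ (inj₁ g∈Dm) = inj₂ (i , left-of g (good-P g (Dm∈P g∈Dm)) , right₃)
          ... | inj₂ (inj₂ g∈D)  = inj₂ (i , left-of g (good-D g g∈D) , right₃)
          PD-sep′ f g (there (here refl)) q with D′-cases q
          ... | inj₁ refl        = inj₁ (HSep-sym e₁ e₂ e₁e₂)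
          ... | inj₂ (inj₁ g∈Dm) = inj₁ (e₂-sep (∈ₚ.∈-++⁺ˡ g∈Dm))
          ... | inj₂ (inj₂ g∈D)  = RSep-sub e e₂ g sub₂ (PD-sep e g e∈P g∈D)
          PD-sep′ f g (there (there p)) q with D′-cases q
          ... | inj₁ refl        = inj₁ (HSep-sym e₁ f (e₁-sep (∈ₚ.∈-++⁺ʳ Dm p)))
          ... | inj₂ (inj₁ g∈Dm) = inj₁ (HSep-sym g f (All.lookup (All.lookup (proj₂ (proj₂ parts)) g∈Dm) p))
          ... | inj₂ (inj₂ g∈D)  = PD-sep f g (K∈P p) g∈D

          P-wall′ : ∀ k f → k ∈ i ∷ is → f ∈ P′ → RWall k f
          P-wall′ k f (here refl) (here refl)         = inj₂ right₃
          P-wall′ k f (here refl) (there p)           = inj₁ (wall₂ p)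
          P-wall′ k f (there k∈) (here refl)          = inj₂ (right-trans e₃ k∈ right₃)
          P-wall′ k f (there k∈) (there (here refl))  = RWall-sub k e e₂ sub₂ (P-wall k e k∈ e∈P)
          P-wall′ k f (there k∈) (there (there p))    = P-wall k f k∈ (K∈P p)

          D-wall′ : ∀ k f → k ∈ i ∷ is → f ∈ D′ → RWall k f ⊎ LeftOf k f
          D-wall′ k f k∈ q with D′-cases q
          D-wall′ k f (here refl) q | inj₁ refl       = inj₂ left₁
          D-wall′ k f (here refl) q | inj₂ (inj₁ f∈)  = inj₂ (left-of f (good-P f (Dm∈P f∈)))
          D-wall′ k f (here refl) q | inj₂ (inj₂ f∈)  = inj₂ (left-of f (good-D f f∈))
          D-wall′ k f (there k∈) q  | inj₁ refl       = inj₁ (RWall-sub k e e₁ sub₁ (P-wall k e k∈ e∈P))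
          D-wall′ k f (there k∈) q  | inj₂ (inj₁ f∈)  = inj₁ (P-wall k f k∈ (Dm∈P f∈))
          D-wall′ k f (there k∈) q  | inj₂ (inj₂ f∈)  = D-wall k f k∈ f∈

          good′ : ∀ f → f ∈ P′ ++ D′ → Good (i ∷ is) f
          good′ f (here refl)         = good₃
          good′ f (there (here refl)) = good₂
          good′ f (there (there p)) with ∈ₚ.∈-++⁻ K p
          ... | inj₁ q = weaken-good f (good-P f (K∈P q))
          ... | inj₂ q with D′-cases q
          ...   | inj₁ refl      = good₁
          ...   | inj₂ (inj₁ f∈) = weaken-good f (good-P f (Dm∈P f∈))
          ...   | inj₂ (inj₂ f∈) = weaken-good f (good-D f f∈)

          covers′ : ∀ y → 0 < y → y < suc N →
                    (∃[ g ] g ∈ P′ × Y (lo g) < y × y < Y (hi g)) ⊎ (∃[ j ] j ∈ i ∷ is × Y (nd j) ≡ y)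
          covers′ y p q with covers y p q
          ... | inj₂ (j , j∈ , eq)       = inj₂ (j , there j∈ , eq)
          ... | inj₁ (f , f∈ , r , s) with cover p q f∈ r s
          ...   | inj₁ g  = inj₁ g
          ...   | inj₂ eq = inj₂ (i , here refl , eq)

          old-↭ : P ++ D ↭ e ∷ rest
          old-↭ = Permₚ.++⁺ʳ D perm

          new-↭ : P′ ++ D′ ↭ e₃ ∷ e₁ ∷ e₂ ∷ rest
          new-↭ = prep e₃ (↭-trans (prep e₂ (Permₚ.shift e₁ K (Dm ++ D)))
            (↭-trans (swap e₂ e₁ (↭-trans (Permₚ.shifts K Dm) (Perm.↭-reflexive (sym (Data.List.Properties.++-assoc Dm K D))))) ↭-refl))
            where import Data.List.Properties

          rest-good : ∀ f → f ∈ rest → Good is f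
          rest-good f p = good f (Permₚ.∈-resp-↭ (↭-sym old-↭) (there p))

          no-v : ∀ π → π ≡ hi ⊎ π ≡ lo → count π v rest ≡ 0 × count π l rest ≡ 0
          no-v π (inj₁ refl) = count-zero hi v (λ p → proj₁ (absent (proj₂ (proj₂ (rest-good _ p)))))
                             , count-zero hi l (λ p → proj₂ (absent (proj₂ (proj₂ (rest-good _ p)))))
          no-v π (inj₂ refl) = count-zero lo v (λ p → proj₁ (absent (proj₁ (proj₂ (rest-good _ p)))))
                             , count-zero lo l (λ p → proj₂ (absent (proj₁ (proj₂ (rest-good _ p)))))

          total : ∀ π u c → count π u rest ≡ 0 →
                  hit (π e₃) u + (hit (π e₁) u + (hit (π e₂) u + 0)) ≡ c → count π u (P′ ++ D′) ≡ c
          total π u c z eq = trans (count-↭ π u new-↭)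
            (trans (cong (λ r → hit (π e₃) u + (hit (π e₁) u + (hit (π e₂) u + r))) z) eq)

          degrees′ : ∀ u → Present (i ∷ is) u → count hi u (P′ ++ D′) ≡ childCount u × count lo u (P′ ++ D′) ≡ parentCount u
          degrees′ u p with split-present u p
          ... | inj₁ refl        = total hi v _ (proj₁ (no-v hi (inj₁ refl))) (proj₁ count-v)
                                 , total lo v _ (proj₁ (no-v lo (inj₂ refl))) (proj₂ count-v)
          ... | inj₂ (inj₁ refl) = total hi l _ (proj₂ (no-v hi (inj₁ refl))) (proj₁ count-l)
                                 , total lo l _ (proj₂ (no-v lo (inj₂ refl))) (proj₂ count-l)
          ... | inj₂ (inj₂ q)    = same hi (inj₁ refl) (proj₁ (degrees u q)) , same lo (inj₂ refl) (proj₂ (degrees u q))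
            where
            same : ∀ π → π ≡ hi ⊎ π ≡ lo → ∀ {c} → count π u (P ++ D) ≡ c → count π u (P′ ++ D′) ≡ c
            same π w eq = trans (count-↭ π u new-↭) (trans (count-old π u w (proj₁ (absent q)) (proj₂ (absent q)) _)
              (trans (sym (count-↭ π u old-↭)) eq))

          e₁∈ : e₁ ∈ P′ ++ D′
          e₁∈ = ∈ₚ.∈-++⁺ʳ P′ (here refl)

          e₂∈ : e₂ ∈ P′ ++ D′
          e₂∈ = there (here refl)

          joined-sym : ∀ {E u w} → Joined E u w → Joined E w u
          joined-sym = Sum.swap

          v-lo : Joined (P′ ++ D′) v (lo e)
          v-lo = proj₁ (link e₁∈ e₂∈)

          v-hi : Joined (P′ ++ D′) v (hi e)
          v-hi = proj₂ (link e₁∈ e₂∈)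

          moved : ∀ {f} → f ∈ rest → f ∈ P′ ++ D′
          moved p = Permₚ.∈-resp-↭ (↭-sym new-↭) (there (there (there p)))

          -- The only edge that disappears is `e`, and the detour through `v` replaces it.
          reroute : ∀ {u w} → (u , w) ∈ P ++ D → Star (Joined (P′ ++ D′)) u w
          reroute p with Permₚ.∈-resp-↭ old-↭ p
          ... | here refl = joined-sym v-lo ◅ v-hi ◅ stay
          ... | there q   = inj₁ (moved q) ◅ stay

          reroute-all : ∀ {u w} → Star (Joined (P ++ D)) u w → Star (Joined (P′ ++ D′)) u w
          reroute-all stay         = stay
          reroute-all (inj₁ p ◅ s) = reroute p ◅◅ reroute-all s
          reroute-all (inj₂ p ◅ s) = reverse joined-sym (reroute p) ◅◅ reroute-all s

          v-connected : Star (Joined (P′ ++ D′)) v bot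
          v-connected = v-lo ◅ reroute-all (connected (lo e) (proj₁ (proj₂ (good-P e e∈P))))

          connected′ : ∀ u → Present (i ∷ is) u → Star (Joined (P′ ++ D′)) u bot
          connected′ u p with split-present u p
          ... | inj₁ refl        = v-connected
          ... | inj₂ (inj₁ refl) = link-leaf (here refl) ◅ v-connected
          ... | inj₂ (inj₂ q)    = reroute-all (connected u q)

        extended : State (i ∷ is)
        extended = record
          { P = P′ ; D = D′
          ; P-sep = All.tabulate above₃ ∷ (All.tabulate (λ p → e₂-sep (∈ₚ.∈-++⁺ʳ Dm p)) ∷ proj₁ (proj₂ parts))
          ; D-sep = D-sep′ ; PD-sep = PD-sep′ ; P-wall = P-wall′ ; D-wall = D-wall′ ; good = good′
          ; covers = covers′ ; degrees = degrees′ ; connected = connected′ }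

-- The insertion steps and the cobinary structure of the completed tree

module CompletedTrees where

  open CobinaryCombinatorics
  open Insertions
  open import Data.Empty using (⊥)
  open import Data.List.Relation.Binary.Permutation.Propositional using (_↭_; ↭-trans; prep; ↭-reflexive)
  import Data.List.Relation.Binary.Permutation.Propositional.Properties as Permₚ
  open import Data.Nat.Base using (_≤_; _<_; _+_)
  open import Data.Unit.Base using (tt)
  open import Function.Bundles using (_⇔_; mk⇔)
  open import Relation.Binary.PropositionalEquality.Core using (refl; sym; trans; cong; subst; ≢-sym)

  module Insertion {n : ℕ} (ε : Fin n → Sign) (N : ℕ) (h : Fin n → ℕ)
    (h-injective : ∀ {i j} → h i ≡ h j → i ≡ j) (h<N : ∀ i → h i < N) where
    open Build ε N h h-injective h<N

    module _ {is : List (Fin n)} (S : State is) (i : Fin n) (is<i : All (Fin._< i) is) where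
      open State S
      open Insert S i is<i

      private
        v l : Vtx n
        v = nd i
        l = lf i

        wk : ∀ u → Present is u → Present (i ∷ is) u
        wk bot    p = tt
        wk top    p = tt
        wk (nd _) p = there p
        wk (lf _) p = there p

        ≢v : ∀ {u} → Present is u → u ≢ v
        ≢v p refl = ℕₚ.<-irrefl refl (X-present is<i v p)

        ≢l : ∀ {u} → Present is u → u ≢ l
        ≢l p refl = ℕₚ.<-irrefl refl (X-present is<i v p)

        v≤l : X v ≤ X l
        v≤l = ℕₚ.n≤1+n _

      module _ (c₁ c₂ : Vtx n) (e∈P : (c₁ , c₂) ∈ P) (c₁<v : Y c₁ < Y v) (v<c₂ : Y v < Y c₂) where

        private
          g : Good is (c₁ , c₂)
          g = good (c₁ , c₂) (∈ₚ.∈-++⁺ˡ e∈P)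
          p₁ = proj₁ (proj₂ g)
          p₂ = proj₂ (proj₂ g)

          Xc₁ : X c₁ ≤ X v
          Xc₁ = ℕₚ.<⇒≤ (X-present is<i c₁ p₁)
          Xc₂ : X c₂ ≤ X v
          Xc₂ = ℕₚ.<⇒≤ (X-present is<i c₂ p₂)

          sub-low : Sub (c₁ , v) (c₁ , c₂)
          sub-low = ℕₚ.≤-refl , ℕₚ.<⇒≤ v<c₂ , λ k (r , s) → r , ℕₚ.≤-trans r Xc₁

          sub-high : Sub (v , c₂) (c₁ , c₂)
          sub-high = ℕₚ.<⇒≤ c₁<v , ℕₚ.≤-refl , λ k (r , s) → ℕₚ.≤-trans s Xc₂ , s

          good-low : Good (i ∷ is) (c₁ , v)
          good-low = c₁<v , wk c₁ p₁ , here refl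

          good-high : Good (i ∷ is) (v , c₂)
          good-high = v<c₂ , here refl , wk c₂ p₂

          Low High : Edge → Set
          Low f  = Y (hi f) ≤ Y c₁
          High f = Y c₂ ≤ Y (lo f)

          isolate : ∃[ xs ] P ↭ (c₁ , c₂) ∷ xs × All (λ f → High f ⊎ Low f) xs
          isolate with ∈ₚ.∈-∃++ e∈P
          ... | xs , ys , eq = xs ++ ys , σ , AllPairs.head (AllPairs-resp-↭ {R = HSep} (λ {f} {g} → HSep-sym f g) σ P-sep)
            where
            σ : P ↭ (c₁ , c₂) ∷ (xs ++ ys)
            σ = ↭-trans (↭-reflexive eq) (Permₚ.shift (c₁ , c₂) xs ys)

        extend-Λ : ε i ≡ Sign.+ → State (i ∷ is)
        extend-Λ ε+ with isolate
        ... | xs , σ , hl with separate (All.map Sum.swap hl)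
        ...   | Dm , K , τ , low , high = extended (c₁ , c₂) (c₁ , v) (v , c₂) (l , v) Dm K perm sub-low sub-high
          (inj₁ ℕₚ.≤-refl) (Xc₁ , ℕₚ.≤-refl) (v≤l , ℕₚ.≤-refl)
          (λ { (here refl) → inj₁ ℕₚ.≤-refl ; (there p) → inj₁ (v≤K p) })
          (λ { (here refl) → inj₁ (ε+ , ℕₚ.≤-refl) ; (there p) → inj₁ (ε+ , v≤K p) })
          good-low good-high (subst (_< Y v) (sym l≡0) (s≤s z≤n) , here refl , here refl)
          cover counts
          (cv ε+ , pv ε+) (cl ε+ , pl ε+)
          (λ a b → inj₂ a , inj₁ b) inj₁
          where
          l≡0 = Y-lf-Λ {i} ε+
          perm : P ↭ (c₁ , c₂) ∷ (Dm ++ K)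
          perm = ↭-trans σ (prep _ τ)
          v≤K : ∀ {f} → f ∈ K → Y v ≤ Y (lo f)
          v≤K p = ℕₚ.≤-trans (ℕₚ.<⇒≤ v<c₂) (All.lookup high p)
          cover : ∀ {f y} → 0 < y → y < suc N → f ∈ P → Y (lo f) < y → y < Y (hi f) →
                  (∃[ g ] g ∈ (l , v) ∷ (v , c₂) ∷ K × Y (lo g) < y × y < Y (hi g)) ⊎ Y v ≡ y
          cover {f} {y} 0<y y<N p r s with ℕₚ.<-cmp y (Y v)
          ... | tri< y<v _ _ = inj₁ ((l , v) , here refl , subst (_< y) (sym l≡0) 0<y , y<v)
          ... | tri≈ _ eq _  = inj₂ (sym eq)
          ... | tri> _ _ v<y with Permₚ.∈-resp-↭ perm p
          ...   | here refl = inj₁ (_ , there (here refl) , v<y , s)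
          ...   | there q with ∈ₚ.∈-++⁻ Dm q
          ...     | inj₁ f∈ = ⊥-elim (ℕₚ.<-asym v<y (ℕₚ.<-≤-trans s (ℕₚ.≤-trans (All.lookup low f∈) (ℕₚ.<⇒≤ c₁<v))))
          ...     | inj₂ f∈ = inj₁ (f , there (there f∈) , r , s)
          counts : ∀ π u → π ≡ hi ⊎ π ≡ lo → u ≢ v → u ≢ l → ∀ c →
                   hit (π (l , v)) u + (hit (π (c₁ , v)) u + (hit (π (v , c₂)) u + c)) ≡ hit (π (c₁ , c₂)) u + c
          counts π u (inj₁ refl) u≢v u≢l c rewrite hit-no (≢-sym u≢v) = refl
          counts π u (inj₂ refl) u≢v u≢l c rewrite hit-no (≢-sym u≢v) | hit-no (≢-sym u≢l) = refl
          cv : ε i ≡ Sign.+ → hit v v + (hit v v + (hit c₂ v + 0)) ≡ childCount v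
          cv e rewrite e | hit-yes v | hit-no (≢v p₂) = refl
          pv : ε i ≡ Sign.+ → hit l v + (hit c₁ v + (hit v v + 0)) ≡ parentCount v
          pv e rewrite e | hit-yes v | hit-no (≢v p₁) = refl
          cl : ε i ≡ Sign.+ → hit v l + (hit v l + (hit c₂ l + 0)) ≡ childCount l
          cl e rewrite e | hit-no (≢l p₂) = refl
          pl : ε i ≡ Sign.+ → hit l l + (hit c₁ l + (hit v l + 0)) ≡ parentCount l
          pl e rewrite e | hit-yes l | hit-no (≢l p₁) = refl

        extend-V : ε i ≡ Sign.- → State (i ∷ is)
        extend-V ε- with isolate
        ... | xs , σ , hl with separate hl
        ...   | Dm , K , τ , high , low = extended (c₁ , c₂) (v , c₂) (c₁ , v) (v , l) Dm K perm sub-high sub-low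
          (inj₂ ℕₚ.≤-refl) (ℕₚ.≤-refl , Xc₂) (ℕₚ.≤-refl , v≤l)
          (λ { (here refl) → inj₂ ℕₚ.≤-refl ; (there p) → inj₂ (K≤v p) })
          (λ { (here refl) → inj₂ (ε- , ℕₚ.≤-refl) ; (there p) → inj₂ (ε- , K≤v p) })
          good-high good-low (subst (Y v <_) (sym l≡N) (s≤s (h<N i)) , here refl , here refl)
          cover counts
          (cv ε- , pv ε-) (cl ε- , pl ε-)
          (λ a b → inj₂ b , inj₁ a) inj₂
          where
          l≡N = Y-lf-V {i} ε-
          perm : P ↭ (c₁ , c₂) ∷ (Dm ++ K)
          perm = ↭-trans σ (prep _ τ)
          K≤v : ∀ {f} → f ∈ K → Y (hi f) ≤ Y v
          K≤v p = ℕₚ.≤-trans (All.lookup low p) (ℕₚ.<⇒≤ c₁<v)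
          cover : ∀ {f y} → 0 < y → y < suc N → f ∈ P → Y (lo f) < y → y < Y (hi f) →
                  (∃[ g ] g ∈ (v , l) ∷ (c₁ , v) ∷ K × Y (lo g) < y × y < Y (hi g)) ⊎ Y v ≡ y
          cover {f} {y} 0<y y<N p r s with ℕₚ.<-cmp y (Y v)
          ... | tri> _ _ v<y = inj₁ ((v , l) , here refl , v<y , subst (y <_) (sym l≡N) y<N)
          ... | tri≈ _ eq _  = inj₂ (sym eq)
          ... | tri< y<v _ _ with Permₚ.∈-resp-↭ perm p
          ...   | here refl = inj₁ (_ , there (here refl) , r , y<v)
          ...   | there q with ∈ₚ.∈-++⁻ Dm q
          ...     | inj₁ f∈ = ⊥-elim (ℕₚ.<-asym y<v (ℕₚ.<-trans v<c₂ (ℕₚ.≤-<-trans (All.lookup high f∈) r)))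
          ...     | inj₂ f∈ = inj₁ (f , there (there f∈) , r , s)
          counts : ∀ π u → π ≡ hi ⊎ π ≡ lo → u ≢ v → u ≢ l → ∀ c →
                   hit (π (v , l)) u + (hit (π (v , c₂)) u + (hit (π (c₁ , v)) u + c)) ≡ hit (π (c₁ , c₂)) u + c
          counts π u (inj₁ refl) u≢v u≢l c rewrite hit-no (≢-sym u≢v) | hit-no (≢-sym u≢l) = refl
          counts π u (inj₂ refl) u≢v u≢l c rewrite hit-no (≢-sym u≢v) = refl
          cv : ε i ≡ Sign.- → hit l v + (hit c₂ v + (hit v v + 0)) ≡ childCount v
          cv e rewrite e | hit-yes v | hit-no (≢v p₂) = refl
          pv : ε i ≡ Sign.- → hit v v + (hit v v + (hit c₁ v + 0)) ≡ parentCount v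
          pv e rewrite e | hit-yes v | hit-no (≢v p₁) = refl
          cl : ε i ≡ Sign.- → hit l l + (hit c₂ l + (hit v l + 0)) ≡ childCount l
          cl e rewrite e | hit-yes l | hit-no (≢l p₂) = refl
          pl : ε i ≡ Sign.- → hit v l + (hit v l + (hit c₁ l + 0)) ≡ parentCount l
          pl e rewrite e | hit-no (≢l p₁) = refl

      insert : State (i ∷ is)
      insert with covers (Y v) (s≤s z≤n) (s≤s (h<N i))
      ... | inj₂ (j , j∈ , eq) with h-injective (ℕₚ.suc-injective eq)
      ...   | refl = ⊥-elim (ℕₚ.<-irrefl refl (All.lookup is<i j∈))
      insert | inj₁ ((c₁ , c₂) , e∈P , p , q) with ε i in eq
      ... | Sign.+ = extend-Λ c₁ c₂ e∈P p q eq
      ... | Sign.- = extend-V c₁ c₂ e∈P p q eq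

    build : ∀ {is} → AllPairs (λ i j → j Fin.< i) is → State is
    build []       = initial
    build (p ∷ ps) = insert (build ps) _ p

  module Completed {n : ℕ} (ε : Fin n → Sign) (N : ℕ) (h : Fin n → ℕ)
    (h-injective : ∀ {i j} → h i ≡ h j → i ≡ j) (h<N : ∀ i → h i < N)
    {is : List (Fin n)} (all : ∀ i → i ∈ is) (S : Build.State ε N h h-injective h<N is) where
    open Build ε N h h-injective h<N
    open State S

    present : ∀ u → Present is u
    present bot    = tt
    present top    = tt
    present (nd i) = all i
    present (lf i) = all i

    E : List Edge
    E = P ++ D

    rising : ∀ {u w} → (u , w) ∈ E → Y u < Y w
    rising p = proj₁ (good _ p)

    private
      E-sep : AllPairs Sep E
      E-sep = AllPairsₚ.++⁺ (AllPairs.map {R = HSep} {S = Sep} (λ s → inj₁ (inj₁ s)) P-sep) D-sep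
        (All.tabulate (λ p → All.tabulate (λ q → inj₁ (PD-sep _ _ p q))))

      -- An edge on both sides of a vertical line through a node would have both ends at that node,
      -- although its ends differ in level.
      RSep-irrefl : ∀ e → e ∈ E → ¬ RSep e e
      RSep-irrefl e p (inj₁ (inj₁ q)) = ℕₚ.<⇒≱ (proj₁ (good e p)) q
      RSep-irrefl e p (inj₁ (inj₂ q)) = ℕₚ.<⇒≱ (proj₁ (good e p)) q
      RSep-irrefl e p (inj₂ (k , (a , b) , (c , d))) = ℕₚ.<-irrefl (cong Y lo≡hi) (proj₁ (good e p))
        where
        lo≡hi : lo e ≡ hi e
        lo≡hi = trans (X-node (lo e) {k} (ℕₚ.≤-antisym a c)) (sym (X-node (hi e) {k} (ℕₚ.≤-antisym b d)))

      Sep-irrefl : ∀ e → e ∈ E → ¬ Sep e e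
      Sep-irrefl e p (inj₁ s) = RSep-irrefl e p s
      Sep-irrefl e p (inj₂ s) = RSep-irrefl e p s

      unique : ∀ {xs} → AllPairs Sep xs → (∀ e → e ∈ xs → ¬ Sep e e) → Unique xs
      unique []       _ = []
      unique {e ∷ _} (q ∷ ps) f =
        All.map {P = Sep e} {Q = e ≢_} (λ { s refl → f e (here refl) s }) q ∷ unique ps (λ e p → f e (there p))

    -- A repeated edge would have to be separated from itself.
    E-unique : Unique E
    E-unique = unique E-sep Sep-irrefl

    separated : ∀ e f → e ∈ E → f ∈ E → e ≡ f ⊎ Sep e f
    separated e f p q = AllPairs-lookup {R = Sep} Sum.swap E-sep p q

    walls : ∀ k e → e ∈ E → Clear k e ⊎ RightOf k e ⊎ LeftOf k e
    walls k e p with ∈ₚ.∈-++⁻ P p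
    ... | inj₁ q with P-wall k e (all k) q
    ...   | inj₁ c = inj₁ c
    ...   | inj₂ r = inj₂ (inj₁ r)
    walls k e p | inj₂ q with D-wall k e (all k) q
    ...   | inj₁ (inj₁ c) = inj₁ c
    ...   | inj₁ (inj₂ r) = inj₂ (inj₁ r)
    ...   | inj₂ r        = inj₂ (inj₂ r)

    -- An edge is determined by its two projections, so among the edges with the end `u` the
    -- opposite ends are distinct. The abstract `π` and `π̄` let one proof serve for children and
    -- for parents.
    neighbours : (π π̄ : Edge → Vtx n) (mk : Vtx n → Vtx n → Edge) →
      (∀ e → mk (π̄ e) (π e) ≡ e) → (∀ c u → π̄ (mk c u) ≡ c) → (∀ c u → π (mk c u) ≡ u) →
      ∀ u → HasSize (count π u E) (λ c → mk c u ∈ E)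
    neighbours π π̄ mk η β̄ β u = map π̄ (filter at E) , distinct E E-unique , size E , λ c → mk⇔ (into c) (out c)
      where
      at : ∀ e → Dec (π e ≡ u)
      at e = π e ≟ᵥ u
      size : ∀ es → length (map π̄ (filter at es)) ≡ count π u es
      size [] = refl
      size (e ∷ es) with π e ≟ᵥ u
      ... | yes _ = cong suc (size es)
      ... | no  _ = size es
      into : ∀ c → mk c u ∈ E → c ∈ map π̄ (filter at E)
      into c p = subst (_∈ map π̄ (filter at E)) (β̄ c u) (∈ₚ.∈-map⁺ π̄ (∈ₚ.∈-filter⁺ at p (β c u)))
      out : ∀ c → c ∈ map π̄ (filter at E) → mk c u ∈ E
      out c p with ∈ₚ.∈-map⁻ π̄ p
      ... | e , e∈ , refl with ∈ₚ.∈-filter⁻ at {xs = E} e∈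
      ...   | q , refl = subst (_∈ E) (sym (η e)) q
      distinct : ∀ es → Unique es → Unique (map π̄ (filter at es))
      distinct [] _ = []
      distinct (e ∷ es) (p ∷ ps) with π e ≟ᵥ u
      ... | no _     = distinct es ps
      ... | yes refl = Allₚ.map⁺ (All.tabulate (λ {f} f∈ eq → let (q , r) = ∈ₚ.∈-filter⁻ at {xs = es} f∈ in
          All.lookup p q (trans (sym (η e)) (trans (≡.cong₂ mk eq (sym r)) (η f))))) ∷ distinct es ps

    children-size : ∀ u → HasSize (childCount u) (λ c → (c , u) ∈ E)
    children-size u = subst (λ k → HasSize k (λ c → (c , u) ∈ E)) (proj₁ (degrees u (present u)))
      (neighbours hi lo _,_ (λ _ → refl) (λ _ _ → refl) (λ _ _ → refl) u)

    parents-size : ∀ u → HasSize (parentCount u) (λ c → (u , c) ∈ E)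
    parents-size u = subst (λ k → HasSize k (λ c → (u , c) ∈ E)) (proj₂ (degrees u (present u)))
      (neighbours lo hi (λ c u → u , c) (λ _ → refl) (λ _ _ → refl) (λ _ _ → refl) u)

    A : Rel (Vtx n) 0ℓ
    A = Joined E

    _◁_ _≺_ : Rel (Vtx n) 0ℓ
    u ◁ w = X u < X w
    u ≺ w = Y u < Y w

    HasSign : Sign → Pred (Vtx n) 0ℓ
    HasSign s u = ∃[ i ] u ≡ nd i × ε i ≡ s

    upward : ∀ {u w} → A u w → u ≺ w → (u , w) ∈ E
    upward (inj₁ p) q = p
    upward (inj₂ p) q = ⊥-elim (ℕₚ.<-asym q (rising p))

    private
      two : ∀ {P : Pred (Vtx n) 0ℓ} {k a b} → HasSize k P → P a → P b → a ≢ b → 2 ≤ k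
      two {a = a} {b} (xs , _ , refl , ⇔) p q a≢b = long xs (Function.Bundles.Equivalence.to (⇔ a) p) (Function.Bundles.Equivalence.to (⇔ b) q)
        where
        import Function.Bundles
        long : ∀ xs → a ∈ xs → b ∈ xs → 2 ≤ length xs
        long (_ ∷ [])    (here refl) (here refl) = ⊥-elim (a≢b refl)
        long (_ ∷ _ ∷ _) _           _           = s≤s (s≤s z≤n)

      node-Λ : ∀ u → 2 ≤ childCount u → HasSign Sign.+ u
      node-Λ top (s≤s ())
      node-Λ (nd i) p with ε i in eq
      ... | Sign.+ = i , refl , eq
      ... | Sign.- = ⊥-elim (ℕₚ.1+n≰n p)
      node-Λ (lf i) p with ε i
      ... | Sign.+ = ⊥-elim (ℕₚ.n≮0 p)
      ... | Sign.- = ⊥-elim (ℕₚ.1+n≰n p)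

      node-V : ∀ u → 2 ≤ parentCount u → HasSign Sign.- u
      node-V bot (s≤s ())
      node-V (nd i) p with ε i in eq
      ... | Sign.+ = ⊥-elim (ℕₚ.1+n≰n p)
      ... | Sign.- = i , refl , eq
      node-V (lf i) p with ε i
      ... | Sign.+ = ⊥-elim (ℕₚ.1+n≰n p)
      ... | Sign.- = ⊥-elim (ℕₚ.n≮0 p)

      strictly : ∀ u {i} → u ≢ nd i → X u ≤ X (nd i) → X u < X (nd i)
      strictly u ne p = ℕₚ.≤∧≢⇒< p (λ eq → ne (X-node u eq))

      strictly′ : ∀ u {i} → u ≢ nd i → X (nd i) ≤ X u → X (nd i) < X u
      strictly′ u ne p = ℕₚ.≤∧≢⇒< p (λ eq → ne (X-node u (sym eq)))

      ≺⇒≢ : ∀ {u w} → u ≺ w → u ≢ w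
      ≺⇒≢ p refl = ℕₚ.<-irrefl refl p

      -- Edges with the same upper end overlap in level, so a vertical line separates them; it
      -- contains their common end and is therefore the line through `nd i` itself.
      top-sides : ∀ {a b} i → (a , nd i) ∈ E → (b , nd i) ∈ E → RSep (a , nd i) (b , nd i) → b ◁ nd i × nd i ◁ a
      top-sides i p q (inj₁ (inj₁ r)) = ⊥-elim (ℕₚ.<⇒≱ (rising q) r)
      top-sides i p q (inj₁ (inj₂ r)) = ⊥-elim (ℕₚ.<⇒≱ (rising p) r)
      top-sides {a} {b} i p q (inj₂ (k , (r , s) , (t , u))) with nd-injective (X-node (nd i) {k} (ℕₚ.≤-antisym s u))
      ... | refl = strictly b (≺⇒≢ (rising q)) r , strictly′ a (≺⇒≢ (rising p)) t

      bot-sides : ∀ {a b} i → (nd i , a) ∈ E → (nd i , b) ∈ E → RSep (nd i , a) (nd i , b) → b ◁ nd i × nd i ◁ a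
      bot-sides i p q (inj₁ (inj₁ r)) = ⊥-elim (ℕₚ.<⇒≱ (rising p) r)
      bot-sides i p q (inj₁ (inj₂ r)) = ⊥-elim (ℕₚ.<⇒≱ (rising q) r)
      bot-sides {a} {b} i p q (inj₂ (k , (s , r) , (u , t))) with nd-injective (X-node (nd i) {k} (ℕₚ.≤-antisym s u))
      ... | refl = strictly b (≢-sym (≺⇒≢ (rising q))) r , strictly′ a (≢-sym (≺⇒≢ (rising p))) t

    top-turn : ∀ {a b u} → (a , u) ∈ E → (b , u) ∈ E → a ≢ b →
               HasSign Sign.+ u × (a ◁ u × u ◁ b ⊎ b ◁ u × u ◁ a)
    top-turn {a} {b} {u} p q a≢b with node-Λ u (two (children-size u) p q a≢b)
    ... | i , refl , ε+ with separated _ _ p q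
    ...   | inj₁ eq       = ⊥-elim (a≢b (cong proj₁ eq))
    ...   | inj₂ (inj₁ s) = (i , refl , ε+) , inj₂ (top-sides i p q s)
    ...   | inj₂ (inj₂ s) = (i , refl , ε+) , inj₁ (top-sides i q p s)

    bot-turn : ∀ {a b u} → (u , a) ∈ E → (u , b) ∈ E → a ≢ b →
               HasSign Sign.- u × (a ◁ u × u ◁ b ⊎ b ◁ u × u ◁ a)
    bot-turn {a} {b} {u} p q a≢b with node-V u (two (parents-size u) p q a≢b)
    ... | i , refl , ε- with separated _ _ p q
    ...   | inj₁ eq       = ⊥-elim (a≢b (cong proj₂ eq))
    ...   | inj₂ (inj₁ s) = (i , refl , ε-) , inj₂ (bot-sides i p q s)
    ...   | inj₂ (inj₂ s) = (i , refl , ε-) , inj₁ (bot-sides i q p s)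

    joined-walls : ∀ k {u w} → A u w →
      (ε k ≡ Sign.+ × Y (nd k) ≤ Y u × Y (nd k) ≤ Y w) ⊎ (ε k ≡ Sign.- × Y u ≤ Y (nd k) × Y w ≤ Y (nd k)) ⊎
      (X (nd k) ≤ X u × X (nd k) ≤ X w) ⊎ (X u ≤ X (nd k) × X w ≤ X (nd k))
    joined-walls k (inj₁ p) with walls k _ p
    ... | inj₁ (inj₁ (e , q)) = inj₁ (e , q , ℕₚ.≤-trans q (ℕₚ.<⇒≤ (rising p)))
    ... | inj₁ (inj₂ (e , q)) = inj₂ (inj₁ (e , ℕₚ.≤-trans (ℕₚ.<⇒≤ (rising p)) q , q))
    ... | inj₂ s              = inj₂ (inj₂ s)
    joined-walls k (inj₂ p) with walls k _ p
    ... | inj₁ (inj₁ (e , q)) = inj₁ (e , ℕₚ.≤-trans q (ℕₚ.<⇒≤ (rising p)) , q)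
    ... | inj₁ (inj₂ (e , q)) = inj₂ (inj₁ (e , q , ℕₚ.≤-trans (ℕₚ.<⇒≤ (rising p)) q))
    ... | inj₂ (inj₁ (a , b)) = inj₂ (inj₂ (inj₁ (b , a)))
    ... | inj₂ (inj₂ (a , b)) = inj₂ (inj₂ (inj₂ (b , a)))

    private
      +≢- : ∀ {s} → s ≡ Sign.+ → s ≢ Sign.-
      +≢- refl ()

      wall-side : ∀ k {a b} → A a b → a ≢ nd k → b ≢ nd k →
                  (ε k ≡ Sign.+ → Y (nd k) ≤ Y a → ⊥) → (ε k ≡ Sign.- → Y a ≤ Y (nd k) → ⊥) →
                  (a ◁ nd k → b ◁ nd k) × (nd k ◁ a → nd k ◁ b)
      wall-side k {a} {b} e a≢ b≢ f g with joined-walls k e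
      ... | inj₁ (s , p , _)               = ⊥-elim (f s p)
      ... | inj₂ (inj₁ (s , p , _))        = ⊥-elim (g s p)
      ... | inj₂ (inj₂ (inj₁ (p , q)))     = (λ r → ⊥-elim (ℕₚ.<⇒≱ r p)) , (λ _ → strictly′ b b≢ q)
      ... | inj₂ (inj₂ (inj₂ (p , q)))     = (λ _ → strictly b b≢ q) , (λ r → ⊥-elim (ℕₚ.<⇒≱ r p))

      wallΛ : ∀ {a b u} → HasSign Sign.+ u → A a b → a ≺ u → b ≺ u → (a ◁ u → b ◁ u) × (u ◁ a → u ◁ b)
      wallΛ (k , refl , s) e p q = wall-side k e (≺⇒≢ p) (≺⇒≢ q) (λ _ → ℕₚ.<⇒≱ p) (λ t _ → +≢- s t)

      wallV : ∀ {a b u} → HasSign Sign.- u → A a b → u ≺ a → u ≺ b → (a ◁ u → b ◁ u) × (u ◁ a → u ◁ b)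
      wallV (k , refl , s) e p q = wall-side k e (≢-sym (≺⇒≢ p)) (≢-sym (≺⇒≢ q)) (λ t _ → +≢- t s) (λ _ → ℕₚ.<⇒≱ p)

    -- The structure covers all vertices, leaves included, so that `Structure.not-closed` applies to
    -- every cycle of the constructed graph.
    cobinary : Cobinary A _◁_ (HasSign Sign.+) (HasSign Sign.-)
    cobinary = record
      { _≟_ = _≟ᵥ_ ; A-sym = Sum.swap ; ◁-trans = ℕₚ.<-trans ; ◁-asym = ℕₚ.<-asym
      ; _≺_ = _≺_ ; ≺-trans = ℕₚ.<-trans ; ≺-asym = ℕₚ.<-asym
      ; oriented = λ { (inj₁ p) → inj₁ (rising p) ; (inj₂ p) → inj₂ (rising p) }
      ; top-turn = λ p q r s → top-turn (upward p r) (upward q s)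
      ; bot-turn = λ p q r s → bot-turn (upward (Sum.swap p) r) (upward (Sum.swap q) s)
      ; wallΛˡ = λ t e p q → proj₁ (wallΛ t e p q) ; wallΛʳ = λ t e p q → proj₂ (wallΛ t e p q)
      ; wallVˡ = λ t e p q → proj₁ (wallV t e p q) ; wallVʳ = λ t e p q → proj₂ (wallV t e p q)
      }

-- The completed tree as a mixed cobinary tree in the plane

module Realisations where

  open Fields
  open CobinaryCombinatorics
  open TreeAnalysis
  open Insertions
  open CompletedTrees
  open import Data.Bool.Base using (true)
  open import Data.Fin.Base using (_↑ˡ_; _↑ʳ_; splitAt; join)
  open import Data.List.Base using (_∷ʳ_)
  import Data.List.Membership.DecPropositional as DecMembership
  open import Data.List.Relation.Unary.Linked using (Linked; [-]; _∷_)
  open import Data.Product.Properties using (≡-dec)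
  open import Data.Sum.Base using ([_,_]′)
  open import Function.Base using (const; _∘_)
  open import Function.Bundles using (_⇔_; mk⇔; Equivalence)
  open import Relation.Binary.Construct.Closure.ReflexiveTransitive using (Star; _◅◅_; reverse; gmap)
  open import Relation.Nullary using (does)
  open import Relation.Nullary.Decidable using (_⊎-dec_; does-⇔; dec-true; dec-false)

  HasSize-⇔ : ∀ {A : Set} {P Q : Pred A 0ℓ} {k} → (∀ v → P v ⇔ Q v) → HasSize k P → HasSize k Q
  HasSize-⇔ e (xs , u , l , f) = xs , u , l , λ v →
    mk⇔ (λ q → Equivalence.to (f v) (Equivalence.from (e v) q)) (λ p → Equivalence.to (e v) (Equivalence.from (f v) p))

  HasSize-pull : ∀ {A B : Set} {P : Pred A 0ℓ} {k} (enc : A → B) (dec : B → A) →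
    (∀ a → dec (enc a) ≡ a) → (∀ b → enc (dec b) ≡ b) → HasSize k P → HasSize k (P ∘ dec)
  HasSize-pull {P = P} enc dec de ed (xs , u , l , f) =
      map enc xs , Uniqueₚ.map⁺ (λ {a} {b} e → ≡.trans (≡.sym (de a)) (≡.trans (≡.cong dec e) (de b))) u
    , ≡.trans (Listₚ.length-map enc xs) l
    , λ v → mk⇔ (λ p → ≡.subst (_∈ map enc xs) (ed v) (∈ₚ.∈-map⁺ enc (Equivalence.to (f (dec v)) p)))
                (λ p → let (a , a∈ , eq) = ∈ₚ.∈-map⁻ enc p in
                   ≡.subst P (≡.sym (≡.trans (≡.cong dec eq) (de a))) (Equivalence.from (f a) a∈))

  HasSize-0-empty : ∀ {A : Set} {P : Pred A 0ℓ} → HasSize 0 P → ∀ {v} → ¬ P v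
  HasSize-0-empty ([] , _ , _ , f) {v} p with () ← Equivalence.to (f v) p

  HasSize-2-two : ∀ {A : Set} {P : Pred A 0ℓ} → HasSize 2 P → ∃[ a ] ∃[ b ] P a × P b × a ≢ b
  HasSize-2-two (a ∷ b ∷ [] , (ne ∷ []) ∷ _ , _ , f) =
    a , b , Equivalence.from (f a) (here ≡.refl) , Equivalence.from (f b) (there (here ≡.refl)) , ne

  does⇒ : ∀ {P : Set} (P? : Dec P) → does P? ≡ true → P
  does⇒ (yes p) _ = p

  module SegmentEnds (𝓡 : CompleteOrderedField) where
    open OrderedField 𝓡
    open RealGeometry 𝓡 using (fromℕ)
    open Crossing 𝓡

    abstract
      convex-nonneg : ∀ {s p q} → 0# ≤ s → s ≤ 1# → 0# ≤ p → 0# ≤ q → 0# ≤ (1# - s) * p + s * q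
      convex-nonneg a b c d = +-nonneg (*-nonneg (≤-diff b) c) (*-nonneg a d)

      at-start : ∀ {s p q} → 0# ≤ s → s ≤ 1# → 0# ≤ p → 0# < q → (1# - s) * p + s * q ≈ 0# → s ≈ 0#
      at-start (inj₂ 0≈s) _ _ _ _ = sym 0≈s
      at-start (inj₁ 0<s) s≤1 0≤p 0<q eq =
        ⊥-elim (<-irrefl (sym eq) (<-respʳ-≈ (+-comm _ _) (+-pos-nonneg (*-pos 0<s 0<q) (*-nonneg (≤-diff s≤1) 0≤p))))

      at-end : ∀ {s p q} → 0# ≤ s → s ≤ 1# → 0# < p → 0# ≤ q → (1# - s) * p + s * q ≈ 0# → s ≈ 1#
      at-end _ (inj₂ s≈1) _ _ _ = s≈1
      at-end 0≤s (inj₁ s<1) 0<p 0≤q eq =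
        ⊥-elim (<-irrefl (sym eq) (+-pos-nonneg (*-pos (<-diff s<1) 0<p) (*-nonneg 0≤s 0≤q)))

      start-value : ∀ {s a b} → s ≈ 0# → a + s * (b - a) ≈ a
      start-value {s} {a} {b} p = trans (+-congˡ (trans (*-congʳ p) (zeroˡ _))) (+-identityʳ a)

      end-value : ∀ {s a b} → s ≈ 1# → a + s * (b - a) ≈ b
      end-value {s} {a} {b} p = trans (+-congˡ (trans (*-congʳ p) (*-identityˡ _)))
        (solve 2 (λ a b → a :+ (b :- a) := b) refl a b)

      on-line : ∀ {s a b c} → a + s * (b - a) ≈ c → (1# - s) * (a - c) + s * (b - c) ≈ 0#
      on-line {s} {a} {b} {c} p = trans (above-identity s a b c) (trans (+-congʳ p) (-‿inverseʳ c))

      on-line′ : ∀ {s a b c} → a + s * (b - a) ≈ c → (1# - s) * (c - a) + s * (c - b) ≈ 0#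
      on-line′ {s} {a} {b} {c} p = trans (below-identity s a b c) (trans (+-congˡ (-‿cong p)) (-‿inverseʳ c))

      ≤-segment : ∀ {s a b c} → 0# ≤ s → s ≤ 1# → c ≤ a → c ≤ b → c ≤ a + s * (b - a)
      ≤-segment {s} {a} {b} {c} p q r t = ≤-by (convex-nonneg p q (≤-diff r) (≤-diff t)) (above-identity s a b c)

      segment-≤ : ∀ {s a b c} → 0# ≤ s → s ≤ 1# → a ≤ c → b ≤ c → a + s * (b - a) ≤ c
      segment-≤ {s} {a} {b} {c} p q r t = ≤-by (convex-nonneg p q (≤-diff r) (≤-diff t)) (below-identity s a b c)

      reverse-value : ∀ s a b → a + s * (b - a) ≈ b + (1# - s) * (a - b)
      reverse-value = solve 3 (λ s a b → a :+ s :* (b :- a) := b :+ (con (1 , 0) :- s) :* (a :- b)) refl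

      reverse-bounds : ∀ {s} → 0# ≤ s → s ≤ 1# → 0# ≤ 1# - s × 1# - s ≤ 1#
      reverse-bounds {s} p q = ≤-diff q , ≤-by p (solve 2 (λ o s → s := o :- (o :- s)) refl 1# s)

      double-half : ∀ k → ½ * fromℕ (k ℕ.+ k) ≈ fromℕ k
      double-half k = trans (*-congˡ (×-homo-+ 1# k k)) (trans (distribˡ ½ _ _) halves)

      half-mono : ∀ {a b} → a ℕ.< b → ½ * fromℕ a < ½ * fromℕ b
      half-mono p = *-monoˡ-< 0<½ (fromℕ-mono-< p)

  module Realise (𝓡 : CompleteOrderedField) {n : ℕ} (ε : Fin n → Sign) (N : ℕ) (h : Fin n → ℕ)
    (h-injective : ∀ {i j} → h i ≡ h j → i ≡ j) (h<N : ∀ i → h i ℕ.< N)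
    {is : List (Fin n)} (all : ∀ i → i ∈ is) (S : Build.State ε N h h-injective h<N is) where
    open OrderedField 𝓡
    open RealGeometry 𝓡
    open SegmentEnds 𝓡
    open Build ε N h h-injective h<N using (X; Y; X-node; childCount; parentCount)
    open Completed ε N h h-injective h<N all S hiding (_◁_; _≺_)

    order : ℕ
    order = 2 ℕ.+ (n ℕ.+ n)

    encode : Vtx n → Fin order
    encode bot    = zero
    encode top    = suc zero
    encode (nd i) = suc (suc (i ↑ˡ n))
    encode (lf i) = suc (suc (n ↑ʳ i))

    decode : Fin order → Vtx n
    decode zero          = bot
    decode (suc zero)    = top
    decode (suc (suc w)) = [ nd , lf ]′ (splitAt n w)

    decode-encode : ∀ u → decode (encode u) ≡ u
    decode-encode bot    = ≡.refl
    decode-encode top    = ≡.refl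
    decode-encode (nd i) = ≡.cong [ nd , lf ]′ (Finₚ.splitAt-↑ˡ n i n)
    decode-encode (lf i) = ≡.cong [ nd , lf ]′ (Finₚ.splitAt-↑ʳ n n i)

    encode-decode : ∀ v → encode (decode v) ≡ v
    encode-decode zero          = ≡.refl
    encode-decode (suc zero)    = ≡.refl
    encode-decode (suc (suc w)) = ≡.trans (by (splitAt n w)) (≡.cong (λ w → suc (suc w)) (Finₚ.join-splitAt n n w))
      where
      by : ∀ t → encode ([ nd , lf ]′ t) ≡ suc (suc (join n n t))
      by (inj₁ _) = ≡.refl
      by (inj₂ _) = ≡.refl

    decode-injective : ∀ {v w} → decode v ≡ decode w → v ≡ w
    decode-injective {v} {w} p = ≡.trans (≡.sym (encode-decode v)) (≡.trans (≡.cong encode p) (encode-decode w))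

    A? : ∀ u w → Dec (A u w)
    A? u w = ((u , w) ∈? E) ⊎-dec ((w , u) ∈? E)
      where open DecMembership (≡-dec _≟ᵥ_ _≟ᵥ_) using (_∈?_)

    A-irrefl : ∀ {u} → ¬ A u u
    A-irrefl (inj₁ p) = ℕₚ.<-irrefl ≡.refl (rising p)
    A-irrefl (inj₂ p) = ℕₚ.<-irrefl ≡.refl (rising p)

    graph : FiniteGraph
    graph = record
      { order     = order
      ; adjacent  = λ u v → does (A? (decode u) (decode v))
      ; symmetric = λ u v → does-⇔ (mk⇔ Sum.swap Sum.swap) (A? (decode u) (decode v)) (A? (decode v) (decode u))
      ; loopless  = λ v → dec-false (A? (decode v) (decode v)) A-irrefl
      }

    open FiniteGraph graph using (Adj; Connected; Acyclic)

    adj⇒ : ∀ {u v} → Adj u v → A (decode u) (decode v)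
    adj⇒ {u} {v} = does⇒ (A? (decode u) (decode v))

    adj⇐ : ∀ {u v} → A (decode u) (decode v) → Adj u v
    adj⇐ {u} {v} = dec-true (A? (decode u) (decode v))

    connected-graph : Connected
    connected-graph u v = ≡.subst₂ (Star Adj) (encode-decode u) (encode-decode v)
      (gmap encode (λ {a} {b} e → adj⇐ {encode a} {encode b} (≡.subst₂ A (≡.sym (decode-encode a)) (≡.sym (decode-encode b)) e))
        (to-bot (decode u) ◅◅ reverse Sum.swap (to-bot (decode v))))
      where
      to-bot : ∀ a → Star A a bot
      to-bot a = Build.State.connected S a (present a)

    -- The vertices of a cycle are distinct, so going around it is a closed walk without
    -- backtracking.
    acyclic : Acyclic
    acyclic {u} {v} {w} ws ((u≢v ∷ u≢w ∷ u∉) ∷ uniq) (e ∷ f ∷ l) =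
      Structure.not-closed cobinary (adj⇒ {u} {v} e)
        (step (adj⇒ {v} {w} f) (λ p → u≢w (decode-injective (≡.sym p))) (walk v w ws uniq u≢v (u≢w ∷ u∉) l))
      where
      walk : ∀ a b xs → Unique (a ∷ b ∷ xs) → u ≢ a → All (u ≢_) (b ∷ xs) → Linked Adj ((b ∷ xs) ∷ʳ u) →
             Walk A (decode a) (decode b) (decode u)
      walk a b [] _ u≢a _ (e ∷ [-]) = step (adj⇒ {b} {u} e) (λ p → u≢a (decode-injective p)) stop
      walk a b (c ∷ xs) ((_ ∷ a≢c ∷ _) ∷ uniq) u≢a (u≢b ∷ u∉) (e ∷ l) =
        step (adj⇒ {b} {c} e) (λ p → a≢c (decode-injective (≡.sym p))) (walk b c xs uniq u≢b u∉ l)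

    point : Vtx n → Point
    point u = ½ * fromℕ (X u) , fromℕ (Y u)

    private
      X-cancel : ∀ {a b} → ½ * fromℕ a ≈ ½ * fromℕ b → a ≡ b
      X-cancel {a} {b} p with ℕₚ.<-cmp a b
      ... | tri< q _ _ = ⊥-elim (<-irrefl p (half-mono q))
      ... | tri≈ _ q _ = q
      ... | tri> _ _ q = ⊥-elim (<-irrefl (sym p) (half-mono q))

      half-mono-≤ : ∀ {a b} → a ℕ.≤ b → ½ * fromℕ a ≤ ½ * fromℕ b
      half-mono-≤ p = *-monoˡ-≤ (<⇒≤ 0<½) (fromℕ-mono-≤ p)

      double-injective : ∀ {a b} → a ℕ.+ a ≡ b ℕ.+ b → a ≡ b
      double-injective {a} {b} p with ℕₚ.<-cmp a b
      ... | tri< q _ _ = ⊥-elim (ℕₚ.<⇒≢ (ℕₚ.+-mono-< q q) p)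
      ... | tri≈ _ q _ = q
      ... | tri> _ _ q = ⊥-elim (ℕₚ.<⇒≢ (ℕₚ.+-mono-< q q) (≡.sym p))

      coordinates-injective : ∀ u w → X u ≡ X w → Y u ≡ Y w → u ≡ w
      coordinates-injective u (nd i) p _ = X-node u p
      coordinates-injective (nd i) w p _ = ≡.sym (X-node w (≡.sym p))
      coordinates-injective bot bot _ _ = ≡.refl
      coordinates-injective top top _ _ = ≡.refl
      coordinates-injective bot top _ ()
      coordinates-injective top bot _ ()
      coordinates-injective bot (lf j) () _
      coordinates-injective top (lf j) () _
      coordinates-injective (lf j) bot () _
      coordinates-injective (lf j) top () _
      coordinates-injective (lf i) (lf j) p _ =
        ≡.cong lf (Finₚ.toℕ-injective (double-injective (ℕₚ.suc-injective (ℕₚ.suc-injective (ℕₚ.suc-injective p)))))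

      point-injective : ∀ u w → point u ≈ₚ point w → u ≡ w
      point-injective u w (p , q) = coordinates-injective u w (X-cancel p) (fromℕ-injective {Y u} {Y w} q)

      Seg : Vtx n → Vtx n → Pred Point 0ℓ
      Seg u w = Segment (point u) (point w)

      seg-sym : ∀ u w p → Seg u w p → Seg w u p
      seg-sym u w p (s , a , b , (x , y)) = let (c , d) = reverse-bounds a b in
        1# - s , c , d , trans x (reverse-value s _ _) , trans y (reverse-value s _ _)

      start-point : ∀ u w p → ((s , _) : Seg u w p) → s ≈ 0# → p ≈ₚ point u
      start-point u w p (s , _ , _ , (x , y)) e = trans x (start-value e) , trans y (start-value e)

      end-point : ∀ u w p → ((s , _) : Seg u w p) → s ≈ 1# → p ≈ₚ point w
      end-point u w p (s , _ , _ , (x , y)) e = trans x (end-value e) , trans y (end-value e)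

      y-≤ : ∀ u w p {k} → Seg u w p → Y u ℕ.≤ k → Y w ℕ.≤ k → proj₂ p ≤ fromℕ k
      y-≤ u w p (s , a , b , (_ , y)) q r = ≤-trans (≈⇒≤ y) (segment-≤ a b (fromℕ-mono-≤ q) (fromℕ-mono-≤ r))

      ≤-y : ∀ u w p {k} → Seg u w p → k ℕ.≤ Y u → k ℕ.≤ Y w → fromℕ k ≤ proj₂ p
      ≤-y u w p (s , a , b , (_ , y)) q r = ≤-trans (≤-segment a b (fromℕ-mono-≤ q) (fromℕ-mono-≤ r)) (≈⇒≤ (sym y))

      x-≤ : ∀ u w p {k} → Seg u w p → X u ℕ.≤ k → X w ℕ.≤ k → proj₁ p ≤ ½ * fromℕ k
      x-≤ u w p (s , a , b , (x , _)) q r = ≤-trans (≈⇒≤ x) (segment-≤ a b (half-mono-≤ q) (half-mono-≤ r))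

      ≤-x : ∀ u w p {k} → Seg u w p → k ℕ.≤ X u → k ℕ.≤ X w → ½ * fromℕ k ≤ proj₁ p
      ≤-x u w p (s , a , b , (x , _)) q r = ≤-trans (≤-segment a b (half-mono-≤ q) (half-mono-≤ r)) (≈⇒≤ (sym x))

      at-top : ∀ u w p → Y u ℕ.< Y w → Seg u w p → fromℕ (Y w) ≤ proj₂ p → p ≈ₚ point w
      at-top u w p u<w g@(s , a , b , (_ , y)) q = end-point u w p g
        (at-end a b (<-diff (fromℕ-mono-< u<w)) (≤-diff ≤-refl)
          (on-line′ (trans (sym y) (≤-antisym (y-≤ u w p g (ℕₚ.<⇒≤ u<w) ℕₚ.≤-refl) q))))

      at-bottom : ∀ u w p → Y u ℕ.< Y w → Seg u w p → proj₂ p ≤ fromℕ (Y u) → p ≈ₚ point u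
      at-bottom u w p u<w g@(s , a , b , (_ , y)) q = start-point u w p g
        (at-start a b (≤-diff ≤-refl) (<-diff (fromℕ-mono-< u<w))
          (on-line (trans (sym y) (≤-antisym q (≤-y u w p g ℕₚ.≤-refl (ℕₚ.<⇒≤ u<w))))))

      End : Vtx n → Vtx n → Vtx n → Point → Set
      End v u w p = (v ≡ u ⊎ v ≡ w) × p ≈ₚ point v

      -- A vertex on the vertical line through node `k` is that node. Hence at most one end of the
      -- edge is on the line, and the edge, lying on one side, meets the line only in that end.
      touch-right : ∀ k u w p → u ≢ w → Seg u w p → X (nd k) ℕ.≤ X u → X (nd k) ℕ.≤ X w →
                    proj₁ p ≈ ½ * fromℕ (X (nd k)) → End (nd k) u w p
      touch-right k u w p u≢w g@(s , a , b , (x , _)) k≤u k≤w eq with ℕₚ.m≤n⇒m<n∨m≡n k≤w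
      ... | inj₁ k<w = let q = start-point u w p g (at-start a b (≤-diff (half-mono-≤ k≤u)) (<-diff (half-mono k<w)) (on-line (trans (sym x) eq)))
                           u≡k = X-node u (X-cancel (trans (sym (proj₁ q)) eq))
                       in inj₁ (≡.sym u≡k) , ≡.subst (λ v → p ≈ₚ point v) u≡k q
      ... | inj₂ k≡w = let w≡k = X-node w (≡.sym k≡w)
                           k<u = ℕₚ.≤∧≢⇒< k≤u (λ e → u≢w (≡.trans (X-node u (≡.sym e)) (≡.sym w≡k)))
                           q = end-point u w p g (at-end a b (<-diff (half-mono k<u)) (≤-diff (half-mono-≤ k≤w)) (on-line (trans (sym x) eq)))
                       in inj₂ (≡.sym w≡k) , ≡.subst (λ v → p ≈ₚ point v) w≡k q

      touch-left : ∀ k u w p → u ≢ w → Seg u w p → X u ℕ.≤ X (nd k) → X w ℕ.≤ X (nd k) →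
                   proj₁ p ≈ ½ * fromℕ (X (nd k)) → End (nd k) u w p
      touch-left k u w p u≢w g@(s , a , b , (x , _)) u≤k w≤k eq with ℕₚ.m≤n⇒m<n∨m≡n w≤k
      ... | inj₁ w<k = let q = start-point u w p g (at-start a b (≤-diff (half-mono-≤ u≤k)) (<-diff (half-mono w<k)) (on-line′ (trans (sym x) eq)))
                           u≡k = X-node u (X-cancel (trans (sym (proj₁ q)) eq))
                       in inj₁ (≡.sym u≡k) , ≡.subst (λ v → p ≈ₚ point v) u≡k q
      ... | inj₂ w≡k = let w≡nd = X-node w w≡k
                           u<k = ℕₚ.≤∧≢⇒< u≤k (λ e → u≢w (≡.trans (X-node u e) (≡.sym w≡nd)))
                           q = end-point u w p g (at-end a b (<-diff (half-mono u<k)) (≤-diff (half-mono-≤ w≤k)) (on-line′ (trans (sym x) eq)))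
                       in inj₂ (≡.sym w≡nd) , ≡.subst (λ v → p ≈ₚ point v) w≡nd q

      Meet : Vtx n → Vtx n → Vtx n → Vtx n → Point → Set
      Meet u v u′ v′ p = ∃[ w ] (w ≡ u ⊎ w ≡ v) × (w ≡ u′ ⊎ w ≡ v′) × p ≈ₚ point w

      meet-sym : ∀ {u v u′ v′ p} → Meet u v u′ v′ p → Meet u′ v′ u v p
      meet-sym (w , a , b , c) = w , b , a , c

      ≺⇒≢ : ∀ {u w} → Y u ℕ.< Y w → u ≢ w
      ≺⇒≢ p ≡.refl = ℕₚ.<-irrefl ≡.refl p

      -- The common point is squeezed between the two levels, so it is the upper end of one edge and
      -- the lower end of the other; distinct vertices have distinct positions.
      meet-levels : ∀ u v u′ v′ p → (u , v) ∈ E → (u′ , v′) ∈ E → Seg u v p → Seg u′ v′ p → Y v ℕ.≤ Y u′ → Meet u v u′ v′ p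
      meet-levels u v u′ v′ p e f g g′ q = v , inj₂ ≡.refl , inj₁ v≡u′ , at-v
        where
        at-v : p ≈ₚ point v
        at-v = at-top u v p (rising e) g (≤-trans (fromℕ-mono-≤ q) (≤-y u′ v′ p g′ ℕₚ.≤-refl (ℕₚ.<⇒≤ (rising f))))
        at-u′ : p ≈ₚ point u′
        at-u′ = at-bottom u′ v′ p (rising f) g′ (≤-trans (y-≤ u v p g (ℕₚ.<⇒≤ (rising e)) ℕₚ.≤-refl) (fromℕ-mono-≤ q))
        v≡u′ : v ≡ u′
        v≡u′ = point-injective v u′ (trans (sym (proj₁ at-v)) (proj₁ at-u′) , trans (sym (proj₂ at-v)) (proj₂ at-u′))

      meet-RSep : ∀ u v u′ v′ p → (u , v) ∈ E → (u′ , v′) ∈ E → Seg u v p → Seg u′ v′ p →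
                  Build.RSep ε N h h-injective h<N (u , v) (u′ , v′) → Meet u v u′ v′ p
      meet-RSep u v u′ v′ p e f g g′ (inj₁ (inj₁ q)) = meet-levels u v u′ v′ p e f g g′ q
      meet-RSep u v u′ v′ p e f g g′ (inj₁ (inj₂ q)) = meet-sym (meet-levels u′ v′ u v p f e g′ g q)
      meet-RSep u v u′ v′ p e f g g′ (inj₂ (k , (q , r) , (s , t))) =
        let x≈ = ≤-antisym (x-≤ u′ v′ p g′ q r) (≤-x u v p g s t)
            (i , at) = touch-right k u v p (≺⇒≢ (rising e)) g s t x≈
            (j , _)  = touch-left k u′ v′ p (≺⇒≢ (rising f)) g′ q r x≈
        in nd k , i , j , at

      meet : ∀ u v u′ v′ p → (u , v) ∈ E → (u′ , v′) ∈ E → Seg u v p → Seg u′ v′ p →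
             (u ≡ u′ × v ≡ v′) ⊎ Meet u v u′ v′ p
      meet u v u′ v′ p e f g g′ with separated (u , v) (u′ , v′) e f
      ... | inj₁ ≡.refl   = inj₁ (≡.refl , ≡.refl)
      ... | inj₂ (inj₁ s) = inj₂ (meet-RSep u v u′ v′ p e f g g′ s)
      ... | inj₂ (inj₂ s) = inj₂ (meet-sym (meet-RSep u′ v′ u v p f e g′ g s))

      meet-A : ∀ u v u′ v′ p → A u v → A u′ v′ → Seg u v p → Seg u′ v′ p →
               ((u ≡ u′ × v ≡ v′) ⊎ (u ≡ v′ × v ≡ u′)) ⊎ Meet u v u′ v′ p
      meet-A u v u′ v′ p (inj₁ e) (inj₁ f) g g′ = Sum.map₁ inj₁ (meet u v u′ v′ p e f g g′)
      meet-A u v u′ v′ p (inj₁ e) (inj₂ f) g g′ =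
        Sum.map inj₂ (λ (w , a , b , c) → w , a , Sum.swap b , c) (meet u v v′ u′ p e f g (seg-sym u′ v′ p g′))
      meet-A u v u′ v′ p (inj₂ e) (inj₁ f) g g′ =
        Sum.map (λ (a , b) → inj₂ (b , a)) (λ (w , a , b , c) → w , Sum.swap a , b , c) (meet v u u′ v′ p e f (seg-sym u v p g) g′)
      meet-A u v u′ v′ p (inj₂ e) (inj₂ f) g g′ =
        Sum.map (λ (a , b) → inj₁ (b , a)) (λ (w , a , b , c) → w , Sum.swap a , Sum.swap b , c)
          (meet v u v′ u′ p e f (seg-sym u v p g) (seg-sym u′ v′ p g′))

    placed : PlacedTree
    placed = record { graph = graph ; isTree = connected-graph , acyclic ; position = λ v → point (decode v) }

    open PlacedTree placed using (Vertex; Support; IsEmbedding; Child; Parent; IsΛ; IsV; xc; yc; Leaf; Internal)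

    isEmbedding : IsEmbedding
    isEmbedding = record
      { injective  = λ {u} {v} p → decode-injective (point-injective (decode u) (decode v) p)
      ; edges-meet = λ {u} {v} {u′} {v′} {p} e f g g′ → back u v u′ v′ p
          (meet-A (decode u) (decode v) (decode u′) (decode v′) p (adj⇒ {u} {v} e) (adj⇒ {u′} {v′} f) g g′)
      }
      where
      back : ∀ u v u′ v′ p →
        ((decode u ≡ decode u′ × decode v ≡ decode v′) ⊎ (decode u ≡ decode v′ × decode v ≡ decode u′)) ⊎
          Meet (decode u) (decode v) (decode u′) (decode v′) p →
        ((u ≡ u′ × v ≡ v′) ⊎ (u ≡ v′ × v ≡ u′)) ⊎
          (∃[ w ] (w ≡ u ⊎ w ≡ v) × (w ≡ u′ ⊎ w ≡ v′) × p ≈ₚ point (decode w))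
      back u v u′ v′ p (inj₁ (inj₁ (a , b))) = inj₁ (inj₁ (decode-injective a , decode-injective b))
      back u v u′ v′ p (inj₁ (inj₂ (a , b))) = inj₁ (inj₂ (decode-injective a , decode-injective b))
      back u v u′ v′ p (inj₂ (w , inj₁ ≡.refl , b , c)) = inj₂ (u , inj₁ ≡.refl , Sum.map decode-injective decode-injective b , c)
      back u v u′ v′ p (inj₂ (w , inj₂ ≡.refl , b , c)) = inj₂ (v , inj₂ ≡.refl , Sum.map decode-injective decode-injective b , c)

    private
      y-mono : ∀ {u w} → Y u ℕ.< Y w → fromℕ (Y u) < fromℕ (Y w)
      y-mono {u} {w} = fromℕ-mono-< {Y u} {Y w}

      y-cancel : ∀ {u w} → fromℕ (Y u) < fromℕ (Y w) → Y u ℕ.< Y w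
      y-cancel {u} {w} = fromℕ-cancel-< {Y u} {Y w}

      child⇔ : ∀ v w → (decode w , decode v) ∈ E ⇔ Child v w
      child⇔ v w = mk⇔ (λ p → adj⇐ {v} {w} (inj₂ p) , y-mono {decode w} {decode v} (rising p))
                       (λ (a , p) → upward (Sum.swap (adj⇒ {v} {w} a)) (y-cancel {decode w} {decode v} p))

      parent⇔ : ∀ v w → (decode v , decode w) ∈ E ⇔ Parent v w
      parent⇔ v w = mk⇔ (λ p → adj⇐ {v} {w} (inj₁ p) , y-mono {decode v} {decode w} (rising p))
                        (λ (a , p) → upward (adj⇒ {v} {w} a) (y-cancel {decode v} {decode w} p))

      children : ∀ v → HasSize (childCount (decode v)) (Child v)
      children v = HasSize-⇔ (child⇔ v) (HasSize-pull encode decode decode-encode encode-decode (children-size (decode v)))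

      parents : ∀ v → HasSize (parentCount (decode v)) (Parent v)
      parents v = HasSize-⇔ (parent⇔ v) (HasSize-pull encode decode decode-encode encode-decode (parents-size (decode v)))

      node : Fin n → Vertex
      node i = encode (nd i)

      decode-node : ∀ i → decode (node i) ≡ nd i
      decode-node i = decode-encode (nd i)

      two-sided : ∀ v → ∀ {a b} → HasSize a (Child v) → HasSize b (Parent v) → a ≢ 0 → b ≢ 0 → Internal v
      two-sided v {zero}  {_}     c p a b leaf = a ≡.refl
      two-sided v {suc _} {zero}  c p a b leaf = b ≡.refl
      two-sided v {suc _} {suc _} c p a b leaf =
        let (x , ax , px) = HasSize-inhabited c
            (y , ay , py) = HasSize-inhabited p
        in <-irrefl (reflexive (≡.cong yc (HasSize-1-unique leaf {x} {y} ax ay))) (<-trans px py)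

      childCount-node : ∀ i → childCount (nd i) ≢ 0
      childCount-node i with ε i
      ... | Sign.+ = λ ()
      ... | Sign.- = λ ()

      parentCount-node : ∀ i → parentCount (nd i) ≢ 0
      parentCount-node i with ε i
      ... | Sign.+ = λ ()
      ... | Sign.- = λ ()

      one-sided : ∀ v → (childCount (decode v) ≡ 0 × parentCount (decode v) ≡ 1) ⊎ (childCount (decode v) ≡ 1 × parentCount (decode v) ≡ 0) → Leaf v
      one-sided v (inj₁ (c , p)) = HasSize-⇔
        (λ w → mk⇔ proj₁ (λ a → [ (λ q → a , y-mono {decode v} {decode w} (rising q))
                                , (λ q → ⊥-elim (HasSize-0-empty (≡.subst (λ k → HasSize k (Child v)) c (children v)) {w}
                                                  (Equivalence.to (child⇔ v w) q))) ]′ (adj⇒ {v} {w} a)))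
        (≡.subst (λ k → HasSize k (Parent v)) p (parents v))
      one-sided v (inj₂ (c , p)) = HasSize-⇔
        (λ w → mk⇔ proj₁ (λ a → [ (λ q → ⊥-elim (HasSize-0-empty (≡.subst (λ k → HasSize k (Parent v)) p (parents v)) {w}
                                                  (Equivalence.to (parent⇔ v w) q)))
                                , (λ q → a , y-mono {decode w} {decode v} (rising q)) ]′ (adj⇒ {v} {w} a)))
        (≡.subst (λ k → HasSize k (Child v)) c (children v))

      leaf-counts : ∀ i → (childCount (lf i) ≡ 0 × parentCount (lf i) ≡ 1) ⊎ (childCount (lf i) ≡ 1 × parentCount (lf i) ≡ 0)
      leaf-counts i with ε i
      ... | Sign.+ = inj₁ (≡.refl , ≡.refl)
      ... | Sign.- = inj₂ (≡.refl , ≡.refl)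

      complete : ∀ v → Internal v → ∃[ i ] node i ≡ v
      complete v internal = by (decode v) ≡.refl
        where
        OneSided : Vtx n → Set
        OneSided u = (childCount u ≡ 0 × parentCount u ≡ 1) ⊎ (childCount u ≡ 1 × parentCount u ≡ 0)
        by : ∀ u → decode v ≡ u → ∃[ i ] node i ≡ v
        by (nd i) eq = i , ≡.trans (≡.cong encode (≡.sym eq)) (encode-decode v)
        by bot eq    = ⊥-elim (internal (one-sided v (≡.subst OneSided (≡.sym eq) (inj₁ (≡.refl , ≡.refl)))))
        by top eq    = ⊥-elim (internal (one-sided v (≡.subst OneSided (≡.sym eq) (inj₂ (≡.refl , ≡.refl)))))
        by (lf i) eq = ⊥-elim (internal (one-sided v (≡.subst OneSided (≡.sym eq) (leaf-counts i))))

      -- An edge that does not avoid the wall by its levels lies on one side of the vertical line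
      -- and meets it only in the node, at the height of the node.
      off-wall : ∀ k s → ε k ≡ s → ∀ p → Support p → proj₁ p ≈ ½ * fromℕ (X (nd k)) →
                 (s ≡ Sign.+ → fromℕ (Y (nd k)) ≤ proj₂ p) × (s ≡ Sign.- → proj₂ p ≤ fromℕ (Y (nd k)))
      off-wall k s eq p (u , w , a , g) x≈ with joined-walls k (adj⇒ {u} {w} a)
      ... | inj₁ (e , q , r)        = (λ _ → ≤-y (decode u) (decode w) p g q r)
                                    , (λ t → ⊥-elim (+≢- (≡.trans (≡.sym e) (≡.trans eq t))))
        where
        +≢- : Sign.+ ≢ Sign.-
        +≢- ()
      ... | inj₂ (inj₁ (e , q , r)) = (λ t → ⊥-elim (+≢- (≡.trans (≡.sym e) (≡.trans eq t))))
                                    , (λ _ → y-≤ (decode u) (decode w) p g q r)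
        where
        +≢- : Sign.- ≢ Sign.+
        +≢- ()
      ... | inj₂ (inj₂ (inj₁ (q , r))) =
        let (_ , _ , y) = touch-right k (decode u) (decode w) p (λ e → A-irrefl (≡.subst (A (decode u)) (≡.sym e) (adj⇒ {u} {w} a))) g q r x≈
        in (λ _ → ≈⇒≤ (sym y)) , (λ _ → ≈⇒≤ y)
      ... | inj₂ (inj₂ (inj₂ (q , r))) =
        let (_ , _ , y) = touch-left k (decode u) (decode w) p (λ e → A-irrefl (≡.subst (A (decode u)) (≡.sym e) (adj⇒ {u} {w} a))) g q r x≈
        in (λ _ → ≈⇒≤ (sym y)) , (λ _ → ≈⇒≤ y)

      xc-mono : ∀ v w → X (decode v) ℕ.< X (decode w) → xc v < xc w
      xc-mono v w p = half-mono p

      node-Λ : ∀ i v → decode v ≡ nd i → ε i ≡ Sign.+ → IsΛ v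
      node-Λ i v dv e = record
        { children  = two
        ; parents   = ≡.subst (λ k → HasSize k (Parent v)) parentCount≡ (parents v)
        ; wall      = λ {p} sup (x≈ , y<) → ≤⇒≯ (≡.subst (λ u → fromℕ (Y u) ≤ proj₂ p) (≡.sym dv)
            (proj₁ (off-wall i Sign.+ e p sup (≡.subst (λ u → proj₁ p ≈ ½ * fromℕ (X u)) dv x≈)) ≡.refl)) y<
        ; separated = sides (HasSize-2-two two)
        }
        where
        childCount≡ : childCount (decode v) ≡ 2
        childCount≡ rewrite dv | e = ≡.refl
        parentCount≡ : parentCount (decode v) ≡ 1
        parentCount≡ rewrite dv | e = ≡.refl
        two : HasSize 2 (Child v)
        two = ≡.subst (λ k → HasSize k (Child v)) childCount≡ (children v)
        sides : (∃[ a ] ∃[ b ] Child v a × Child v b × a ≢ b) → ∃[ l ] ∃[ r ] Child v l × Child v r × xc l < xc v × xc v < xc r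
        sides (a , b , ca , cb , a≢b) with top-turn (Equivalence.from (child⇔ v a) ca) (Equivalence.from (child⇔ v b) cb) (λ q → a≢b (decode-injective q))
        ... | _ , inj₁ (q , r) = a , b , ca , cb , xc-mono a v q , xc-mono v b r
        ... | _ , inj₂ (q , r) = b , a , cb , ca , xc-mono b v q , xc-mono v a r

      node-V : ∀ i v → decode v ≡ nd i → ε i ≡ Sign.- → IsV v
      node-V i v dv e = record
        { children  = ≡.subst (λ k → HasSize k (Child v)) childCount≡ (children v)
        ; parents   = two
        ; wall      = λ {p} sup (x≈ , y<) → ≤⇒≯ (≡.subst (λ u → proj₂ p ≤ fromℕ (Y u)) (≡.sym dv)
            (proj₂ (off-wall i Sign.- e p sup (≡.subst (λ u → proj₁ p ≈ ½ * fromℕ (X u)) dv x≈)) ≡.refl)) y<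
        ; separated = sides (HasSize-2-two two)
        }
        where
        childCount≡ : childCount (decode v) ≡ 1
        childCount≡ rewrite dv | e = ≡.refl
        parentCount≡ : parentCount (decode v) ≡ 2
        parentCount≡ rewrite dv | e = ≡.refl
        two : HasSize 2 (Parent v)
        two = ≡.subst (λ k → HasSize k (Parent v)) parentCount≡ (parents v)
        sides : (∃[ a ] ∃[ b ] Parent v a × Parent v b × a ≢ b) → ∃[ l ] ∃[ r ] Parent v l × Parent v r × xc l < xc v × xc v < xc r
        sides (a , b , ca , cb , a≢b) with bot-turn (Equivalence.from (parent⇔ v a) ca) (Equivalence.from (parent⇔ v b) cb) (λ q → a≢b (decode-injective q))
        ... | _ , inj₁ (q , r) = a , b , ca , cb , xc-mono a v q , xc-mono v b r
        ... | _ , inj₂ (q , r) = b , a , cb , ca , xc-mono b v q , xc-mono v a r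

      type : ∀ i s → ε i ≡ s → Σ[ t ∈ IsΛ (node i) ⊎ IsV (node i) ] [ const Sign.+ , const Sign.- ]′ t ≡ s
      type i Sign.+ e = inj₁ (node-Λ i (node i) (decode-node i) e) , ≡.refl
      type i Sign.- e = inj₂ (node-V i (node i) (decode-node i) e) , ≡.refl

    tree : MCT n
    tree = record
      { placedTree   = placed
      ; isEmbedding  = isEmbedding
      ; noHorizontal = λ {u} {v} a eq → A-irrefl (≡.subst (A (decode u))
          (≡.sym (level-injective (adj⇒ {u} {v} a) (fromℕ-injective {Y (decode u)} {Y (decode v)} eq))) (adj⇒ {u} {v} a))
      ; node         = node
      ; nodeInternal = λ i → two-sided (node i) (children (node i)) (parents (node i))
          (≡.subst (λ u → childCount u ≢ 0) (≡.sym (decode-node i)) (childCount-node i))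
          (≡.subst (λ u → parentCount u ≢ 0) (≡.sym (decode-node i)) (parentCount-node i))
      ; nodeComplete = λ {v} → complete v
      ; node-x       = λ i → trans (reflexive (≡.cong (λ u → ½ * fromℕ (X u)) (decode-node i)))
          (trans (reflexive (≡.cong (λ k → ½ * fromℕ (suc k)) (≡.sym (ℕₚ.+-suc (toℕ i) (toℕ i))))) (double-half (suc (toℕ i))))
      ; nodeType     = λ i → proj₁ (type i (ε i) ≡.refl)
      }
      where
      level-injective : ∀ {u w} → A u w → Y u ≡ Y w → u ≡ w
      level-injective (inj₁ p) eq = ⊥-elim (ℕₚ.<⇒≢ (rising p) eq)
      level-injective (inj₂ p) eq = ⊥-elim (ℕₚ.<⇒≢ (rising p) (≡.sym eq))

    tree-sign : signVector tree ≗ ε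
    tree-sign i = proj₂ (type i (ε i) ≡.refl)

    tree-height : ∀ i → yc (MCT.node tree i) ≡ fromℕ (suc (h i))
    tree-height i = ≡.cong (λ u → fromℕ (Y u)) (decode-node i)

-- Binary trees as codes of linear extensions

module LinearOrders where

  open CobinaryCombinatorics
  open import Data.List.Membership.Propositional using (_∉_)
  open import Data.Nat.Base using (_+_)
  open import Relation.Binary.PropositionalEquality.Core using (refl; sym; trans; cong; cong₂; subst)
  open Insertions using (AllPairs-++⁻)

  data Tree : Set where
    leaf : Tree
    node : Tree → Tree → Tree

  size : Tree → ℕ
  size leaf       = 0
  size (node l r) = suc (size l + size r)

  module _ {n : ℕ} where

    position : List (Fin n) → Fin n → ℕ
    -- A missing node thus gets the length of the list as its position, the shift that
    -- `position-++ʳ` relies on.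
    position []       q = 0
    position (a ∷ xs) q with a Finₚ.≟ q
    ... | yes _ = 0
    ... | no  _ = suc (position xs q)

    position-here : ∀ a xs → position (a ∷ xs) a ≡ 0
    position-here a xs with a Finₚ.≟ a
    ... | yes _ = refl
    ... | no ne = ⊥-elim (ne refl)

    position-there : ∀ {a q} xs → a ≢ q → position (a ∷ xs) q ≡ suc (position xs q)
    position-there {a} {q} xs ne with a Finₚ.≟ q
    ... | yes eq = ⊥-elim (ne eq)
    ... | no _   = refl

    position-< : ∀ {xs q} → q ∈ xs → position xs q ℕ.< length xs
    position-< {a ∷ xs} {q} p with a Finₚ.≟ q
    ... | yes _ = s≤s z≤n
    position-< {a ∷ xs} (here eq) | no ne = ⊥-elim (ne (sym eq))
    position-< {a ∷ xs} (there p) | no ne = s≤s (position-< p)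

    position-injective : ∀ {xs p q} → p ∈ xs → q ∈ xs → position xs p ≡ position xs q → p ≡ q
    position-injective {a ∷ xs} {p} {q} p∈ q∈ eq with a Finₚ.≟ p | a Finₚ.≟ q
    ... | yes refl | yes refl = refl
    position-injective (here e) q∈ eq         | no ne | no _   = ⊥-elim (ne (sym e))
    position-injective (there _) (here e) eq  | no _  | no ne  = ⊥-elim (ne (sym e))
    position-injective (there p) (there q) eq | no _  | no _   = position-injective p q (ℕₚ.suc-injective eq)

    position-++ˡ : ∀ {xs q} ys → q ∈ xs → position (xs ++ ys) q ≡ position xs q
    position-++ˡ {a ∷ xs} {q} ys p with a Finₚ.≟ q
    ... | yes _ = refl
    position-++ˡ {a ∷ xs} ys (here eq) | no ne = ⊥-elim (ne (sym eq))
    position-++ˡ {a ∷ xs} ys (there p) | no ne = cong suc (position-++ˡ ys p)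

    position-++ʳ : ∀ {xs q} ys → q ∉ xs → position (xs ++ ys) q ≡ length xs + position ys q
    position-++ʳ {[]}     ys q∉ = refl
    position-++ʳ {a ∷ xs} ys q∉ = trans (position-there (xs ++ ys) (λ { refl → q∉ (here refl) }))
                                        (cong suc (position-++ʳ ys (λ p → q∉ (there p))))

    position-sorted : ∀ {xs} → AllPairs _≢_ xs → AllPairs (λ p q → position xs p ℕ.< position xs q) xs
    position-sorted {[]}     []       = []
    position-sorted {a ∷ xs} (p ∷ ps) =
      All.map (λ {q} ne → subst₂ ℕ._<_ (sym (position-here a xs)) (sym (position-there xs ne)) (s≤s z≤n)) p
      ∷ shifted p (position-sorted ps)
      where
      open ≡ using (subst₂)
      shifted : ∀ {ys} → All (a ≢_) ys → AllPairs (λ p q → position xs p ℕ.< position xs q) ys →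
                AllPairs (λ p q → position (a ∷ xs) p ℕ.< position (a ∷ xs) q) ys
      shifted [] [] = []
      shifted (p ∷ ps) (q ∷ qs) =
        All.zipWith (λ (ne , lt) → subst₂ ℕ._<_ (sym (position-there xs p)) (sym (position-there xs ne)) (s≤s lt)) (ps , q)
        ∷ shifted ps qs

    Descending : List (Fin n) → Set
    Descending = AllPairs (λ i j → j Fin.< i)

    module Cuts (ε : Fin n → Sign) where

      -- The ways to cut a descending list S into the nodes L below and U above a
      -- node m > S: in the order "Λ-nodes descending, then V-nodes ascending" L is
      -- an initial segment.
      data Cut : (S L U : List (Fin n)) → Set where
        []   : Cut [] [] []
        Λ-lo : ∀ {a S L U} → ε a ≡ Sign.+ → Cut S L U → Cut (a ∷ S) (a ∷ L) U
        -- The rightmost node `a` is first in that order if it is a Λ-node and last if it is a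
        -- V-node. So a Λ-node in the upper part takes everything with it, as does a V-node in the
        -- lower part.
        Λ-hi : ∀ {a S} → ε a ≡ Sign.+ → Cut (a ∷ S) [] (a ∷ S)
        V-hi : ∀ {a S L U} → ε a ≡ Sign.- → Cut S L U → Cut (a ∷ S) L (a ∷ U)
        V-lo : ∀ {a S} → ε a ≡ Sign.- → Cut (a ∷ S) (a ∷ S) []

      private
        +≢- : ∀ {s} → s ≡ Sign.+ → s ≢ Sign.-
        +≢- refl ()

      cut-length : ∀ {S L U} → Cut S L U → length L + length U ≡ length S
      cut-length []           = refl
      cut-length (Λ-lo _ c)   = cong suc (cut-length c)
      cut-length (Λ-hi _)     = refl
      cut-length {L = L} (V-hi {U = U} _ c) = trans (ℕₚ.+-suc (length L) (length U)) (cong suc (cut-length c))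
      cut-length (V-lo _)     = ℕₚ.+-identityʳ _

      private
        cut-bound : ∀ {S L U} → Cut S L U → length L ℕ.≤ length S
        cut-bound {L = L} c = subst (length L ℕ.≤_) (cut-length c) (ℕₚ.m≤m+n _ _)

      cut-unique : ∀ {S L U L′ U′} → Cut S L U → Cut S L′ U′ → length L ≡ length L′ → L ≡ L′ × U ≡ U′
      cut-unique []         []          _  = refl , refl
      cut-unique (Λ-lo e c) (Λ-lo _ c′) eq = let (p , q) = cut-unique c c′ (ℕₚ.suc-injective eq) in cong (_ ∷_) p , q
      cut-unique (Λ-lo e c) (Λ-hi _)    ()
      cut-unique (Λ-lo e c) (V-hi e′ _) _  = ⊥-elim (+≢- e e′)
      cut-unique (Λ-lo e c) (V-lo e′)   _  = ⊥-elim (+≢- e e′)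
      cut-unique (Λ-hi e)   (Λ-lo _ _)  ()
      cut-unique (Λ-hi e)   (Λ-hi _)    _  = refl , refl
      cut-unique (Λ-hi e)   (V-hi e′ _) _  = ⊥-elim (+≢- e e′)
      cut-unique (Λ-hi e)   (V-lo e′)   _  = ⊥-elim (+≢- e e′)
      cut-unique (V-hi e c) (V-hi _ c′) eq = let (p , q) = cut-unique c c′ eq in p , cong (_ ∷_) q
      cut-unique (V-hi e c) (V-lo _)    eq = ⊥-elim (ℕₚ.1+n≰n (subst (ℕ._≤ _) eq (cut-bound c)))
      cut-unique (V-hi e c) (Λ-lo e′ _) _  = ⊥-elim (+≢- e′ e)
      cut-unique (V-hi e c) (Λ-hi e′)   _  = ⊥-elim (+≢- e′ e)
      cut-unique (V-lo e)   (V-lo _)    _  = refl , refl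
      cut-unique (V-lo e)   (V-hi _ c)  eq = ⊥-elim (ℕₚ.1+n≰n (subst (ℕ._≤ _) (sym eq) (cut-bound c)))
      cut-unique (V-lo e)   (Λ-lo e′ _) _  = ⊥-elim (+≢- e′ e)
      cut-unique (V-lo e)   (Λ-hi e′)   _  = ⊥-elim (+≢- e′ e)

      cut-exists : ∀ S k → k ℕ.≤ length S → ∃[ L ] ∃[ U ] Cut S L U × length L ≡ k
      cut-exists [] zero p = [] , [] , [] , refl
      cut-exists (a ∷ S) k p with ε a in eq
      cut-exists (a ∷ S) zero p          | Sign.+ = [] , a ∷ S , Λ-hi eq , refl
      cut-exists (a ∷ S) (suc k) (s≤s p) | Sign.+ =
        let (L , U , c , q) = cut-exists S k p in a ∷ L , U , Λ-lo eq c , cong suc q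
      cut-exists (a ∷ S) k p | Sign.- with ℕₚ.m≤n⇒m<n∨m≡n p
      ... | inj₁ (s≤s q) = let (L , U , c , r) = cut-exists S k q in L , a ∷ U , V-hi eq c , r
      ... | inj₂ refl    = a ∷ S , [] , V-lo eq , refl

      cut-∈ : ∀ {S L U} → Cut S L U → ∀ {q} → q ∈ S → q ∈ L ⊎ q ∈ U
      cut-∈ (Λ-lo _ c) (here e)  = inj₁ (here e)
      cut-∈ (Λ-lo _ c) (there p) = Sum.map₁ there (cut-∈ c p)
      cut-∈ (Λ-hi _)   p         = inj₂ p
      cut-∈ (V-hi _ c) (here e)  = inj₂ (here e)
      cut-∈ (V-hi _ c) (there p) = Sum.map₂ there (cut-∈ c p)
      cut-∈ (V-lo _)   p         = inj₁ p

      cut-L : ∀ {S L U} → Cut S L U → ∀ {q} → q ∈ L → q ∈ S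
      cut-L (Λ-lo _ c) (here e)  = here e
      cut-L (Λ-lo _ c) (there p) = there (cut-L c p)
      cut-L (V-hi _ c) p         = there (cut-L c p)
      cut-L (V-lo _)   p         = p

      cut-U : ∀ {S L U} → Cut S L U → ∀ {q} → q ∈ U → q ∈ S
      cut-U (Λ-lo _ c) p         = there (cut-U c p)
      cut-U (Λ-hi _)   p         = p
      cut-U (V-hi _ c) (here e)  = here e
      cut-U (V-hi _ c) (there p) = there (cut-U c p)

      cut-descending : ∀ {S L U} → Cut S L U → Descending S → Descending L × Descending U
      cut-descending []         _        = [] , []
      cut-descending (Λ-lo _ c) (p ∷ ps) = let (a , b) = cut-descending c ps in
        All.tabulate (λ q → All.lookup p (cut-L c q)) ∷ a , b
      cut-descending (Λ-hi _)   ps       = [] , ps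
      cut-descending (V-hi _ c) (p ∷ ps) = let (a , b) = cut-descending c ps in
        a , All.tabulate (λ q → All.lookup p (cut-U c q)) ∷ b
      cut-descending (V-lo _)   ps       = ps , []

      cut-disjoint : ∀ {S L U} → Cut S L U → Descending S → ∀ {q} → q ∈ L → q ∉ U
      cut-disjoint (Λ-lo _ c) (p ∷ ps) (here refl) r = ℕₚ.<-irrefl refl (All.lookup p (cut-U c r))
      cut-disjoint (Λ-lo _ c) (p ∷ ps) (there q)   r = cut-disjoint c ps q r
      cut-disjoint (V-hi _ c) (p ∷ ps) q (here refl) = ℕₚ.<-irrefl refl (All.lookup p (cut-L c q))
      cut-disjoint (V-hi _ c) (p ∷ ps) q (there r)   = cut-disjoint c ps q r

      -- All of `L` precedes `p` in the order that defines cuts, and only Λ-nodes further to the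
      -- right precede a Λ-node.
      cut-Λ : ∀ {S L U} → Cut S L U → Descending S → ∀ {p q} → p ∈ U → ε p ≡ Sign.+ → q ∈ L → p Fin.< q
      cut-Λ (Λ-lo _ c) (x ∷ xs) p e (here refl) = All.lookup x (cut-U c p)
      cut-Λ (Λ-lo _ c) (x ∷ xs) p e (there q)   = cut-Λ c xs p e q
      cut-Λ (V-hi e′ c) (x ∷ xs) (here refl) e q = ⊥-elim (+≢- e e′)
      cut-Λ (V-hi _ c) (x ∷ xs) (there p) e q   = cut-Λ c xs p e q

      cut-V : ∀ {S L U} → Cut S L U → Descending S → ∀ {p q} → p ∈ U → q ∈ L → ε q ≡ Sign.- → q Fin.< p
      cut-V (Λ-lo e′ c) (x ∷ xs) p (here refl) e = ⊥-elim (+≢- e′ e)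
      cut-V (Λ-lo _ c) (x ∷ xs) p (there q) e   = cut-V c xs p q e
      cut-V (V-hi _ c) (x ∷ xs) (here refl) q e = All.lookup x (cut-L c q)
      cut-V (V-hi _ c) (x ∷ xs) (there p) q e   = cut-V c xs p q e

      -- Code t S o: the binary tree t encodes the linear order o (listed from the
      -- lowest to the highest node) of the nodes S.
      data Code : Tree → List (Fin n) → List (Fin n) → Set where
        leaf : Code leaf [] []
        node : ∀ {m S L U l r o₁ o₂} → Cut S L U → Code l L o₁ → Code r U o₂ → Code (node l r) (m ∷ S) (o₁ ++ m ∷ o₂)

      code-size : ∀ {t S o} → Code t S o → size t ≡ length S
      code-size leaf         = refl
      code-size (node c p q) = cong suc (trans (cong₂ _+_ (code-size p) (code-size q)) (cut-length c))

      -- The left subtree has as many nodes as `L`, and an initial segment is known from its length.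
      code-unique : ∀ {t S o o′} → Code t S o → Code t S o′ → o ≡ o′
      code-unique leaf leaf = refl
      code-unique (node c p q) (node c′ p′ q′)
        with cut-unique c c′ (trans (sym (code-size p)) (code-size p′))
      ... | refl , refl = cong₂ (λ a b → a ++ _ ∷ b) (code-unique p p′) (code-unique q q′)

      code-exists : ∀ t S → size t ≡ length S → ∃[ o ] Code t S o
      code-exists leaf       []      _  = [] , leaf
      code-exists (node l r) (m ∷ S) eq =
        let eq′ = ℕₚ.suc-injective eq
            (L , U , c , p) = cut-exists S (size l) (subst (size l ℕ.≤_) eq′ (ℕₚ.m≤m+n _ _))
            q = ℕₚ.+-cancelˡ-≡ (length L) (size r) (length U)
                  (trans (cong (_+ size r) p) (trans eq′ (sym (cut-length c))))
            (o₁ , a) = code-exists l L (sym p)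
            (o₂ , b) = code-exists r U q
        in o₁ ++ m ∷ o₂ , node c a b

      code-∈ : ∀ {t S o} → Code t S o → ∀ {q} → q ∈ S → q ∈ o
      code-∈ (node {o₁ = o₁} c p q) (here refl) = ∈ₚ.∈-++⁺ʳ o₁ (here refl)
      code-∈ (node {o₁ = o₁} c p q) (there r) with cut-∈ c r
      ... | inj₁ s = ∈ₚ.∈-++⁺ˡ (code-∈ p s)
      ... | inj₂ s = ∈ₚ.∈-++⁺ʳ o₁ (there (code-∈ q s))

      code-∈⁻ : ∀ {t S o} → Code t S o → ∀ {q} → q ∈ o → q ∈ S
      code-∈⁻ (node {o₁ = o₁} c p q) r with ∈ₚ.∈-++⁻ o₁ r
      ... | inj₁ s         = there (cut-L c (code-∈⁻ p s))
      ... | inj₂ (here e)  = here e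
      ... | inj₂ (there s) = there (cut-U c (code-∈⁻ q s))

      code-length : ∀ {t S o} → Code t S o → length o ≡ length S
      code-length leaf = refl
      code-length (node {o₁ = o₁} {o₂} c p q) = trans (Listₚ.length-++ o₁)
        (trans (ℕₚ.+-suc (length o₁) (length o₂)) (cong suc (trans (cong₂ _+_ (code-length p) (code-length q)) (cut-length c))))

      private
        AllPairs-++⁺ : ∀ {R : Fin n → Fin n → Set} xs {ys} → AllPairs R xs → AllPairs R ys →
                       (∀ {x y} → x ∈ xs → y ∈ ys → R x y) → AllPairs R (xs ++ ys)
        AllPairs-++⁺ []       ps       qs f = qs
        AllPairs-++⁺ (x ∷ xs) (p ∷ ps) qs f =
          Allₚ.++⁺ p (All.tabulate (λ q → f (here refl) q)) ∷ AllPairs-++⁺ xs ps qs (λ a b → f (there a) b)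

      code-distinct : ∀ {t S o} → Code t S o → Descending S → AllPairs _≢_ o
      code-distinct leaf _ = []
      code-distinct (node {m} {S} {o₁ = o₁} {o₂} c p q) (x ∷ xs) =
        let (dl , du) = cut-descending c xs in
        AllPairs-++⁺ o₁ (code-distinct p dl)
          (All.tabulate (λ r eq → m∉ (cut-U c (code-∈⁻ q (subst (_∈ o₂) (sym eq) r)))) ∷ code-distinct q du)
          (λ { r (here refl) refl → m∉ (cut-L c (code-∈⁻ p r))
             ; r (there s) refl → cut-disjoint c xs (code-∈⁻ p r) (code-∈⁻ q s) })
        where
        m∉ : m ∉ S
        m∉ p = ℕₚ.<-irrefl refl (All.lookup x p)

  module Fitting {n : ℕ} (ε : Fin n → Sign) {A}
    (C : Cobinary {Fin n} A Fin._<_ (λ i → ε i ≡ Sign.+) (λ i → ε i ≡ Sign.-))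
    (conn : ∀ i j → Path A i j) where
    open Cobinary C
    open Structure C
    open Cuts ε

    Down Up : Fin n → Fin n → Set
    Down m q = ∃[ c ] A m c × c ≺ m × Walk A m c q
    Up   m q = ∃[ c ] A m c × m ≺ c × Walk A m c q

    direction : ∀ {m q} → m ≢ q → Down m q ⊎ Up m q
    direction {m} {q} ne with conn m q
    ... | here = ⊥-elim (ne refl)
    ... | go a W with oriented a
    ...   | inj₁ p = inj₂ (_ , a , p , W)
    ...   | inj₂ p = inj₁ (_ , a , p , W)

    exclusive : ∀ {m q} → Down m q → ¬ Up m q
    exclusive (c , a , p , W) (d , b , q , X) with first-unique a W b X
    ... | refl = ≺-asym p q

    private
      snoc : ∀ {w u z j} → A w u → Walk A w u z → A z j → Walk A w u j ⊎ (u ≡ z × j ≡ w)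
      snoc {w} {j = j} a stop e with j ≟ w
      ... | yes eq = inj₂ (refl , eq)
      ... | no ne  = inj₁ (step e ne stop)
      snoc a (step b ne W) e with snoc b W e
      ... | inj₁ X             = inj₁ (step b ne X)
      ... | inj₂ (refl , refl) = inj₁ stop

    -- One more edge either prolongs the path or removes its last step; in both cases the first step
    -- stays unless `m` itself is reached.
    down-adj : ∀ {m i j} → Down m i → A i j → j ≢ m → Down m j
    down-adj (c , a , p , W) e ne with snoc a W e
    ... | inj₁ X        = c , a , p , X
    ... | inj₂ (_ , eq) = ⊥-elim (ne eq)

    -- Fits t S o: Code t S o, where each cut is the one given by the directions in
    -- which the paths of the tree start.
    data Fits : Tree → List (Fin n) → List (Fin n) → Set where
      leaf : Fits leaf [] []
      node : ∀ {m S L U l r o₁ o₂} → Cut S L U → All (Down m) L → All (Up m) U →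
             Fits l L o₁ → Fits r U o₂ → Fits (node l r) (m ∷ S) (o₁ ++ m ∷ o₂)

    fits-code : ∀ {t S o} → Fits t S o → Code t S o
    fits-code leaf             = leaf
    fits-code (node c _ _ p q) = node c (fits-code p) (fits-code q)

    private
      same-cut : ∀ {m S L U L′ U′} → Cut S L U → Cut S L′ U′ → All (Down m) L → All (Up m) U →
                 All (Down m) L′ → All (Up m) U′ → (∀ {q} → q ∈ L → q ∈ L′) × (∀ {q} → q ∈ U → q ∈ U′)
      same-cut c c′ d u d′ u′ =
          (λ q → Sum.[ (λ r → r) , (λ r → ⊥-elim (exclusive (All.lookup d q) (All.lookup u′ r))) ] (cut-∈ c′ (cut-L c q)))
        , (λ q → Sum.[ (λ r → ⊥-elim (exclusive (All.lookup d′ r) (All.lookup u q))) , (λ r → r) ] (cut-∈ c′ (cut-U c q)))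

      descending-ext : ∀ {xs ys : List (Fin n)} → Descending xs → Descending ys →
                       (∀ {q} → q ∈ xs → q ∈ ys) → (∀ {q} → q ∈ ys → q ∈ xs) → xs ≡ ys
      descending-ext [] [] f g = refl
      descending-ext [] (_ ∷ _) f g with () ← g (here refl)
      descending-ext (_ ∷ _) [] f g with () ← f (here refl)
      descending-ext {x ∷ xs} {y ∷ ys} (p ∷ ps) (q ∷ qs) f g with f (here refl) | g (here refl)
      ... | there a | there b = ⊥-elim (ℕₚ.<-asym (All.lookup q a) (All.lookup p b))
      ... | here refl | _ = cong (x ∷_) (descending-ext ps qs (tail p f) (tail q g))
        where
        tail : ∀ {xs ys} → All (Fin._< x) xs → (∀ {q} → q ∈ x ∷ xs → q ∈ x ∷ ys) → ∀ {q} → q ∈ xs → q ∈ ys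
        tail p f a with f (there a)
        ... | here refl = ⊥-elim (ℕₚ.<-irrefl refl (All.lookup p a))
        ... | there b   = b
      ... | there _ | here refl = cong (x ∷_) (descending-ext ps qs (tail p f) (tail q g))
        where
        tail : ∀ {xs ys} → All (Fin._< x) xs → (∀ {q} → q ∈ x ∷ xs → q ∈ x ∷ ys) → ∀ {q} → q ∈ xs → q ∈ ys
        tail p f a with f (there a)
        ... | here refl = ⊥-elim (ℕₚ.<-irrefl refl (All.lookup p a))
        ... | there b   = b

    -- The tree fixes the direction from `m` to every node, so both cuts have the same members, and
    -- a descending list is determined by its members.
    fits-unique : ∀ {t t′ S o o′} → Descending S → Fits t S o → Fits t′ S o′ → t ≡ t′
    fits-unique _ leaf leaf = refl
    fits-unique (_ ∷ ds) (node c d u p q) (node c′ d′ u′ p′ q′)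
      with cut-descending c ds | cut-descending c′ ds | same-cut c c′ d u d′ u′ | same-cut c′ c d′ u′ d u
    ... | dl , du | dl′ , du′ | f , g | f′ , g′ with descending-ext dl dl′ f f′ | descending-ext du du′ g g′
    ...   | refl | refl = cong₂ node (fits-unique dl p p′) (fits-unique du q q′)

    -- No edge joins `L` to `U`, because adjacent nodes other than `m` lie in the same direction
    -- from `m`. So an edge either ends at `m` or is handled inside one of the two parts.
    fits-rising : ∀ {t S o} → Fits t S o → ∀ {i j} → i ∈ S → j ∈ S → A i j → i ≺ j → position o i ℕ.< position o j
    fits-rising (node {m} {S} {L} {U} {o₁ = o₁} {o₂} c d u p q) = by
      where
      lower : ∀ {i} → i ∈ L → position (o₁ ++ m ∷ o₂) i ≡ position o₁ i
      lower i∈ = position-++ˡ (m ∷ o₂) (code-∈ (fits-code p) i∈)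

      lower-< : ∀ {i} → i ∈ L → position (o₁ ++ m ∷ o₂) i ℕ.< length o₁
      lower-< i∈ = subst (ℕ._< length o₁) (sym (lower i∈)) (position-< (code-∈ (fits-code p) i∈))

      m∉o₁ : m ∉ o₁
      m∉o₁ r = let (_ , a , _ , W) = All.lookup d (code-∈⁻ (fits-code p) r) in not-closed a W

      middle : position (o₁ ++ m ∷ o₂) m ≡ length o₁
      middle = trans (position-++ʳ (m ∷ o₂) m∉o₁) (trans (cong (length o₁ +_) (position-here m o₂)) (ℕₚ.+-identityʳ _))

      upper : ∀ {i} → i ∈ U → position (o₁ ++ m ∷ o₂) i ≡ length o₁ + suc (position o₂ i)
      upper i∈ = trans (position-++ʳ (m ∷ o₂) (λ r → exclusive (All.lookup d (code-∈⁻ (fits-code p) r)) (All.lookup u i∈)))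
        (cong (length o₁ +_) (position-there o₂ (λ { refl → let (_ , a , _ , W) = All.lookup u i∈ in not-closed a W })))

      place : ∀ {i} → i ∈ m ∷ S → i ≡ m ⊎ i ∈ L ⊎ i ∈ U
      place (here e)  = inj₁ e
      place (there r) = inj₂ (cut-∈ c r)

      not-m : ∀ {i} → Up m i → i ≢ m
      not-m (_ , a , _ , W) refl = not-closed a W

      by : ∀ {i j} → i ∈ m ∷ S → j ∈ m ∷ S → A i j → i ≺ j → position (o₁ ++ m ∷ o₂) i ℕ.< position (o₁ ++ m ∷ o₂) j
      by i∈ j∈ a r with place i∈ | place j∈
      ... | inj₁ refl | inj₁ refl = ⊥-elim (≺-irrefl r)
      ... | inj₁ refl | inj₂ (inj₁ j∈L) = ⊥-elim (exclusive (All.lookup d j∈L) (_ , a , r , stop))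
      ... | inj₁ refl | inj₂ (inj₂ j∈U) = ≡.subst₂ ℕ._<_ (sym middle) (sym (upper j∈U)) (ℕₚ.m<m+n _ (s≤s z≤n))
      ... | inj₂ (inj₁ i∈L) | inj₁ refl = subst (position (o₁ ++ m ∷ o₂) _ ℕ.<_) (sym middle) (lower-< i∈L)
      ... | inj₂ (inj₂ i∈U) | inj₁ refl = ⊥-elim (exclusive (_ , A-sym a , r , stop) (All.lookup u i∈U))
      ... | inj₂ (inj₁ i∈L) | inj₂ (inj₁ j∈L) = ≡.subst₂ ℕ._<_ (sym (lower i∈L)) (sym (lower j∈L)) (fits-rising p i∈L j∈L a r)
      ... | inj₂ (inj₁ i∈L) | inj₂ (inj₂ j∈U) =
        ⊥-elim (exclusive (down-adj (All.lookup d i∈L) a (not-m (All.lookup u j∈U))) (All.lookup u j∈U))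
      ... | inj₂ (inj₂ i∈U) | inj₂ (inj₁ j∈L) =
        ⊥-elim (exclusive (down-adj (All.lookup d j∈L) (A-sym a) (not-m (All.lookup u i∈U))) (All.lookup u i∈U))
      ... | inj₂ (inj₂ i∈U) | inj₂ (inj₂ j∈U) = ≡.subst₂ ℕ._<_ (sym (upper i∈U)) (sym (upper j∈U))
        (ℕₚ.+-monoʳ-< (length o₁) (s≤s (fits-rising q i∈U j∈U a r)))

    private
      -- If a chain rises from `m` to `p`, the path from `m` to `q` starts on the right of the wall
      -- below `p` and stays there. Otherwise the path to `p` turns at a Λ-node `v` between `p` and
      -- `m`, and the wall below `v` keeps `q` on the right of `v`.
      beyond-Λ : ∀ {m p q} → p Fin.< m → ε p ≡ Sign.+ → Up m p → Down m q → p Fin.< q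
      beyond-Λ p<m Λp (c , a , m≺c , W) (d , b , d≺m , X) with up-fate a m≺c W
      ... | up ch                        = descend-right Λp a m≺c ch p<m (step b (λ { refl → ≺-asym d≺m m≺c }) X)
      ... | top v ch Λv (inj₁ (r , _ , s)) = ⊥-elim (ℕₚ.<-asym p<m (ℕₚ.<-trans r s))
      ... | top v ch Λv (inj₂ (r , _ , s)) = ℕₚ.<-trans s (descend-right Λv a m≺c ch r (step b (λ { refl → ≺-asym d≺m m≺c }) X))

      beyond-V : ∀ {m p q} → q Fin.< m → ε q ≡ Sign.- → Down m q → Up m p → q Fin.< p
      beyond-V q<m Vq (c , a , c≺m , W) (d , b , m≺d , X) with down-fate a c≺m W
      ... | down ch                      = ascend-right Vq (A-sym a) c≺m ch q<m (step b (λ { refl → ≺-asym m≺d c≺m }) X)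
      ... | bot v ch Vv (inj₁ (r , _ , s)) = ⊥-elim (ℕₚ.<-asym q<m (ℕₚ.<-trans r s))
      ... | bot v ch Vv (inj₂ (r , _ , s)) = ℕₚ.<-trans s (ascend-right Vv (A-sym a) c≺m ch r (step b (λ { refl → ≺-asym m≺d c≺m }) X))

      -- If the rightmost node of `S` is a Λ-node in the upper direction, a node in the lower
      -- direction would lie further right by `beyond-Λ`, so there is none; `beyond-V` treats a
      -- V-node in the lower direction. In the remaining cases the node joins the cut of the tail.
      cut-by-direction : ∀ {m S} → All (Fin._< m) S → Descending S →
                         ∃[ L ] ∃[ U ] Cut S L U × All (Down m) L × All (Up m) U
      cut-by-direction [] [] = [] , [] , [] , [] , []
      cut-by-direction {m} {a ∷ S} (a<m ∷ S<m) (S<a ∷ ds)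
        with ε a in eq | direction (λ e → ℕₚ.<-irrefl (cong Fin.toℕ (sym e)) a<m) | cut-by-direction S<m ds
      ... | Sign.+ | inj₁ dn | L , U , c , d , u = a ∷ L , U , Λ-lo eq c , dn ∷ d , u
      ... | Sign.+ | inj₂ u′ | _ = [] , a ∷ S , Λ-hi eq , [] , u′ ∷ All.tabulate (λ {q} q∈ →
            Sum.[ (λ dn → ⊥-elim (ℕₚ.<-asym (All.lookup S<a q∈) (beyond-Λ a<m eq u′ dn))) , (λ r → r) ]
              (direction (λ e → ℕₚ.<-irrefl (cong Fin.toℕ (sym e)) (All.lookup S<m q∈))))
      ... | Sign.- | inj₂ u′ | L , U , c , d , u = L , a ∷ U , V-hi eq c , d , u′ ∷ u
      ... | Sign.- | inj₁ dn | _ = a ∷ S , [] , V-lo eq , dn ∷ All.tabulate (λ {q} q∈ →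
            Sum.[ (λ r → r) , (λ u′ → ⊥-elim (ℕₚ.<-asym (All.lookup S<a q∈) (beyond-V a<m eq dn u′))) ]
              (direction (λ e → ℕₚ.<-irrefl (cong Fin.toℕ (sym e)) (All.lookup S<m q∈)))) , []

      fits-bounded : ∀ k S → length S ℕ.≤ k → Descending S → ∃[ t ] ∃[ o ] Fits t S o
      fits-bounded k []      _ _ = leaf , [] , leaf
      fits-bounded (suc k) (m ∷ S) (s≤s b) (S<m ∷ ds) =
        let (L , U , c , d , u) = cut-by-direction S<m ds
            (dl , du) = cut-descending c ds
            (l , o₁ , p) = fits-bounded k L (ℕₚ.≤-trans (subst (length L ℕ.≤_) (cut-length c) (ℕₚ.m≤m+n _ _)) b) dl
            (r , o₂ , q) = fits-bounded k U (ℕₚ.≤-trans (subst (length U ℕ.≤_) (cut-length c) (ℕₚ.m≤n+m _ _)) b) du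
        in node l r , o₁ ++ m ∷ o₂ , node c d u p q

    fits-exists : ∀ {S} → Descending S → ∃[ t ] ∃[ o ] Fits t S o
    fits-exists {S} = fits-bounded (length S) S ℕₚ.≤-refl

    Turn : Fin n → Fin n → Fin n → Set
    Turn i m z = Between i m z × ((ε m ≡ Sign.+ × i ⊑ m) ⊎ (ε m ≡ Sign.- × m ⊑ i))

    -- In the recursion `S` is no longer the set of all nodes. This condition keeps in `S` the
    -- turning points met on paths between its members, and it passes to both parts of a cut.
    TurnClosed : List (Fin n) → Set
    TurnClosed S = ∀ {i m z} → i ∈ S → z ∈ S → Turn i m z → m ∈ S

    module _ (x : Fin n → ℕ) (mono : MonotoneFor (λ i j → x i ℕ.< x j)) where

      private
        ⊑-≤ : ∀ {i j} → i ⊑ j → x i ℕ.≤ x j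
        ⊑-≤ done       = ℕₚ.≤-refl
        ⊑-≤ (up a p c) = ℕₚ.≤-trans (ℕₚ.<⇒≤ (mono a p)) (⊑-≤ c)

        between-swap : ∀ {m i c z} → Separates m i c z → Between i m z
        between-swap (inj₁ (p , _ , q)) = inj₁ (p , q)
        between-swap (inj₂ (p , _ , q)) = inj₂ (q , p)

        outside : ∀ {i m z} → m Fin.< i → m Fin.< z → ¬ Between i m z
        outside p q (inj₁ (r , _)) = ℕₚ.<-asym p r
        outside p q (inj₂ (r , _)) = ℕₚ.<-asym q r

        outside′ : ∀ {i m z} → i Fin.< m → z Fin.< m → ¬ Between i m z
        outside′ p q (inj₁ (_ , r)) = ℕₚ.<-asym q r
        outside′ p q (inj₂ (_ , r)) = ℕₚ.<-asym p r

      -- When `x` extends the tree order, an abstract cut is forced to follow the directions. A node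
      -- of `L` in the upper direction would be above `m` or behind a Λ-node `v` above `m`; then `v`
      -- is in `U` and to the right of that node, against `cut-Λ`. The argument for `U` is dual.
      code-fits : ∀ {t S o} → Code t S o → Descending S → TurnClosed S → AllPairs (λ i j → x i ℕ.< x j) o → Fits t S o
      code-fits leaf _ _ _ = leaf
      code-fits (node {m} {S} {L} {U} {o₁ = o₁} {o₂} c p q) (S<m ∷ ds) closed sorted =
        node c (All.tabulate L-down) (All.tabulate U-up) (code-fits p dl L-closed (proj₁ parts))
               (code-fits q du U-closed (AllPairs.tail (proj₁ (proj₂ parts))))
        where
        dl = proj₁ (cut-descending c ds)
        du = proj₂ (cut-descending c ds)
        parts : AllPairs (λ i j → x i ℕ.< x j) o₁ × AllPairs (λ i j → x i ℕ.< x j) (m ∷ o₂) × All (λ i → All (λ j → x i ℕ.< x j) (m ∷ o₂)) o₁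
        parts = AllPairs-++⁻ o₁ sorted
        L<m : ∀ {i} → i ∈ L → x i ℕ.< x m
        L<m i∈ = All.lookup (All.lookup (proj₂ (proj₂ parts)) (code-∈ p i∈)) (here refl)
        m<U : ∀ {i} → i ∈ U → x m ℕ.< x i
        m<U i∈ = All.lookup (AllPairs.head (proj₁ (proj₂ parts))) (code-∈ q i∈)
        L-right : ∀ {i} → i ∈ L → i Fin.< m
        L-right i∈ = All.lookup S<m (cut-L c i∈)
        U-right : ∀ {i} → i ∈ U → i Fin.< m
        U-right i∈ = All.lookup S<m (cut-U c i∈)
        ≢m : ∀ {i} → i Fin.< m → m ≢ i
        ≢m r refl = ℕₚ.<-irrefl refl r

        in-S : ∀ {v} → v ∈ m ∷ S → v Fin.< m → v ∈ L ⊎ v ∈ U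
        in-S (here refl) r = ⊥-elim (ℕₚ.<-irrefl refl r)
        in-S (there s)   _ = cut-∈ c s

        turn-left : ∀ {i v} → i Fin.< m → Between m v i → v Fin.< m
        turn-left r (inj₁ (s , t)) = ⊥-elim (ℕₚ.<-asym r (ℕₚ.<-trans s t))
        turn-left r (inj₂ (s , t)) = t

        turn-beyond : ∀ {i v} → i Fin.< m → Between m v i → i Fin.< v
        turn-beyond r (inj₁ (s , t)) = ⊥-elim (ℕₚ.<-asym r (ℕₚ.<-trans s t))
        turn-beyond r (inj₂ (s , t)) = s

        L-down : ∀ {i} → i ∈ L → Down m i
        L-down {i} i∈ with direction (≢m (L-right i∈))
        ... | inj₁ d = d
        ... | inj₂ (k , a , r , W) with up-fate a r W
        ...   | up ch = ⊥-elim (ℕₚ.<-asym (L<m i∈) (ℕₚ.<-≤-trans (mono a r) (⊑-≤ ch)))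
        ...   | top v ch Λv sp with between-swap sp
        ...     | btw with in-S (closed (here refl) (there (cut-L c i∈)) (btw , inj₁ (Λv , up a r ch))) (turn-left (L-right i∈) btw)
        ...       | inj₁ v∈L = ⊥-elim (ℕₚ.<-asym (L<m v∈L) (ℕₚ.<-≤-trans (mono a r) (⊑-≤ ch)))
        ...       | inj₂ v∈U = ⊥-elim (ℕₚ.<-asym (cut-Λ c ds v∈U Λv i∈) (turn-beyond (L-right i∈) btw))

        U-up : ∀ {i} → i ∈ U → Up m i
        U-up {i} i∈ with direction (≢m (U-right i∈))
        ... | inj₂ d = d
        ... | inj₁ (k , a , r , W) with down-fate a r W
        ...   | down ch = ⊥-elim (ℕₚ.<-asym (m<U i∈) (ℕₚ.≤-<-trans (⊑-≤ ch) (mono (A-sym a) r)))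
        ...   | bot v ch Vv sp with between-swap sp
        ...     | btw with in-S (closed (here refl) (there (cut-U c i∈)) (btw , inj₂ (Vv , ⊑-snoc ch (A-sym a) r))) (turn-left (U-right i∈) btw)
        ...       | inj₂ v∈U = ⊥-elim (ℕₚ.<-asym (m<U v∈U) (ℕₚ.≤-<-trans (⊑-≤ ch) (mono (A-sym a) r)))
        ...       | inj₁ v∈L = ⊥-elim (ℕₚ.<-asym (cut-V c ds i∈ v∈L Vv) (turn-beyond (U-right i∈) btw))

        -- A turn that fell into `U` would, as a Λ-node, lie to the left of both ends and not
        -- between them; as a V-node, it would be below an element of `L` in the tree order.
        L-closed : TurnClosed L
        L-closed i∈ z∈ (btw , t) with closed (there (cut-L c i∈)) (there (cut-L c z∈)) (btw , t)
        ... | here refl = ⊥-elim (outside′ (L-right i∈) (L-right z∈) btw)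
        ... | there s with cut-∈ c s
        ...   | inj₁ r = r
        ...   | inj₂ r with t
        ...     | inj₁ (Λm , _)  = ⊥-elim (outside (cut-Λ c ds r Λm i∈) (cut-Λ c ds r Λm z∈) btw)
        ...     | inj₂ (_ , ch)  = ⊥-elim (ℕₚ.<⇒≱ (ℕₚ.<-trans (L<m i∈) (m<U r)) (⊑-≤ ch))

        U-closed : TurnClosed U
        U-closed i∈ z∈ (btw , t) with closed (there (cut-U c i∈)) (there (cut-U c z∈)) (btw , t)
        ... | here refl = ⊥-elim (outside′ (U-right i∈) (U-right z∈) btw)
        ... | there s with cut-∈ c s
        ...   | inj₂ r = r
        ...   | inj₁ r with t
        ...     | inj₁ (_ , ch)  = ⊥-elim (ℕₚ.<⇒≱ (ℕₚ.<-trans (L<m r) (m<U i∈)) (⊑-≤ ch))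
        ...     | inj₂ (Vm , _)  = ⊥-elim (outside (cut-V c ds i∈ r Vm) (cut-V c ds z∈ r Vm) btw)

-- Counting binary trees by ballot numbers

module CatalanNumbers where

  open import Defs using (catalan)
  open LinearOrders
  open import Data.Nat.Base using (_+_; _*_; _≤_)
  open import Data.Nat.Combinatorics using (_C_; nCk+nC[k+1]≡[n+1]C[k+1]; nCk≡nC[n∸k]; nC1≡n; k>n⇒nCk≡0)
  open import Data.Nat.DivMod using (_/_; m*n/n≡m)
  open import Data.Nat.Solver using (module +-*-Solver)
  open import Data.Vec.Base as Vec using (Vec; []; _∷_)
  import Data.Vec.Properties as Vecₚ
  open import Relation.Binary.PropositionalEquality

  graft : ∀ {k} → Vec Tree (suc (suc k)) → Vec Tree (suc k)
  graft (l ∷ r ∷ f) = node l r ∷ f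

  -- The first tree of a forest is a leaf, or removing its root leaves a forest with one more tree.
  -- Passing from trees to forests replaces the convolution of the Catalan recursion by a sum of two
  -- terms.
  forests : ∀ k (n : ℕ) → List (Vec Tree k)
  forests zero    zero    = [] ∷ []
  forests zero    (suc n) = []
  forests (suc k) zero    = map (leaf ∷_) (forests k zero)
  forests (suc k) (suc n) = map (leaf ∷_) (forests k (suc n)) ++ map graft (forests (suc (suc k)) n)

  total : ∀ {k} → Vec Tree k → ℕ
  total []      = 0
  total (t ∷ f) = size t + total f

  ∈-forests : ∀ {k} (f : Vec Tree k) {n} → total f ≡ n → f ∈ forests k n
  ∈-forests f {n} = by _ n f
    where
    by : ∀ k n (f : Vec Tree k) → total f ≡ n → f ∈ forests k n
    by zero    zero    []               eq = here refl
    by zero    (suc n) []               ()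
    by (suc k) zero    (leaf ∷ f)       eq = ∈ₚ.∈-map⁺ (leaf ∷_) (by k zero f eq)
    by (suc k) zero    (node l r ∷ f)   ()
    by (suc k) (suc n) (leaf ∷ f)       eq = ∈ₚ.∈-++⁺ˡ (∈ₚ.∈-map⁺ (leaf ∷_) (by k (suc n) f eq))
    by (suc k) (suc n) (node l r ∷ f)   eq = ∈ₚ.∈-++⁺ʳ (map (leaf ∷_) (forests k (suc n)))
      (∈ₚ.∈-map⁺ graft (by (suc (suc k)) n (l ∷ r ∷ f) (trans (sym (ℕₚ.+-assoc (size l) (size r) (total f))) (ℕₚ.suc-injective eq))))

  forests-total : ∀ k n {f} → f ∈ forests k n → total f ≡ n
  forests-total zero    zero    (here refl) = refl
  forests-total (suc k) zero    p = by (forests-total k zero) p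
    where
    by : (∀ {f} → f ∈ forests k zero → total f ≡ zero) → ∀ {f} → f ∈ map (leaf ∷_) (forests k zero) → total f ≡ zero
    by rec p with ∈ₚ.∈-map⁻ (leaf ∷_) p
    ... | f , q , refl = rec q
  forests-total (suc k) (suc n) p =
    by (forests-total k (suc n)) (forests-total (suc (suc k)) n) (∈ₚ.∈-++⁻ (map (leaf ∷_) (forests k (suc n))) p)
    where
    by : (∀ {f} → f ∈ forests k (suc n) → total f ≡ suc n) → (∀ {f} → f ∈ forests (suc (suc k)) n → total f ≡ n) →
         ∀ {f} → f ∈ map (leaf ∷_) (forests k (suc n)) ⊎ f ∈ map graft (forests (suc (suc k)) n) → total f ≡ suc n
    by rec₁ rec₂ (inj₁ q) with ∈ₚ.∈-map⁻ (leaf ∷_) q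
    ... | f , r , refl = rec₁ r
    by rec₁ rec₂ (inj₂ q) with ∈ₚ.∈-map⁻ graft q
    ... | (l ∷ r ∷ f) , s , refl = cong suc (trans (ℕₚ.+-assoc (size l) (size r) (total f)) (rec₂ s))

  graft-injective : ∀ {k} {f g : Vec Tree (suc (suc k))} → graft f ≡ graft g → f ≡ g
  graft-injective {f = _ ∷ _ ∷ _} {g = _ ∷ _ ∷ _} refl = refl

  forests-unique : ∀ k n → Unique (forests k n)
  forests-unique zero    zero    = [] ∷ []
  forests-unique zero    (suc n) = []
  forests-unique (suc k) zero    = Uniqueₚ.map⁺ Vecₚ.∷-injectiveʳ (forests-unique k zero)
  forests-unique (suc k) (suc n) = Uniqueₚ.++⁺ (Uniqueₚ.map⁺ Vecₚ.∷-injectiveʳ (forests-unique k (suc n)))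
    (Uniqueₚ.map⁺ graft-injective (forests-unique (suc (suc k)) n)) disjoint
    where
    disjoint : ∀ {f} → ¬ (f ∈ map (leaf ∷_) (forests k (suc n)) × f ∈ map graft (forests (suc (suc k)) n))
    disjoint (p , q) with ∈ₚ.∈-map⁻ (leaf ∷_) p | ∈ₚ.∈-map⁻ graft q
    ... | _ , _ , refl | (_ ∷ _ ∷ _) , _ , ()

  -- m choose k - 1, which is 0 for k = 0.
  _C⁻_ : ℕ → ℕ → ℕ
  m C⁻ zero  = 0
  m C⁻ suc k = m C k

  private
    pascal : ∀ m k → suc m C suc k ≡ m C k + m C suc k
    pascal m k = sym (nCk+nC[k+1]≡[n+1]C[k+1] m k)

    pascal⁻ : ∀ m k → suc m C⁻ suc k ≡ m C k + m C⁻ k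
    pascal⁻ m zero    = refl
    pascal⁻ m (suc k) = trans (pascal m k) (ℕₚ.+-comm (m C k) (m C suc k))

    forests-step : ∀ k n → length (forests (suc k) (suc n)) ≡ length (forests k (suc n)) + length (forests (suc (suc k)) n)
    forests-step k n = trans (Listₚ.length-++ (map (leaf ∷_) (forests k (suc n))))
      (cong₂ _+_ (Listₚ.length-map _ (forests k (suc n))) (Listₚ.length-map _ (forests (suc (suc k)) n)))

    forests-zero : ∀ k → length (forests k 0) ≡ 1
    forests-zero zero    = refl
    forests-zero (suc k) = trans (Listₚ.length-map _ (forests k 0)) (forests-zero k)

    middle : ∀ n → suc (n + n) C n ≡ suc (n + n) C suc n
    middle n = trans (nCk≡nC[n∸k] (ℕₚ.m≤n⇒m≤1+n (ℕₚ.m≤m+n n n)))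
      (cong (suc (n + n) C_) (trans (ℕₚ.+-∸-assoc 1 (ℕₚ.m≤m+n n n)) (cong suc (ℕₚ.m+n∸m≡n n n))))

    open +-*-Solver

    combine : ∀ {a b c p q r s} → a + p ≡ q → b + r ≡ s → c ≡ a + b → c + (p + r) ≡ q + s
    combine {a} {b} {c} {p} {q} {r} {s} refl refl refl =
      solve 4 (λ a b p r → (a :+ b) :+ (p :+ r) := (a :+ p) :+ (b :+ r)) refl a b p r

  -- The ballot number C(2n + j, n) - C(2n + j, n - 1), without subtraction.
  ballot : ∀ j n → length (forests (suc j) n) + (j + (n + n)) C⁻ n ≡ (j + (n + n)) C n
  ballot j zero = trans (ℕₚ.+-identityʳ _) (forests-zero (suc j))
  -- There is no empty forest with nodes, so only the grafted forests contribute; the symmetry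
  -- `C(2n + 1, n) = C(2n + 1, n + 1)` supplies the binomial missing from Pascal's rule.
  ballot zero (suc n) rewrite ℕₚ.+-suc n n = begin
    length (forests 1 (suc n)) + suc M C n          ≡⟨ cong₂ _+_ (forests-step 0 n) (pascal⁻ M n) ⟩
    length (forests 2 n) + (M C n + M C⁻ n)         ≡⟨ solve 3 (λ a b c → a :+ (b :+ c) := b :+ (a :+ c)) refl (length (forests 2 n)) (M C n) (M C⁻ n) ⟩
    M C n + (length (forests 2 n) + M C⁻ n)         ≡⟨ cong (M C n +_) (trans (ballot 1 n) (middle n)) ⟩
    M C n + M C suc n                               ≡⟨ pascal M n ⟨
    suc M C suc n                                   ∎
    where
    open ≡-Reasoning
    M = suc (n + n)
  -- Pascal's rule for both binomials has the shape of the recursion for forests: one tree fewer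
  -- with the same nodes, or one tree more with one node less.
  ballot (suc j) (suc n) = begin
    length (forests (suc (suc j)) (suc n)) + suc M C n             ≡⟨ cong (length (forests (suc (suc j)) (suc n)) +_) (pascal⁻ M n) ⟩
    length (forests (suc (suc j)) (suc n)) + (M C n + M C⁻ n)      ≡⟨ combine {a = length (forests (suc j) (suc n))} {b = length (forests (suc (suc (suc j))) n)} {p = M C n} {r = M C⁻ n}
                                                                         (ballot j (suc n)) second (forests-step (suc j) n) ⟩
    M C suc n + M C n                                              ≡⟨ ℕₚ.+-comm (M C suc n) (M C n) ⟩
    M C n + M C suc n                                              ≡⟨ pascal M n ⟨
    suc M C suc n                                                  ∎
    where
    open ≡-Reasoning
    M = j + (suc n + suc n)
    second : length (forests (suc (suc (suc j))) n) + M C⁻ n ≡ M C n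
    second = subst (λ m → length (forests (suc (suc (suc j))) n) + m C⁻ n ≡ m C n)
      (solve 2 (λ j n → con 2 :+ j :+ (n :+ n) := j :+ ((con 1 :+ n) :+ (con 1 :+ n))) refl j n)
      (ballot (suc (suc j)) n)

  absorption : ∀ m k → suc k * (suc m C suc k) ≡ suc m * (m C k)
  absorption zero zero = refl
  absorption zero (suc k) = trans (cong (suc (suc k) *_) (k>n⇒nCk≡0 {1} {suc (suc k)} (s≤s (s≤s z≤n))))
    (trans (ℕₚ.*-zeroʳ (suc (suc k))) (sym (trans (ℕₚ.*-identityˡ _) (k>n⇒nCk≡0 {0} {suc k} (s≤s z≤n)))))
  absorption (suc m) zero = trans (ℕₚ.*-identityˡ _) (trans (nC1≡n (suc (suc m))) (sym (ℕₚ.*-identityʳ _)))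
  absorption (suc m) (suc k) = begin
    suc (suc k) * (suc (suc m) C suc (suc k))
      ≡⟨ cong (suc (suc k) *_) (pascal (suc m) (suc k)) ⟩
    suc (suc k) * (suc m C suc k + suc m C suc (suc k))
      ≡⟨ solve 3 (λ k a b → (con 2 :+ k) :* (a :+ b) := (con 1 :+ k) :* a :+ a :+ (con 2 :+ k) :* b) refl k (suc m C suc k) (suc m C suc (suc k)) ⟩
    suc k * (suc m C suc k) + suc m C suc k + suc (suc k) * (suc m C suc (suc k))
      ≡⟨ cong₂ (λ a b → a + suc m C suc k + b) (absorption m k) (absorption m (suc k)) ⟩
    suc m * (m C k) + suc m C suc k + suc m * (m C suc k)
      ≡⟨ solve 4 (λ m a b c → (con 1 :+ m) :* a :+ c :+ (con 1 :+ m) :* b := (con 1 :+ m) :* (a :+ b) :+ c) refl m (m C k) (m C suc k) (suc m C suc k) ⟩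
    suc m * (m C k + m C suc k) + suc m C suc k
      ≡⟨ cong (λ a → suc m * a + suc m C suc k) (pascal m k) ⟨
    suc m * (suc m C suc k) + suc m C suc k
      ≡⟨ ℕₚ.+-comm (suc m * (suc m C suc k)) _ ⟩
    suc (suc m) * (suc m C suc k) ∎
    where open ≡-Reasoning

  private
    -- This turns the difference `F = B - P` given by `ballot` into a quotient:
    -- `(n + 1) F = (n + 1) B - n B = B`. It comes from two uses of `absorption` and the symmetry of
    -- the binomials.
    neighbours-of-middle : ∀ n → suc n * ((n + n) C⁻ n) ≡ n * ((n + n) C n)
    neighbours-of-middle zero = refl
    neighbours-of-middle (suc p) rewrite ℕₚ.+-suc p p = begin
      suc (suc p) * (suc M C p)            ≡⟨ cong (suc (suc p) *_) symmetric ⟩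
      suc (suc p) * (suc M C suc (suc p))  ≡⟨ absorption M (suc p) ⟩
      suc M * (M C suc p)                  ≡⟨ cong (suc M *_) (middle p) ⟨
      suc M * (M C p)                      ≡⟨ absorption M p ⟨
      suc p * (suc M C suc p)              ∎
      where
      open ≡-Reasoning
      M = suc (p + p)
      p≤ : p ≤ suc M
      p≤ = ℕₚ.m≤n⇒m≤1+n (ℕₚ.m≤n⇒m≤1+n (ℕₚ.m≤m+n p p))
      symmetric : suc M C p ≡ suc M C suc (suc p)
      symmetric = trans (nCk≡nC[n∸k] p≤)
        (cong (suc M C_) (trans (ℕₚ.+-∸-assoc 2 (ℕₚ.m≤m+n p p)) (cong (2 +_) (ℕₚ.m+n∸m≡n p p))))

  count-trees : ∀ n → length (forests 1 n) ≡ catalan n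
  count-trees n = sym (begin
    ((2 * n) C n) / suc n       ≡⟨ cong (λ m → (m C n) / suc n) (cong (n +_) (ℕₚ.+-identityʳ n)) ⟩
    ((n + n) C n) / suc n       ≡⟨ cong (_/ suc n) product ⟨
    (F * suc n) / suc n         ≡⟨ m*n/n≡m F (suc n) ⟩
    F                           ∎)
    where
    open ≡-Reasoning
    F = length (forests 1 n)
    B = (n + n) C n
    P = (n + n) C⁻ n
    product : F * suc n ≡ B
    product = ℕₚ.+-cancelʳ-≡ (suc n * P) (F * suc n) B (begin
      F * suc n + suc n * P   ≡⟨ solve 3 (λ f n p → f :* (con 1 :+ n) :+ (con 1 :+ n) :* p := (con 1 :+ n) :* (f :+ p)) refl F n P ⟩
      suc n * (F + P)         ≡⟨ cong (suc n *_) (ballot 0 n) ⟩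
      B + n * B               ≡⟨ cong (B +_) (neighbours-of-middle n) ⟨
      B + suc n * P           ∎)

  trees : ℕ → List Tree
  trees n = map Vec.head (forests 1 n)

  private
    head-injective : ∀ {f g : Vec Tree 1} → Vec.head f ≡ Vec.head g → f ≡ g
    head-injective {_ ∷ []} {_ ∷ []} refl = refl

  trees-unique : ∀ n → Unique (trees n)
  trees-unique n = Uniqueₚ.map⁺ head-injective (forests-unique 1 n)

  trees-length : ∀ n → length (trees n) ≡ catalan n
  trees-length n = trans (Listₚ.length-map Vec.head (forests 1 n)) (count-trees n)

  ∈-trees : ∀ t → t ∈ trees (size t)
  ∈-trees t = ∈ₚ.∈-map⁺ Vec.head (∈-forests (t ∷ []) (ℕₚ.+-identityʳ (size t)))

  trees-size : ∀ {n t} → t ∈ trees n → size t ≡ n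
  trees-size {n} p with ∈ₚ.∈-map⁻ Vec.head p
  ... | (t ∷ []) , q , refl = trans (sym (ℕₚ.+-identityʳ (size t))) (forests-total 1 n q)

-- Covering, representatives and the partition of the sphere

module Classifications where

  open Fields
  open CobinaryCombinatorics
  open OrderCones
  open SimplicialCones
  open TreeAnalysis
  open EdgeCones
  open Isomorphisms
  open Insertions
  open CompletedTrees
  open Realisations
  open LinearOrders hiding (node; leaf)
  open CatalanNumbers hiding (total)
  open import Data.Fin.Base using (opposite; cast)
  open import Data.List.Base using (tabulate; allFin; lookup)
  import Data.List.Relation.Unary.Any.Properties as Anyₚ
  open import Relation.Nullary.Decidable using (_⊎-dec_; _×-dec_)
  open import Relation.Unary using (Decidable)

  labels : ∀ n → List (Fin n)
  labels n = tabulate opposite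

  labels-descending : ∀ n → Descending (labels n)
  labels-descending n = AllPairsₚ.tabulate⁺-< {f = opposite} λ {i} {j} i<j →
    ≡.subst₂ ℕ._<_ (≡.sym (Finₚ.opposite-prop j)) (≡.sym (Finₚ.opposite-prop i))
      (ℕₚ.∸-monoʳ-< (s≤s i<j) (Finₚ.toℕ<n j))

  ∈-labels : ∀ {n} (i : Fin n) → i ∈ labels n
  ∈-labels i = ≡.subst (_∈ labels _) (Finₚ.opposite-involutive i) (∈ₚ.∈-tabulate⁺ {f = opposite} (opposite i))

  length-labels : ∀ n → length (labels n) ≡ n
  length-labels n = Listₚ.length-tabulate {n = n} opposite

  lookup-unique : ∀ {A : Set} {xs : List A} → Unique xs → ∀ {i j} → lookup xs i ≡ lookup xs j → i ≡ j
  lookup-unique (p ∷ ps) {zero}  {zero}  eq = ≡.refl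
  lookup-unique (p ∷ ps) {zero}  {suc j} eq = ⊥-elim (All.lookup p (∈ₚ.∈-lookup j) eq)
  lookup-unique (p ∷ ps) {suc i} {zero}  eq = ⊥-elim (All.lookup p (∈ₚ.∈-lookup i) (≡.sym eq))
  lookup-unique (p ∷ ps) {suc i} {suc j} eq = ≡.cong suc (lookup-unique ps eq)

  module _ {A : Set} {P Q : Pred A 0ℓ} (P? : Decidable P) (Q? : Decidable Q) (P⊆Q : P ⊆ Q) where

    filter-≤ : ∀ xs → length (filter P? xs) ℕ.≤ length (filter Q? xs)
    filter-≤ [] = z≤n
    filter-≤ (x ∷ xs) with P? x | Q? x
    ... | yes p | yes q = s≤s (filter-≤ xs)
    ... | yes p | no ¬q = ⊥-elim (¬q (P⊆Q p))
    ... | no ¬p | yes q = ℕₚ.m≤n⇒m≤1+n (filter-≤ xs)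
    ... | no ¬p | no ¬q = filter-≤ xs

    filter-< : ∀ {xs a} → a ∈ xs → ¬ P a → Q a → length (filter P? xs) ℕ.< length (filter Q? xs)
    filter-< {x ∷ xs} (here ≡.refl) ¬p q with P? x | Q? x
    ... | yes p | _     = ⊥-elim (¬p p)
    ... | no _  | no ¬q = ⊥-elim (¬q q)
    ... | no _  | yes _ = s≤s (filter-≤ xs)
    filter-< {x ∷ xs} (there a∈) ¬p q with P? x | Q? x
    ... | yes p | yes _ = s≤s (filter-< a∈ ¬p q)
    ... | yes p | no ¬q = ⊥-elim (¬q (P⊆Q p))
    ... | no _  | yes _ = ℕₚ.m≤n⇒m≤1+n (filter-< a∈ ¬p q)
    ... | no _  | no _  = filter-< a∈ ¬p q

  module Ranks (𝓡 : CompleteOrderedField) {n : ℕ} (x : RealGeometry.ℝ^ 𝓡 n) where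
    open OrderedField 𝓡

    -- Ties between coordinates are broken by the index. This makes the order linear, at the price
    -- that along it `x` increases only weakly, as the closed cones allow.
    Before : Fin n → Fin n → Set
    Before i j = x i < x j ⊎ (x i ≈ x j × i Fin.< j)

    before? : ∀ i j → Dec (Before i j)
    before? i j = (x i <? x j) ⊎-dec ((x i ≈? x j) ×-dec (i Finₚ.<? j))

    before-trans : ∀ {i j k} → Before i j → Before j k → Before i k
    before-trans (inj₁ p)       (inj₁ q)       = inj₁ (<-trans p q)
    before-trans (inj₁ p)       (inj₂ (q , _)) = inj₁ (<-≤-trans p (≈⇒≤ q))
    before-trans (inj₂ (p , _)) (inj₁ q)       = inj₁ (≤-<-trans (≈⇒≤ p) q)
    before-trans (inj₂ (p , r)) (inj₂ (q , s)) = inj₂ (trans p q , Finₚ.<-trans r s)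

    before-irrefl : ∀ {i} → ¬ Before i i
    before-irrefl (inj₁ p)       = <-irrefl refl p
    before-irrefl (inj₂ (_ , p)) = ℕₚ.<-irrefl ≡.refl p

    before-total : ∀ i j → Before i j ⊎ i ≡ j ⊎ Before j i
    before-total i j with compare (x i) (x j) | Finₚ.<-cmp i j
    ... | tri< p _ _ | _          = inj₁ (inj₁ p)
    ... | tri> _ _ p | _          = inj₂ (inj₂ (inj₁ p))
    ... | tri≈ _ p _ | tri< q _ _ = inj₁ (inj₂ (p , q))
    ... | tri≈ _ p _ | tri≈ _ q _ = inj₂ (inj₁ q)
    ... | tri≈ _ p _ | tri> _ _ q = inj₂ (inj₂ (inj₂ (sym p , q)))

    rank : Fin n → ℕ
    rank i = length (filter (λ j → before? j i) (allFin n))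

    rank-mono : ∀ {i j} → Before i j → rank i ℕ.< rank j
    rank-mono {i} {j} p = filter-< (λ k → before? k i) (λ k → before? k j) (λ q → before-trans q p)
      (∈ₚ.∈-allFin i) before-irrefl p

    rank-injective : ∀ {i j} → rank i ≡ rank j → i ≡ j
    rank-injective {i} {j} eq with before-total i j
    ... | inj₁ p        = ⊥-elim (ℕₚ.<⇒≢ (rank-mono p) eq)
    ... | inj₂ (inj₁ p) = p
    ... | inj₂ (inj₂ p) = ⊥-elim (ℕₚ.<⇒≢ (rank-mono p) (≡.sym eq))

    rank-< : ∀ i → rank i ℕ.< suc n
    rank-< i = s≤s (≡.subst (rank i ℕ.≤_) all-labels (Listₚ.length-filter (λ j → before? j i) (allFin n)))
      where
      all-labels : length (allFin n) ≡ n
      all-labels = Listₚ.length-tabulate {n = n} (λ j → j)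

    rank-order : ∀ {i j} → rank i ℕ.< rank j → x i ≤ x j
    rank-order {i} {j} p with before-total i j
    ... | inj₁ (inj₁ q)       = <⇒≤ q
    ... | inj₁ (inj₂ (q , _)) = ≈⇒≤ q
    ... | inj₂ (inj₁ ≡.refl)  = ≤-refl
    ... | inj₂ (inj₂ q)       = ⊥-elim (ℕₚ.<-asym p (rank-mono q))

  module Leveled (𝓡 : CompleteOrderedField) {n : ℕ} (ε : Fin n → Sign) (N : ℕ) (h : Fin n → ℕ)
    (h-injective : ∀ {i j} → h i ≡ h j → i ≡ j) (h<N : ∀ i → h i ℕ.< N) where
    open OrderedField 𝓡
    open RealGeometry 𝓡
    open Realise 𝓡 ε N h h-injective h<N ∈-labels (Insertion.build ε N h h-injective h<N (labels-descending n)) public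
      using (tree; tree-sign; tree-height)

    edge-levels : ∀ {i j} → Analysis.U 𝓡 tree i j → h i ℕ.< h j
    edge-levels {i} {j} (_ , p) = ℕ.s≤s⁻¹ (fromℕ-cancel-< {suc (h i)} {suc (h j)}
      (≡.subst₂ _<_ (tree-height i) (tree-height j) p))

  module Partition (𝓡 : CompleteOrderedField) (k : ℕ) (ε : Fin (suc (suc k)) → Sign) {N : ℕ}
    (T : Fin N → RealGeometry.MCT 𝓡 (suc (suc k)))
    (sign : ∀ i → RealGeometry.signVector (T i) ≗ ε)
    (classification : (T₀ : RealGeometry.MCT 𝓡 (suc (suc k))) → RealGeometry.signVector T₀ ≗ ε →
                      ∃! _≡_ (λ i → RealGeometry._≅_ 𝓡 T₀ (T i)))
    (covering : (x : RealGeometry.ℝ^ 𝓡 (suc (suc k))) →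
                Σ[ T₀ ∈ RealGeometry.MCT 𝓡 (suc (suc k)) ] RealGeometry.signVector T₀ ≗ ε × RealGeometry.R̄ 𝓡 T₀ x) where
    open OrderedField 𝓡
    open RealGeometry 𝓡
    open Isomorphism 𝓡 {suc (suc k)}

    private
      n : ℕ
      n = suc (suc k)

    private
      piece : Fin N → Pred (ℝ^ n) _
      piece i = R̄ (T i) ∩ Sphere n

      module P (i : Fin N) = Pieces 𝓡 (T i)

      module SC (i : Fin N) =
        SphereCone 𝓡 (Analysis.U 𝓡 (T i)) (Analysis.height 𝓡 (T i)) proj₂

      ≅-injective : ∀ {i j} → T i ≅ T j → i ≡ j
      ≅-injective {i} {j} iso =
        let (_ , _ , unique) = classification (T i) (sign i)
            height = Analysis.height 𝓡 (T i)
            in-R = Analysis.Rising⇒R 𝓡 (T i) {height} proj₂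
            -- Reflexivity of `_≅_`: the heights of `T i` are a common point of its cone with
            -- itself.
            self = common-point⇒≅ (T i) (T i) ε (sign i) (sign i) zero {height} in-R in-R
        in ≡.trans (≡.sym (unique self)) (unique iso)

      common-point : ∀ {i j x} → R (T i) x → R (T j) x → i ≡ j
      common-point {i} {j} {x} p q = ≅-injective (common-point⇒≅ (T i) (T j) ε
        (sign i) (sign j) zero {x} p q)

      near-trans : ∀ {δ} {x y z : ℝ^ n} → Near (½ * δ) x y → Near (½ * δ) y z → Near δ x z
      near-trans {δ} {x} {y} {z} p q i =
          <-by (+-pos (<-diff (proj₁ (p i))) (<-diff (proj₁ (q i)))) (trans (lower (½ * δ) (x i) (y i) (z i)) (+-congˡ (-‿cong (-‿cong halves))))
        , <-by (+-pos (<-diff (proj₂ (p i))) (<-diff (proj₂ (q i)))) (trans (upper (½ * δ) (x i) (y i) (z i)) (+-congʳ halves))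
        where
        lower : ∀ d x y z → (y - x - - d) + (z - y - - d) ≈ (z - x) - - (d + d)
        lower = solve 4 (λ d x y z → (y :- x :- :- d) :+ (z :- y :- :- d) := (z :- x) :- :- (d :+ d)) refl
        upper : ∀ d x y z → (d - (y - x)) + (d - (z - y)) ≈ (d + d) - (z - x)
        upper = solve 4 (λ d x y z → (d :- (y :- x)) :+ (d :- (z :- y)) := (d :+ d) :- (z :- x)) refl

      closure-idempotent : ∀ {P : Pred (ℝ^ n) _} → Closure (Closure P) ⊆ Closure P
      closure-idempotent cl 0<δ =
        let (y , near , c) = cl (*-pos 0<½ 0<δ)
            (z , near′ , p) = c (*-pos 0<½ 0<δ)
        in z , near-trans near near′ , p

      an-edge : ∀ i → ∃[ p ] ∃[ q ] Analysis.U 𝓡 (T i) p q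
      an-edge i = from (path zero (suc zero))
        where
        open Analysis.Signed 𝓡 (T i) ε (sign i)
        from : Path (Analysis.A 𝓡 (T i)) zero (suc zero) → ∃[ p ] ∃[ q ] Analysis.U 𝓡 (T i) p q
        from (go a _) with Analysis.vertical 𝓡 (T i) a
        ... | inj₁ r = _ , _ , a , r
        ... | inj₂ r = _ , _ , Analysis.Adj-sym 𝓡 (T i) a , r

      -- The open cone of `T i` contains a unit vector. If it also lies in the closed cone of `T j`,
      -- some point of `R (T j)` is close enough to belong to `R (T i)`.
      distinct : ∀ {i j} → i ≢ j → ¬ (piece i ≐ piece j)
      distinct {i} {j} i≢j (i⊆j , _) =
        let (_ , _ , u) = an-edge i
            (x , x∈S , mono) = SC.unit-vector i u
            (x∈R̄ , _) = i⊆j {x} (P.Mono≤⇒R̄ i {x} (P.Mono<⊆Mono≤ i {x} mono) , x∈S)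
            (δ , 0<δ , ball) = P.Mono<-open i {x} mono
            (y , near , r) = x∈R̄ 0<δ
        in i≢j (common-point {x = y} (Analysis.Rising⇒R 𝓡 (T i) (ball near)) r)

      relative-interior : ∀ i → RelativeInterior (Sphere n) (piece i) ⊆ R (T i)
      relative-interior i {x} (x∈S , δ , 0<δ , ball) = Analysis.Rising⇒R 𝓡 (T i)
        (SC.relative-interior⇒Mono< i {x} (x∈S , δ , 0<δ , λ {y} y∈S near →
          let (r , s) = ball y∈S near in P.R̄⇒Mono≤ i {y} r , s))

      covers : ∀ {x} → Sphere n x → ∃[ i ] piece i x
      covers {x} x∈S =
        let (T₀ , sign₀ , r) = covering x
            (i , iso , _)  = classification T₀ sign₀
        in i , P.closure-mono i {R T₀} {R (T i)} (proj₁ (≅⇒R≐ T₀ (T i) iso)) r , x∈S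

    partition : IsPartition (Sphere n) piece
    partition = record
      { within   = λ i → proj₂
      ; closed   = λ i {x} (cl , x∈S) →
          closure-idempotent {R (T i)} (P.closure-mono i {piece i} {R̄ (T i)} proj₁ {x} cl) , x∈S
      ; covers   = covers
      ; distinct = distinct
      ; disjoint = λ {i} {j} i≢j {x} (p , q) → i≢j (common-point {x = x} (relative-interior i p) (relative-interior j q))
      }

    simplex : ∀ i → IsSphericalSimplex (piece i)
    simplex i =
      let open Numbering 𝓡 (T i) ε (sign i)
          (b , basis , (to , from) , _) = simplicial-cone numbering
      in b , basis , (λ {x} (r , s) → to {x} (r , proj₁ s) , s)
                   , (λ {x} (c , s) → proj₁ (from {x} c) , s)

  module Assembly (𝓡 : CompleteOrderedField) (k : ℕ) (ε : Fin (suc (suc k)) → Sign) where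
    open OrderedField 𝓡
    open RealGeometry 𝓡
    open Isomorphism 𝓡 {suc (suc k)}
    open Cuts ε

    private
      n : ℕ
      n = suc (suc k)

    -- Taking the ranks of the coordinates of `x` as levels, every edge of the tree built on them
    -- leads from a coordinate to one at least as large.
    covering : (x : ℝ^ n) → Σ[ T ∈ MCT n ] signVector T ≗ ε × R̄ T x
    covering x = V.tree , V.tree-sign , Pieces.Mono≤⇒R̄ 𝓡 V.tree {x} (λ u → K.rank-order (V.edge-levels u))
      where
      module K = Ranks 𝓡 {n} x
      module V = Leveled 𝓡 {n} ε (suc n) K.rank (λ {i} {j} → K.rank-injective {i} {j}) K.rank-<

    private
      shape : Fin (catalan n) → Tree
      shape i = lookup (trees n) (cast (≡.sym (trees-length n)) i)

      shape-size : ∀ i → size (shape i) ≡ length (labels n)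
      shape-size i = ≡.trans (trees-size (∈ₚ.∈-lookup (cast (≡.sym (trees-length n)) i))) (≡.sym (length-labels n))

      shape-injective : ∀ {i j} → shape i ≡ shape j → i ≡ j
      shape-injective {i} {j} eq = ≡.trans (≡.sym (Finₚ.cast-involutive (trees-length n) (≡.sym (trees-length n)) i))
        (≡.trans (≡.cong (cast (trees-length n)) (lookup-unique (trees-unique n) eq))
                 (Finₚ.cast-involutive (trees-length n) (≡.sym (trees-length n)) j))

      shape-surjective : ∀ t → size t ≡ n → ∃[ i ] shape i ≡ t
      shape-surjective t eq = cast (trees-length n) (Any.index t∈)
        , ≡.trans (≡.cong (lookup (trees n)) (Finₚ.cast-involutive (≡.sym (trees-length n)) (trees-length n) (Any.index t∈)))
                  (≡.sym (Anyₚ.lookup-index t∈))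
        where
        t∈ : t ∈ trees n
        t∈ = ≡.subst (λ m → t ∈ trees m) eq (∈-trees t)

      order : Fin (catalan n) → List (Fin n)
      order i = proj₁ (code-exists (shape i) (labels n) (shape-size i))

      order-code : ∀ i → Code (shape i) (labels n) (order i)
      order-code i = proj₂ (code-exists (shape i) (labels n) (shape-size i))

      level : Fin (catalan n) → Fin n → ℕ
      level i = position (order i)

      level-injective : ∀ i {p q} → level i p ≡ level i q → p ≡ q
      level-injective i = position-injective (code-∈ (order-code i) (∈-labels _)) (code-∈ (order-code i) (∈-labels _))

      level-< : ∀ i p → level i p ℕ.< length (order i)
      level-< i p = position-< (code-∈ (order-code i) (∈-labels p))

      module L (i : Fin (catalan n)) = Leveled 𝓡 ε (length (order i)) (level i) (level-injective i) (level-< i)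

    representative : Fin (catalan n) → MCT n
    representative i = L.tree i

    representative-sign : ∀ i → signVector (representative i) ≗ ε
    representative-sign i = L.tree-sign i

    private
      point : Fin (catalan n) → ℝ^ n
      point i p = fromℕ (level i p)

      point∈R : ∀ i → R (representative i) (point i)
      point∈R i = Analysis.Rising⇒R 𝓡 (representative i)
        (λ {p} {q} u → fromℕ-mono-< {level i p} {level i q} (L.edge-levels i u))

    -- The binary tree that fits `T` encodes a linear extension of its order, so `T` shares a point
    -- of its open cone with the corresponding representative. Conversely, if
    -- `T ≅ representative j`, then `order j` extends the order of `T`, so `shape j` fits `T` by
    -- `code-fits`, and only one binary tree fits.
    classification : (T : MCT n) → signVector T ≗ ε → ∃! _≡_ (λ i → T ≅ representative i)
    classification T sign = i , iso , unique
      where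
      open Analysis.Signed 𝓡 T ε sign
      module F = Fitting ε cobinary path
      fit = F.fits-exists (labels-descending n)
      t = proj₁ fit
      o = proj₁ (proj₂ fit)
      fits : F.Fits t (labels n) o
      fits = proj₂ (proj₂ fit)
      found = shape-surjective t (≡.trans (code-size (F.fits-code fits)) (length-labels n))
      i = proj₁ found
      order≡ : o ≡ order i
      order≡ = code-unique (≡.subst (λ s → Code s (labels n) o) (≡.sym (proj₂ found)) (F.fits-code fits)) (order-code i)
      iso : T ≅ representative i
      iso = common-point⇒≅ T (representative i) ε sign (representative-sign i) zero {point i}
        (Analysis.Rising⇒R 𝓡 T (λ {p} {q} (a , r) → fromℕ-mono-< {level i p} {level i q}
          (≡.subst (λ o → position o p ℕ.< position o q) order≡ (F.fits-rising fits (∈-labels p) (∈-labels q) a r))))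
        (point∈R i)
      unique : ∀ {j} → T ≅ representative j → i ≡ j
      unique {j} iso′ = shape-injective (≡.trans (proj₂ found) (F.fits-unique (labels-descending n) fits
        (F.code-fits (level j) rise (order-code j) (labels-descending n) (λ _ _ _ → ∈-labels _)
          (position-sorted (code-distinct (order-code j) (labels-descending n))))))
        where
        rise : Structure.MonotoneFor cobinary (λ p q → level j p ℕ.< level j q)
        rise {p} {q} a r = fromℕ-cancel-< {level j p} {level j q}
          (Analysis.R⇒Rising 𝓡 T (proj₂ (≅⇒R≐ T (representative j) iso′) (point∈R j)) (a , r))

open import Data.Nat.Base using (ℕ; pred; _≤_)
corollary1 :
  (𝓡 : CompleteOrderedField) (n : ℕ) → 2 ≤ n → (ε : Fin n → Sign) →
  let open RealGeometry 𝓡 in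
  -- each R̄(T) ∩ H is a simplicial cone with one side per internal edge
  ((T : MCT n) → signVector T ≗ ε →
    EdgeNumbering T ×
    ((ℓ : EdgeNumbering T) →
      Σ[ b ∈ (Fin (pred n) → ℝ^ n) ]
        IsBasisOf (H n) b ×
        (R̄ T ∩ H n) ≐ Cone b ×
        (∀ i → Side b i ≐ ((R̄ T ∩ H n) ∩ Equaliser (edgeLeft ℓ i) (edgeRight ℓ i))))) ×
  -- the sets R̄(T) cover ℝⁿ
  ((x : ℝ^ n) → Σ[ T ∈ MCT n ] signVector T ≗ ε × R̄ T x) ×
  -- R(T) is the interior of R̄(T), depends only on the isomorphism class of T,
  -- and different classes give disjoint interiors
  ((T : MCT n) → signVector T ≗ ε → Interior (R̄ T) ≐ R T) ×
  ((T T′ : MCT n) → signVector T ≗ ε → signVector T′ ≗ ε →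
    (T ≅ T′ → R T ≐ R T′) × (¬ (T ≅ T′) → R T ⊥ R T′)) ×
  -- the isomorphism classes, C_n in number, partition the sphere into
  -- spherical simplices
  (Σ[ T ∈ (Fin (catalan n) → MCT n) ]
    (∀ i → signVector (T i) ≗ ε) ×
    ((T′ : MCT n) → signVector T′ ≗ ε → ∃! _≡_ (λ i → T′ ≅ T i)) ×
    IsPartition (Sphere n) (λ i → R̄ (T i) ∩ Sphere n) ×
    (∀ i → IsSphericalSimplex (R̄ (T i) ∩ Sphere n)))
corollary1 𝓡 (suc (suc k)) (s≤s (s≤s _)) ε =
    (λ T sign → Numbering.numbering 𝓡 T ε sign , Numbering.simplicial-cone 𝓡 T ε sign)
  , covering
  , (λ T _ → Pieces.interior-R̄ 𝓡 T)
  , (λ T T′ sign sign′ → ≅⇒R≐ T T′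
      , λ ¬iso {x} (p , q) → ¬iso (common-point⇒≅ T T′ ε sign sign′ zero {x} p q))
  , representative , representative-sign , classification , partition , simplex
  where
  open EdgeCones
  open Isomorphisms.Isomorphism 𝓡
  open Classifications.Assembly 𝓡 k ε
  open Classifications.Partition 𝓡 k ε representative representative-sign classification covering
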